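{- Let $r\geq 3$, $k\geq 1$, $p\geq 0$, $\ell_1,\dots,\ell_k\geq 5$ be integers, and if $p\geq 1$ let $t_1,\dots,t_p\geq 2$ be integers. Let $s\geq r$ be an integer and $t=\sum_{i=1}^k\lfloor\frac{\ell_i+1}{2}\rfloor+p-1$. For each $i\in[k]$ let $Q_i\in\{P_{\ell_i}^r,C_{\ell_i}^r\}$ (chosen independently). Let $n\to\infty$. (i) If $s\leq t+r-1$, then $$\mathrm{ex}_r(n,K_s^{(r)},Q_1\cup\cdots\cup Q_k\cup S^r_{t_1}\cup\cdots\cup S^r_{t_p})=(1+o(1))\,\mathcal{N}(K_s^{(r)},S_{n,t}^r)=\binom{t}{s-r+1}\frac{n^{r-1}}{(r-1)!}+o(n^{r-1}).$$ (ii) If $s\geq t+r$, then $\mathrm{ex}_r(n,K_s^{(r)},Q_1\cup\cdots\cup Q_k\cup S^r_{t_1}\cup\cdots\cup S^r_{t_p})=o(n^{r-1})$.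
   Context: An $r$-graph is a hypergraph all of whose hyperedges have exactly $r$ vertices. $K_s^{(r)}$ is the complete $r$-graph on $s$ vertices. $P_\ell$, $C_\ell$, $S_\ell$ are the path, cycle and star with $\ell$ edges. For a graph $F$, the $r$-expansion $F^r$ is obtained from $F$ by adding $r-2$ new vertices to each edge, all new vertices distinct from each other and from $V(F)$. $\cup$ denotes vertex-disjoint union (when $p=0$ there are no star components). $S_{n,t}^r$ is the $n$-vertex $r$-graph whose hyperedges are all $r$-sets intersecting a fixed set of $t$ vertices. $\mathcal{N}(\mathcal{G}_1,\mathcal{G}_2)$ is the number of copies of $\mathcal{G}_1$ in $\mathcal{G}_2$. $\mathrm{ex}_r(n,\mathcal{H},\mathcal{F})$ is the maximum number of copies of $\mathcal{H}$ in an $n$-vertex $r$-graph containing no copy of $\mathcal{F}$. -}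

module Defs where

open import Data.Nat using (ℕ; zero; suc; _+_; _*_; _∸_; _^_; _≤_; _<_; _≡ᵇ_; _/_)
open import Data.Nat.Properties using (≡ᵇ⇒≡)
open import Data.Nat.ListAction using (sum)
open import Data.Bool using (Bool; true; false; _∧_; _∨_; not; if_then_else_; T)
open import Data.Bool.Properties using (T-∧)
open import Data.Fin using (Fin; toℕ)
open import Data.Fin.Subset using (Subset; ⁅_⁆; _∪_; ∣_∣) renaming (⊥ to ∅)
open import Data.Vec using (Vec; []; _∷_; toList; zipWith; tabulate)
open import Data.List using (List; []; _∷_; map; upTo; length; filter; _++_; foldr)
open import Data.List.Relation.Unary.All using (All)
open import Data.Product using (Σ; _×_; _,_; proj₁)
open import Relation.Nullary using (¬_)
open import Relation.Binary.PropositionalEquality using (_≡_)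
open import Function.Bundles using (Equivalence)

record RGraph (r n : ℕ) : Set where
  field
    E    : Subset n → Bool
    unif : ∀ A → T (E A) → ∣ A ∣ ≡ r
open RGraph public

subsets : (n : ℕ) → List (Subset n)
subsets zero    = [] ∷ []
subsets (suc n) = map (true ∷_) (subsets n) ++ map (false ∷_) (subsets n)

_⊆ᵇ_ : ∀ {n} → Subset n → Subset n → Bool
[] ⊆ᵇ [] = true
(a ∷ A) ⊆ᵇ (b ∷ B) = (not a ∨ b) ∧ (A ⊆ᵇ B)

isCliqueᵇ : ∀ {r n} → RGraph r n → ℕ → Subset n → Bool
isCliqueᵇ {r} {n} G s S =
  (∣ S ∣ ≡ᵇ s) ∧
  foldr _∧_ true
    (map (λ A → not ((A ⊆ᵇ S) ∧ (∣ A ∣ ≡ᵇ r)) ∨ E G A) (subsets n))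

-- 𝒩(K_s^(r), G): the number of copies of K_s^(r) in G.  A copy of a
-- complete r-graph is determined by its vertex set, so this is the
-- number of s-sets spanning a clique.
numKs : ∀ {r n} → ℕ → RGraph r n → ℕ
numKs s G = length (filter (λ S → T? (isCliqueᵇ G s S)) (subsets _))
  where
  open import Relation.Nullary.Decidable using (Dec)
  open import Data.Bool.Properties using (T?)

-- Pattern (hyper)graphs with vertices labelled 0 .. verts-1.

record Graph : Set where
  field
    gverts : ℕ
    gedges : List (ℕ × ℕ)
open Graph public

record HGraph : Set where
  field
    verts : ℕ
    edges : List (List ℕ)
open HGraph public

pathG : ℕ → Graph
pathG ℓ = record { gverts = suc ℓ ; gedges = map (λ i → (i , suc i)) (upTo ℓ) }

cycleG : ℕ → Graph
cycleG ℓ = record { gverts = ℓ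
                  ; gedges = map (λ i → (i , suc i)) (upTo (ℓ ∸ 1)) ++ ((ℓ ∸ 1 , 0) ∷ []) }

starG : ℕ → Graph
starG ℓ = record { gverts = suc ℓ ; gedges = map (λ i → (0 , suc i)) (upTo ℓ) }

-- r-expansion: each edge {a,b} gets m = r-2 new vertices, all distinct,
-- numbered from the first fresh label f onwards.
expandEdges : ℕ → ℕ → List (ℕ × ℕ) → List (List ℕ)
expandEdges m f [] = []
expandEdges m f ((a , b) ∷ es) = (a ∷ b ∷ map (f +_) (upTo m)) ∷ expandEdges m (f + m) es

expansion : ℕ → Graph → HGraph
expansion r F = record
  { verts = gverts F + length (gedges F) * (r ∸ 2)
  ; edges = expandEdges (r ∸ 2) (gverts F) (gedges F) }

_⊔_ : HGraph → HGraph → HGraph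
H ⊔ H' = record
  { verts = verts H + verts H'
  ; edges = edges H ++ map (map (verts H +_)) (edges H') }

emptyH : HGraph
emptyH = record { verts = 0 ; edges = [] }

⨆ : List HGraph → HGraph
⨆ = foldr _⊔_ emptyH

Qexp : ℕ → Bool → ℕ → HGraph
Qexp r q ℓ = expansion r (if q then pathG ℓ else cycleG ℓ)

forbidden : ∀ {k p} → ℕ → Vec ℕ k → Vec Bool k → Vec ℕ p → HGraph
forbidden r ls qs ts =
  ⨆ (toList (zipWith (Qexp r) qs ls) ++ map (λ t → expansion r (starG t)) (toList ts))

image : ∀ {n} → (ℕ → Fin n) → List ℕ → Subset n
image φ e = foldr (λ x acc → ⁅ φ x ⁆ ∪ acc) ∅ e

Contains : ∀ {r n} → RGraph r n → HGraph → Set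
Contains {n = n} G H =
  Σ (ℕ → Fin n) λ φ →
    (∀ x y → x < verts H → y < verts H → φ x ≡ φ y → x ≡ y) ×
    All (λ e → T (E G (image φ e))) (edges H)

Free : ∀ {r n} → RGraph r n → HGraph → Set
Free G H = ¬ Contains G H

meetsᵇ : ∀ {n} → ℕ → Subset n → Bool
meetsᵇ t A = foldr _∨_ false (toList (zipWith (λ b i → b ∧ (suc (toℕ i) Data.Nat.≤ᵇ t)) A (tabulate (λ i → i))))
  where import Data.Nat

Snt : (r n t : ℕ) → RGraph r n
Snt r n t = record
  { E    = λ A → (∣ A ∣ ≡ᵇ r) ∧ meetsᵇ t A
  ; unif = λ A h → ≡ᵇ⇒≡ ∣ A ∣ r (proj₁ (Equivalence.to T-∧ h)) }

tParam : ∀ {k} → Vec ℕ k → ℕ → ℕ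
tParam ls p = sum (map (λ ℓ → suc ℓ / 2) (toList ls)) + p ∸ 1

module Submission where

-- Upper bound.  Let d = r - 1 and let t + 1 be the crosscut number of the forbidden graph F.
-- Delete, one after another, d-sets of codegree at most t together with the edges through
-- them.  Each deletion destroys at most C(t, s - d) copies of K_s, so at most
-- C(t, s - d) C(n, d) copies are lost; in the remaining graph G₀ every d-set of the shadow has
-- codegree at least t + 1.  A nonempty graph whose shadow codegrees exceed a large constant
-- contains F greedily, so the same deletion with a large threshold shows that G₀ has
-- O(|∂G₀|) copies of K_s, and it remains to see that |∂G₀| = o(n^d).  If the shadow is dense
-- it contains a complete d-partite d-graph (a box) with large parts.  The further vertices
-- ("colours") completing a point of the box to an edge are either popular, i.e. good for the
-- whole box, or rare.  Popular colours serve as crosscut vertices of F; with j of them, every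
-- point of the box still has t + 1 - j rare colours, and after a union bound disjoint points
-- have disjoint lists of rare colours, so that the rest of F is found greedily.
--
-- Lower bound.  A set meeting all edges of F has more than t vertices, since a vertex lies in
-- at most two edges of a path or cycle; hence S_{n,t} is F-free.

-- Every edge of a walk in the box takes a fresh index, and consecutive edges share one box vertex.
-- So only neighbouring edges can compete for a rare colour, and closing a cycle adds one more
-- conflict: three rare colours per point suffice for all pieces. The dichotomy is therefore `q ≥ 3`
-- against `q ≤ 2`, where `q` is the number of rare colours of a point. If `q ≤ 2`, then t + 1 - q
-- colours are popular. A popular colour placed as a base vertex serves two consecutive edges, which
-- is the rate of ⌊(ℓ+1)/2⌋; the deficit `q` is made up once, in the first path or cycle, by a
-- stretch of at most four edges with rare colours. This is possible because k ≥ 1 and ℓ ≥ 5. The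
-- delicate case is r = 3: the box is bipartite and has no odd plain cycle, and the detour that
-- repairs this is the reason why neighbours of pairs {c, z} take part in the cleaning. Error terms
-- live in the natural numbers: o(X) means that for each `b` the inequality multiplied by `suc b`
-- holds eventually, up to one multiple of X that does not depend on `b`.

open import Defs
open import Data.Nat hiding (_⊔_)
open import Data.Nat.Properties
open import Data.Nat.Tactic.RingSolver using (solve-∀)
open import Data.Bool using (Bool; true; false; T; _∧_; _∨_; not)
open import Data.Fin as Fin using (Fin; zero; suc; combine; remQuot; fromℕ<; toℕ)
open import Data.List using (List; []; _∷_; length; map; _++_; filter; filterᵇ; take; cartesianProductWith; cartesianProduct; allFin; concatMap; concat; upTo; applyUpTo; [_]; downFrom; foldr)
open import Data.List.Properties using (length-++; length-map; ++-assoc; map-applyUpTo; map-∘; map-cong; ∷-injectiveˡ; ∷-injectiveʳ; length-tabulate; length-upTo; ++-identityʳ; map-++)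
open import Data.List.Membership.Propositional using (_∈_; _∉_; find)
open import Data.List.Membership.Propositional.Properties
open import Data.List.Relation.Unary.Any as Any using (here; there)
open import Data.List.Relation.Unary.All as All using (All; []; _∷_)
open import Data.List.Relation.Unary.AllPairs using ([]; _∷_)
open import Data.List.Relation.Unary.Unique.Propositional using (Unique)
open import Data.Product using (∃; _×_; _,_; Σ; proj₁; proj₂)
open import Data.Sum using (inj₁; inj₂; _⊎_; [_,_]′)
open import Data.Empty using (⊥; ⊥-elim)
open import Relation.Nullary.Decidable using (⌊_⌋; ¬?; toWitness; _×-dec_)
open import Function using (_∘_; id)
open import Relation.Nullary
open import Relation.Binary.PropositionalEquality hiding ([_])
import Data.Fin.Properties as Finₚ
import Data.List.Relation.Unary.Unique.Propositional.Properties as Uniq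
import Data.List.Relation.Unary.All.Properties as Allₚ

-- Sums over lists, indicators, duplicate-free lists.

module Lists where

  open import Relation.Binary.Definitions using (DecidableEquality)

  private
    variable
      A B : Set

  ∑ : List A → (A → ℕ) → ℕ
  ∑ []       f = 0
  ∑ (x ∷ xs) f = f x + ∑ xs f

  𝟙 : Bool → ℕ
  𝟙 true  = 1
  𝟙 false = 0

  𝟙≤1 : ∀ b → 𝟙 b ≤ 1
  𝟙≤1 true  = s≤s z≤n
  𝟙≤1 false = z≤n

  𝟙-true : ∀ {b} → T b → 𝟙 b ≡ 1
  𝟙-true {true} _ = refl

  𝟙-pos : ∀ {b} → 1 ≤ 𝟙 b → T b
  𝟙-pos {true} _ = _

  𝟙-mono : ∀ {a b} → (T a → T b) → 𝟙 a ≤ 𝟙 b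
  𝟙-mono {true}  h = ≤-reflexive (sym (𝟙-true (h _)))
  𝟙-mono {false} h = z≤n

  ∑-mono : (xs : List A) {f g : A → ℕ} → (∀ x → x ∈ xs → f x ≤ g x) → ∑ xs f ≤ ∑ xs g
  ∑-mono []       h = z≤n
  ∑-mono (x ∷ xs) h = +-mono-≤ (h x (here refl)) (∑-mono xs λ y m → h y (there m))

  ∑-cong : (xs : List A) {f g : A → ℕ} → (∀ x → f x ≡ g x) → ∑ xs f ≡ ∑ xs g
  ∑-cong []       h = refl
  ∑-cong (x ∷ xs) h = cong₂ _+_ (h x) (∑-cong xs h)

  ∑-+ : (xs : List A) (f g : A → ℕ) → ∑ xs (λ x → f x + g x) ≡ ∑ xs f + ∑ xs g
  ∑-+ []       f g = refl
  ∑-+ (x ∷ xs) f g rewrite ∑-+ xs f g = +-swap-middle (f x) (g x) (∑ xs f) (∑ xs g)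
    where
    open import Data.Nat.Tactic.RingSolver using (solve-∀)
    +-swap-middle : ∀ a b c d → a + b + (c + d) ≡ a + c + (b + d)
    +-swap-middle = solve-∀

  ∑-const : (xs : List A) (c : ℕ) → ∑ xs (λ _ → c) ≡ length xs * c
  ∑-const []       c = refl
  ∑-const (x ∷ xs) c = cong (c +_) (∑-const xs c)

  ∑-*ˡ : (xs : List A) (c : ℕ) (f : A → ℕ) → ∑ xs (λ x → c * f x) ≡ c * ∑ xs f
  ∑-*ˡ []       c f = sym (*-zeroʳ c)
  ∑-*ˡ (x ∷ xs) c f rewrite ∑-*ˡ xs c f = sym (*-distribˡ-+ c (f x) _)

  ∑-*ʳ : (xs : List A) (c : ℕ) (f : A → ℕ) → ∑ xs (λ x → f x * c) ≡ ∑ xs f * c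
  ∑-*ʳ []       c f = refl
  ∑-*ʳ (x ∷ xs) c f rewrite ∑-*ʳ xs c f = sym (*-distribʳ-+ c (f x) _)

  ∑-++ : (xs ys : List A) (f : A → ℕ) → ∑ (xs ++ ys) f ≡ ∑ xs f + ∑ ys f
  ∑-++ []       ys f = refl
  ∑-++ (x ∷ xs) ys f rewrite ∑-++ xs ys f = sym (+-assoc (f x) _ _)

  ∑-map : (g : A → B) (xs : List A) (f : B → ℕ) → ∑ (map g xs) f ≡ ∑ xs (f ∘ g)
  ∑-map g []       f = refl
  ∑-map g (x ∷ xs) f = cong (f (g x) +_) (∑-map g xs f)

  ∑-swap : (xs : List A) (ys : List B) (f : A → B → ℕ) →
           ∑ xs (λ x → ∑ ys (f x)) ≡ ∑ ys (λ y → ∑ xs (λ x → f x y))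
  ∑-swap []       ys f = sym (trans (∑-const ys 0) (*-zeroʳ (length ys)))
  ∑-swap (x ∷ xs) ys f rewrite ∑-swap xs ys f = sym (∑-+ ys (f x) _)

  ∑-≤-const : (xs : List A) (f : A → ℕ) (c : ℕ) → (∀ x → x ∈ xs → f x ≤ c) → ∑ xs f ≤ length xs * c
  ∑-≤-const xs f c h = ≤-trans (∑-mono xs h) (≤-reflexive (∑-const xs c))

  ∈⇒≤∑ : (xs : List A) (f : A → ℕ) {x : A} → x ∈ xs → f x ≤ ∑ xs f
  ∈⇒≤∑ (x ∷ xs) f (here refl) = m≤m+n _ _
  ∈⇒≤∑ (x ∷ xs) f (there m)   = ≤-trans (∈⇒≤∑ xs f m) (m≤n+m _ _)

  pigeonhole : (xs : List A) (f : A → ℕ) (b : ℕ) → length xs * b < ∑ xs f → ∃ λ x → x ∈ xs × b < f x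
  pigeonhole (x ∷ xs) f b h with b <? f x
  ... | yes p = x , here refl , p
  ... | no ¬p with pigeonhole xs f b (+-cancelˡ-< b _ _ (<-≤-trans h (+-monoˡ-≤ _ (≮⇒≥ ¬p))))
  ...   | y , m , q = y , there m , q

  -- This is `pigeonhole` for the function multiplied by `length xs`, with the threshold lowered by
  -- one, so that no division by the length occurs.
  averaging : (xs : List A) (f : A → ℕ) (b : ℕ) → 0 < b → b ≤ ∑ xs f → ∃ λ x → x ∈ xs × b ≤ length xs * f x
  averaging []          f (suc b) _ ()
  averaging xs@(_ ∷ _) f (suc b) _ h = pigeonhole xs (λ x → length xs * f x) b
    (subst (length xs * b <_) (sym (∑-*ˡ xs (length xs) f)) (*-monoʳ-< (length xs) h))

  filterᵇ-∈⁺ : (p : A → Bool) {x : A} (xs : List A) → x ∈ xs → T (p x) → x ∈ filterᵇ p xs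
  filterᵇ-∈⁺ p xs m t = ∈-filter⁺ (λ y → T? (p y)) m t
    where open import Data.Bool.Properties using (T?)

  filterᵇ-∈⁻ : (p : A → Bool) {x : A} (xs : List A) → x ∈ filterᵇ p xs → x ∈ xs × T (p x)
  filterᵇ-∈⁻ p xs m = ∈-filter⁻ (λ y → T? (p y)) m
    where open import Data.Bool.Properties using (T?)

  filterᵇ-Unique : (p : A → Bool) {xs : List A} → Unique xs → Unique (filterᵇ p xs)
  filterᵇ-Unique p u = Uniq.filter⁺ (λ y → T? (p y)) u
    where open import Data.Bool.Properties using (T?)

  length-filterᵇ : (p : A → Bool) (xs : List A) → length (filterᵇ p xs) ≡ ∑ xs (𝟙 ∘ p)
  length-filterᵇ p [] = refl
  length-filterᵇ p (x ∷ xs) with p x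
  ... | true  = cong suc (length-filterᵇ p xs)
  ... | false = length-filterᵇ p xs

  Unique-head : {x : A} {xs : List A} → Unique (x ∷ xs) → x ∉ xs
  Unique-head (ne ∷ _) m = All.lookup ne m refl

  Unique-tail : {x : A} {xs : List A} → Unique (x ∷ xs) → Unique xs
  Unique-tail (_ ∷ u) = u

  Unique-∷ : {x : A} {xs : List A} → x ∉ xs → Unique xs → Unique (x ∷ xs)
  Unique-∷ {x = x} h u = All.tabulate (λ {y} m e → h (subst (_∈ _) (sym e) m)) ∷ u

  Unique-++ : {xs ys : List A} → Unique xs → Unique ys → (∀ {v} → v ∈ xs → v ∈ ys → ⊥) → Unique (xs ++ ys)
  Unique-++ u v h = Uniq.++⁺ u v (λ (a , b) → h a b)

  Unique-++⁻ : (xs : List A) {ys : List A} → Unique (xs ++ ys) →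
               Unique xs × Unique ys × (∀ {v} → v ∈ xs → v ∈ ys → ⊥)
  Unique-++⁻ []       u = [] , u , λ ()
  Unique-++⁻ (x ∷ xs) u with Unique-++⁻ xs (Unique-tail u)
  ... | a , b , c = Unique-∷ (λ m → Unique-head u (∈-++⁺ˡ m)) a , b ,
    λ { (here refl) m → Unique-head u (∈-++⁺ʳ xs m) ; (there m) m' → c m m' }

  remove : {x : A} (ys : List A) → x ∈ ys → ∃ λ zs → length ys ≡ suc (length zs) × (∀ {y} → y ≢ x → y ∈ ys → y ∈ zs)
  remove (y ∷ ys) (here refl) = ys , refl , λ { ne (here e) → ⊥-elim (ne e) ; ne (there m) → m }
  remove (y ∷ ys) (there m) with remove ys m
  ... | zs , e , h = y ∷ zs , cong suc e , λ { ne (here e') → here e' ; ne (there m') → there (h ne m') }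

  Unique-⊆-length : {xs ys : List A} → Unique xs → (∀ {x} → x ∈ xs → x ∈ ys) → length xs ≤ length ys
  Unique-⊆-length {xs = []} u h = z≤n
  Unique-⊆-length {xs = x ∷ xs} {ys} u h with remove ys (h (here refl))
  ... | zs , e , k = ≤-trans
    (s≤s (Unique-⊆-length (Unique-tail u)
      (λ m → k (λ { refl → Unique-head u m }) (h (there m)))))
    (≤-reflexive (sym e))

  take-∈ : ∀ k {x : A} {xs : List A} → x ∈ take k xs → x ∈ xs
  take-∈ (suc k) {xs = _ ∷ _} (here e)  = here e
  take-∈ (suc k) {xs = _ ∷ _} (there m) = there (take-∈ k m)

  length-take-≤ : ∀ k (xs : List A) → k ≤ length xs → length (take k xs) ≡ k
  length-take-≤ zero    xs       h       = refl
  length-take-≤ (suc k) (x ∷ xs) (s≤s h) = cong suc (length-take-≤ k xs h)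

  length-take-bound : ∀ k (xs : List A) → length (take k xs) ≤ k
  length-take-bound zero    xs       = z≤n
  length-take-bound (suc k) []       = z≤n
  length-take-bound (suc k) (x ∷ xs) = s≤s (length-take-bound k xs)

  module DecList {A : Set} (_≟_ : DecidableEquality A) where
    open import Data.List.Membership.DecPropositional _≟_ public using (_∈?_)
    open import Relation.Nullary.Decidable using (¬?)

    _∖_ : List A → List A → List A
    xs ∖ ys = filter (λ x → ¬? (x ∈? ys)) xs

    ∖-∈⁻ : ∀ xs ys {x} → x ∈ xs ∖ ys → x ∈ xs × x ∉ ys
    ∖-∈⁻ xs ys m = ∈-filter⁻ (λ x → ¬? (x ∈? ys)) m

    ∖-∈⁺ : ∀ {xs ys x} → x ∈ xs → x ∉ ys → x ∈ xs ∖ ys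
    ∖-∈⁺ m h = ∈-filter⁺ (λ x → ¬? (x ∈? _)) m h

    ∖-Unique : ∀ {xs} ys → Unique xs → Unique (xs ∖ ys)
    ∖-Unique ys u = Uniq.filter⁺ (λ x → ¬? (x ∈? ys)) u

    length-∖ : ∀ {xs} ys → Unique xs → length xs ≤ length ys + length (xs ∖ ys)
    length-∖ {xs} ys u = ≤-trans (Unique-⊆-length u cover) (≤-reflexive (length-++ ys))
      where
      cover : ∀ {x} → x ∈ xs → x ∈ ys ++ (xs ∖ ys)
      cover {x} m with x ∈? ys
      ... | yes p = ∈-++⁺ˡ p
      ... | no ¬p = ∈-++⁺ʳ ys (∖-∈⁺ m ¬p)

    avoid : ∀ {xs} ys → Unique xs → length ys < length xs → ∃ λ x → x ∈ xs × x ∉ ys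
    avoid {xs} ys u h with xs ∖ ys in eq | length-∖ ys u
    ... | []    | le = ⊥-elim (<⇒≱ h (≤-trans le (≤-reflexive (+-identityʳ _))))
    ... | z ∷ _ | le = z , ∖-∈⁻ xs ys (subst (z ∈_) (sym eq) (here refl))

-- Sums over boxes and the Erdős box theorem.

module Boxes where

  open Lists
  open import Data.Bool.ListAction using (all)
  open import Data.Vec as Vec using (Vec; []; _∷_; lookup; _[_]≔_)

  private
    variable
      V : Set
      k : ℕ

  ∑□ : Vec (List V) k → (Vec V k → ℕ) → ℕ
  ∑□ []       w = w []
  ∑□ (A ∷ As) w = ∑ A (λ x → ∑□ As (λ ω → w (x ∷ ω)))

  vol : Vec (List V) k → ℕ
  vol []       = 1
  vol (A ∷ As) = length A * vol As

  data _∈□_ {V : Set} : {k : ℕ} → Vec V k → Vec (List V) k → Set where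
    []  : [] ∈□ []
    _∷_ : ∀ {k x A} {ω : Vec V k} {As} → x ∈ A → ω ∈□ As → (x ∷ ω) ∈□ (A ∷ As)

  ∈□-lookup : {ω : Vec V k} {As : Vec (List V) k} → ω ∈□ As → ∀ i → lookup ω i ∈ lookup As i
  ∈□-lookup (m ∷ _)  zero    = m
  ∈□-lookup (_ ∷ ms) (suc i) = ∈□-lookup ms i

  ∈□-tabulate : {ω : Vec V k} {As : Vec (List V) k} → (∀ i → lookup ω i ∈ lookup As i) → ω ∈□ As
  ∈□-tabulate {ω = []}    {[]}    h = []
  ∈□-tabulate {ω = _ ∷ _} {_ ∷ _} h = h zero ∷ ∈□-tabulate (h ∘ suc)

  ∑□-mono : (As : Vec (List V) k) {w w' : Vec V k → ℕ} → (∀ ω → ω ∈□ As → w ω ≤ w' ω) → ∑□ As w ≤ ∑□ As w'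
  ∑□-mono []       h = h [] []
  ∑□-mono (A ∷ As) h = ∑-mono A λ x m → ∑□-mono As λ ω m' → h (x ∷ ω) (m ∷ m')

  ∑□-cong : (As : Vec (List V) k) {w w' : Vec V k → ℕ} → (∀ ω → w ω ≡ w' ω) → ∑□ As w ≡ ∑□ As w'
  ∑□-cong []       h = h []
  ∑□-cong (A ∷ As) h = ∑-cong A λ x → ∑□-cong As λ ω → h (x ∷ ω)

  ∑□-const : (As : Vec (List V) k) (c : ℕ) → ∑□ As (λ _ → c) ≡ vol As * c
  ∑□-const []       c = sym (+-identityʳ c)
  ∑□-const (A ∷ As) c = trans (∑-cong A λ _ → ∑□-const As c)
    (trans (∑-const A _) (sym (*-assoc (length A) (vol As) c)))

  ∑□-+ : (As : Vec (List V) k) (w w' : Vec V k → ℕ) → ∑□ As (λ ω → w ω + w' ω) ≡ ∑□ As w + ∑□ As w'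
  ∑□-+ []       w w' = refl
  ∑□-+ (A ∷ As) w w' = trans (∑-cong A λ x → ∑□-+ As _ _) (∑-+ A _ _)

  ∑□-*ˡ : (As : Vec (List V) k) (c : ℕ) (w : Vec V k → ℕ) → ∑□ As (λ ω → c * w ω) ≡ c * ∑□ As w
  ∑□-*ˡ []       c w = refl
  ∑□-*ˡ (A ∷ As) c w = trans (∑-cong A λ x → ∑□-*ˡ As c _) (∑-*ˡ A c _)

  ∑□-∑ : {X : Set} (As : Vec (List V) k) (xs : List X) (w : X → Vec V k → ℕ) →
         ∑□ As (λ ω → ∑ xs (λ x → w x ω)) ≡ ∑ xs (λ x → ∑□ As (w x))
  ∑□-∑ As []       w = trans (∑□-const As 0) (*-zeroʳ (vol As))
  ∑□-∑ As (x ∷ xs) w = trans (∑□-+ As _ _) (cong (∑□ As (w x) +_) (∑□-∑ As xs w))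

  -- The expectation argument over the natural numbers: if every point had weight at least 1, the
  -- total would reach the volume.
  ∑□-zero : (As : Vec (List V) k) (w : Vec V k → ℕ) → ∑□ As w < vol As → ∃ λ ω → ω ∈□ As × w ω ≡ 0
  ∑□-zero []       w h = [] , [] , n≤0⇒n≡0 (≤-pred h)
  ∑□-zero (A ∷ As) w h = go A h
    where
    go : ∀ A → ∑ A (λ x → ∑□ As (λ ω → w (x ∷ ω))) < length A * vol As →
         ∃ λ ω → ω ∈□ (A ∷ As) × w ω ≡ 0
    go (x ∷ A) h with ∑□ As (λ ω → w (x ∷ ω)) <? vol As
    ... | yes p with ∑□-zero As _ p
    ...   | ω , m , e = x ∷ ω , here refl ∷ m , e
    go (x ∷ A) h | no ¬p with go A (+-cancelˡ-< (vol As) _ _ (≤-<-trans (+-monoˡ-≤ _ (≮⇒≥ ¬p)) h))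
    ...   | y ∷ ω , m ∷ m' , e = y ∷ ω , there m ∷ m' , e

  -- Averaging over one coordinate: re-drawing the entry at p does not change the total.
  ∑□-resample₁ : (As : Vec (List V) k) (p : Fin k) (w : Vec V k → ℕ) →
    ∑□ As w * length (lookup As p) ≡ ∑□ As (λ ω → ∑ (lookup As p) (λ x → w (ω [ p ]≔ x)))
  ∑□-resample₁ (A ∷ As) zero w = begin
    ∑ A f * length A                                          ≡⟨ *-comm (∑ A f) (length A) ⟩
    length A * ∑ A f                                          ≡⟨ sym (∑-const A _) ⟩
    ∑ A (λ _ → ∑ A f)                                         ≡⟨ ∑-cong A (λ _ → sym (∑□-∑ As A _)) ⟩
    ∑ A (λ _ → ∑□ As (λ ω → ∑ A (λ x → w (x ∷ ω))))         ∎
    where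
    open ≡-Reasoning
    f = λ x → ∑□ As (λ ω → w (x ∷ ω))
  ∑□-resample₁ (A ∷ As) (suc p) w =
    trans (sym (∑-*ʳ A _ _)) (∑-cong A λ x → ∑□-resample₁ As p (λ ω → w (x ∷ ω)))

  updates : ∀ {h} → Vec V h → Vec (Fin h) k → Vec V k → Vec V h
  updates ω []       []       = ω
  updates ω (p ∷ ps) (x ∷ xs) = updates (ω [ p ]≔ x) ps xs

  -- Conditioning in counting form: the average of `w` is the average over `ω` of the averages over
  -- fresh values at the positions `ps`.
  ∑□-resample : ∀ {h} (As : Vec (List V) h) (ps : Vec (Fin h) k) (w : Vec V h → ℕ) →
    ∑□ As w * vol (Vec.map (lookup As) ps) ≡
    ∑□ As (λ ω → ∑□ (Vec.map (lookup As) ps) (λ xs → w (updates ω ps xs)))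
  ∑□-resample As []       w = *-identityʳ _
  ∑□-resample As (p ∷ ps) w = begin
    ∑□ As w * (length (lookup As p) * vol Bs)  ≡⟨ lem (∑□ As w) _ _ ⟩
    ∑□ As w * vol Bs * length (lookup As p)    ≡⟨ cong (_* length (lookup As p)) (∑□-resample As ps w) ⟩
    _                                          ≡⟨ ∑□-resample₁ As p _ ⟩
    _                                          ∎
    where
    open ≡-Reasoning
    Bs = Vec.map (lookup As) ps
    lem : ∀ a b c → a * (b * c) ≡ a * c * b
    lem = solve-∀

  choose : ℕ → List V → List (List V)
  choose zero    xs       = [] ∷ []
  choose (suc m) []       = []
  choose (suc m) (x ∷ xs) = map (x ∷_) (choose m xs) ++ choose (suc m) xs

  length-choose : ∀ m (xs : List V) → length (choose m xs) ≤ 2 ^ length xs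
  length-choose zero    xs       = m^n>0 2 (length xs)
  length-choose (suc m) []       = z≤n
  length-choose (suc m) (x ∷ xs) = ≤-trans
    (≤-reflexive (trans (length-++ (map (x ∷_) (choose m xs))) (cong (_+ _) (length-map (x ∷_) (choose m xs)))))
    (+-mono-≤ (length-choose m xs) (≤-trans (length-choose (suc m) xs) (m≤m+n _ 0)))

  choose-⊆ : ∀ m (xs : List V) {ys} → ys ∈ choose m xs → ∀ {y} → y ∈ ys → y ∈ xs
  choose-⊆ zero    xs       (here refl) ()
  choose-⊆ (suc m) (x ∷ xs) h p with ∈-++⁻ (map (x ∷_) (choose m xs)) h
  ... | inj₂ h' = there (choose-⊆ (suc m) xs h' p)
  ... | inj₁ h' with ∈-map⁻ (x ∷_) h'
  ...   | zs , h'' , refl with p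
  ...     | here e  = here e
  ...     | there q = there (choose-⊆ m xs h'' q)

  choose-length : ∀ m (xs : List V) {ys} → ys ∈ choose m xs → length ys ≡ m
  choose-length zero    xs       (here refl) = refl
  choose-length (suc m) (x ∷ xs) h with ∈-++⁻ (map (x ∷_) (choose m xs)) h
  ... | inj₂ h' = choose-length (suc m) xs h'
  ... | inj₁ h' with ∈-map⁻ (x ∷_) h'
  ...   | zs , h'' , refl = cong suc (choose-length m xs h'')

  choose-Unique : ∀ m {xs : List V} {ys} → Unique xs → ys ∈ choose m xs → Unique ys
  choose-Unique zero    u (here refl) = []
  choose-Unique (suc m) {x ∷ xs} u h with ∈-++⁻ (map (x ∷_) (choose m xs)) h
  ... | inj₂ h' = choose-Unique (suc m) (Unique-tail u) h'
  ... | inj₁ h' with ∈-map⁻ (x ∷_) h'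
  ...   | zs , h'' , refl = Unique-∷ (Unique-head u ∘ choose-⊆ m xs h'') (choose-Unique m (Unique-tail u) h'')

  -- Replaces the convexity estimate for binomial coefficients in the usual proof of the box
  -- theorem: a degree of at least `m` only has to yield one complete `m`-sublist.
  choose-all : ∀ m (p : V → Bool) (xs : List V) → m ≤ ∑ xs (𝟙 ∘ p) → 1 ≤ ∑ (choose m xs) (𝟙 ∘ all p)
  choose-all zero    p xs       h = s≤s z≤n
  choose-all (suc m) p (x ∷ xs) h
    rewrite ∑-++ (map (x ∷_) (choose m xs)) (choose (suc m) xs) (𝟙 ∘ all p)
          | ∑-map (x ∷_) (choose m xs) (𝟙 ∘ all p)
    with p x
  ... | true  = ≤-trans (choose-all m p xs (≤-pred h)) (m≤m+n _ _)
  ... | false = ≤-trans (choose-all (suc m) p xs h) (m≤n+m _ _)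

  all-∈ : (p : V → Bool) {xs : List V} → T (all p xs) → ∀ {x} → x ∈ xs → T (p x)
  all-∈ p {y ∷ ys} h m with p y in eq
  all-∈ p {y ∷ ys} h (here refl) | true = subst T (sym eq) _
  all-∈ p {y ∷ ys} h (there m)   | true = all-∈ p {ys} h m

  Fat : ℕ → Vec (List V) k → Set
  Fat N As = ∀ i → Unique (lookup As i) × N ≤ length (lookup As i)

  vol>0 : (As : Vec (List V) k) → Fat 1 As → 0 < vol As
  vol>0 []       h = s≤s z≤n
  vol>0 (A ∷ As) h = *-mono-≤ (proj₂ (h zero)) (vol>0 As (h ∘ suc))

  Fat-mono : ∀ {N N'} {As : Vec (List V) k} → N' ≤ N → Fat N As → Fat N' As
  Fat-mono le h i = proj₁ (h i) , ≤-trans le (proj₂ (h i))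

  ∑□-𝟙 : (As : Vec (List V) k) (R : Vec V k → Bool) → ∑□ As (𝟙 ∘ R) ≤ vol As
  ∑□-𝟙 As R = ≤-trans (∑□-mono As (λ ω _ → 𝟙≤1 (R ω)))
    (≤-reflexive (trans (∑□-const As 1) (*-identityʳ _)))

  SubBox : ℕ → Vec (List V) k → (Vec V k → Bool) → Set
  SubBox {V} {k} m As R = Σ (Vec (List V) k) λ Bs →
    (∀ i → Unique (lookup Bs i) × length (lookup Bs i) ≡ m) × (∀ ω → ω ∈□ Bs → ω ∈□ As × T (R ω))

  module _ {V : Set} {k : ℕ} (e m : ℕ) {{_ : NonZero e}} {{_ : NonZero m}} where

    private
      -- With `b` elements whose fibres have density at least 1/(2e), a point of `As` has average
      -- degree at least 2m; half of that remains after degrees below `m` are discarded.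
      b = 4 * e * m

    -- One coordinate of the Erdős box theorem: among the elements of A with a dense fibre,
    -- some m of them have a dense common fibre.
    fibre : ∀ (A : List V) (As : Vec (List V) k) (R : Vec V (suc k) → Bool) →
      Unique A → 2 * e * b < length A → 0 < vol As →
      length A * vol As ≤ e * ∑□ (A ∷ As) (𝟙 ∘ R) →
      ∃ λ A' → Unique A' × length A' ≡ m × (∀ {x} → x ∈ A' → x ∈ A) ×
        vol As ≤ 4 * e * 2 ^ b * ∑□ As (λ ω → 𝟙 (all (λ x → R (x ∷ ω)) A'))
    fibre A As R uA big pos dense = A' , choose-Unique m uB A'∈ , choose-length m B A'∈ ,
        (λ h → proj₁ (good-∈ (take-∈ b (choose-⊆ m B A'∈ h)))) , final
      where
      open ≤-Reasoning
      t = vol As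
      c : V → ℕ
      c x = ∑□ As (λ ω → 𝟙 (R (x ∷ ω)))
      good : V → Bool
      -- Fibres below half the average density carry at most half of the total, so at least |A|/(2e)
      -- elements are good.
      good x = t ≤ᵇ 2 * e * c x
      G = filterᵇ good A
      good-∈ : ∀ {x} → x ∈ G → x ∈ A × t ≤ 2 * e * c x
      good-∈ h with filterᵇ-∈⁻ good A h
      ... | h' , g = h' , ≤ᵇ⇒≤ t _ g
      split : ∀ A → 2 * e * ∑ A c ≤ length (filterᵇ good A) * (2 * e * t) + length A * t
      split [] = ≤-reflexive (*-zeroʳ (2 * e))
      split (x ∷ A) with good x in eq
      ... | true = begin
        2 * e * (c x + ∑ A c)                          ≡⟨ *-distribˡ-+ (2 * e) (c x) _ ⟩
        2 * e * c x + 2 * e * ∑ A c                    ≤⟨ +-mono-≤ (*-monoʳ-≤ (2 * e) (∑□-𝟙 As _)) (split A) ⟩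
        2 * e * t + (L * (2 * e * t) + length A * t)   ≤⟨ +-monoʳ-≤ (2 * e * t) (+-monoʳ-≤ (L * (2 * e * t)) (m≤n+m (length A * t) t)) ⟩
        2 * e * t + (L * (2 * e * t) + (t + length A * t)) ≡⟨ sym (+-assoc (2 * e * t) _ _) ⟩
        2 * e * t + L * (2 * e * t) + (t + length A * t) ∎
        where L = length (filterᵇ good A)
      ... | false = begin
        2 * e * (c x + ∑ A c)                          ≡⟨ *-distribˡ-+ (2 * e) (c x) _ ⟩
        2 * e * c x + 2 * e * ∑ A c                    ≤⟨ +-mono-≤ (<⇒≤ (≰⇒> λ p → subst T eq (≤⇒≤ᵇ {t} p))) (split A) ⟩
        t + (L * (2 * e * t) + length A * t)           ≡⟨ lem t (L * (2 * e * t)) (length A * t) ⟩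
        L * (2 * e * t) + (t + length A * t)           ∎
        where
        L = length (filterᵇ good A)
        lem : ∀ a b c → a + (b + c) ≡ b + (a + c)
        lem = solve-∀
      many : length A ≤ 2 * e * length G
      many = *-cancelʳ-≤ (length A) _ t {{>-nonZero pos}} (+-cancelʳ-≤ (length A * t) _ _ (begin
        length A * t + length A * t                    ≡⟨ lem₁ (length A) t ⟩
        2 * (length A * t)                             ≤⟨ *-monoʳ-≤ 2 dense ⟩
        2 * (e * ∑ A c)                                ≡⟨ sym (*-assoc 2 e _) ⟩
        2 * e * ∑ A c                                  ≤⟨ split A ⟩
        length G * (2 * e * t) + length A * t          ≡⟨ cong (_+ length A * t) (lem₂ (length G) (2 * e) t) ⟩
        2 * e * length G * t + length A * t            ∎))
        where
        lem₁ : ∀ a t → a * t + a * t ≡ 2 * (a * t)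
        lem₁ = solve-∀
        lem₂ : ∀ g e t → g * (e * t) ≡ e * g * t
        lem₂ = solve-∀
      b≤G : b ≤ length G
      b≤G with b ≤? length G
      ... | yes p = p
      ... | no ¬p = ⊥-elim (<⇒≱ big (≤-trans many (*-monoʳ-≤ (2 * e) (<⇒≤ (≰⇒> ¬p)))))
      B = take b G
      lenB : length B ≡ b
      lenB = length-take-≤ b G b≤G
      uB : Unique B
      uB = Uniq.take⁺ b (filterᵇ-Unique good uA)
      deg : Vec V k → ℕ
      deg ω = ∑ B (λ x → 𝟙 (R (x ∷ ω)))
      full : List V → Vec V k → Bool
      full A' ω = all (λ x → R (x ∷ ω)) A'
      total = ∑ (choose m B) (λ A' → ∑□ As (𝟙 ∘ full A'))
      -- A degree of at least `m` never exceeds `b`, and there is a complete `m`-sublist to charge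
      -- it to.
      deg≤ : ∀ ω → deg ω ≤ m + b * ∑ (choose m B) (λ A' → 𝟙 (full A' ω))
      deg≤ ω with m ≤? deg ω
      ... | no ¬p = ≤-trans (<⇒≤ (≰⇒> ¬p)) (m≤m+n m _)
      ... | yes p = begin
        deg ω             ≤⟨ ∑-≤-const B _ 1 (λ x _ → 𝟙≤1 _) ⟩
        length B * 1      ≡⟨ cong (_* 1) lenB ⟩
        b * 1             ≤⟨ *-monoʳ-≤ b (choose-all m (λ x → R (x ∷ ω)) B p) ⟩
        b * _             ≤⟨ m≤n+m _ m ⟩
        m + b * _         ∎
      ∑deg : b * t ≤ 2 * e * ∑□ As deg
      ∑deg = begin
        b * t                          ≡⟨ cong (_* t) (sym lenB) ⟩
        length B * t                   ≡⟨ sym (∑-const B t) ⟩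
        ∑ B (λ _ → t)                  ≤⟨ ∑-mono B (λ x h → proj₂ (good-∈ (take-∈ b h))) ⟩
        ∑ B (λ x → 2 * e * c x)        ≡⟨ ∑-*ˡ B (2 * e) c ⟩
        2 * e * ∑ B c                  ≡⟨ cong (2 * e *_) (sym (∑□-∑ As B _)) ⟩
        2 * e * ∑□ As deg              ∎
      ∑deg≤ : ∑□ As deg ≤ t * m + b * total
      ∑deg≤ = begin
        ∑□ As deg                                     ≤⟨ ∑□-mono As (λ ω _ → deg≤ ω) ⟩
        ∑□ As (λ ω → m + b * _)                       ≡⟨ ∑□-+ As _ _ ⟩
        ∑□ As (λ _ → m) + ∑□ As (λ ω → b * _)         ≡⟨ cong₂ _+_ (∑□-const As m) (∑□-*ˡ As b _) ⟩
        t * m + b * ∑□ As (λ ω → ∑ (choose m B) _)    ≡⟨ cong (λ z → t * m + b * z) (∑□-∑ As (choose m B) _) ⟩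
        t * m + b * total                             ∎
      t≤total : t ≤ 4 * e * total
      t≤total = *-cancelˡ-≤ (2 * e * m) {{m*n≢0 (2 * e) m {{m*n≢0 2 e}}}} (+-cancelˡ-≤ (2 * e * m * t) _ _ (begin
        2 * e * m * t + 2 * e * m * t       ≡⟨ lem₁ e m t ⟩
        4 * e * m * t                       ≤⟨ ∑deg ⟩
        2 * e * ∑□ As deg                   ≤⟨ *-monoʳ-≤ (2 * e) ∑deg≤ ⟩
        2 * e * (t * m + 4 * e * m * total) ≡⟨ lem₂ e m t total ⟩
        2 * e * m * t + 2 * e * m * (4 * e * total) ∎))
        where
        lem₁ : ∀ e m t → 2 * e * m * t + 2 * e * m * t ≡ 4 * e * m * t
        lem₁ = solve-∀
        lem₂ : ∀ e m t q → 2 * e * (t * m + 4 * e * m * q) ≡ 2 * e * m * t + 2 * e * m * (4 * e * q)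
        lem₂ = solve-∀
      pick = averaging (choose m B) (λ A' → 4 * e * ∑□ As (𝟙 ∘ full A')) t pos
               (≤-trans t≤total (≤-reflexive (sym (∑-*ˡ (choose m B) (4 * e) _))))
      A' = proj₁ pick
      A'∈ = proj₁ (proj₂ pick)
      final : t ≤ 4 * e * 2 ^ b * ∑□ As (𝟙 ∘ full A')
      final = begin
        t                                              ≤⟨ proj₂ (proj₂ pick) ⟩
        length (choose m B) * (4 * e * ∑□ As (𝟙 ∘ full A'))
          ≤⟨ *-monoˡ-≤ _ (≤-trans (length-choose m B) (≤-reflexive (cong (2 ^_) lenB))) ⟩
        2 ^ b * (4 * e * ∑□ As (𝟙 ∘ full A'))          ≡⟨ lem (2 ^ b) (4 * e) _ ⟩
        4 * e * 2 ^ b * ∑□ As (𝟙 ∘ full A')            ∎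
        where
        lem : ∀ a b c → a * (b * c) ≡ b * a * c
        lem = solve-∀

  -- Erdős's theorem on complete k-partite k-graphs, at fixed density 1/e. The type `V` is
  -- quantified inside, so that the threshold `N` cannot depend on it.
  ErdősFor : (k e m N : ℕ) → Set₁
  ErdősFor k e m N = ∀ {V : Set} (As : Vec (List V) k) → Fat N As →
    (R : Vec V k → Bool) → vol As ≤ e * ∑□ As (𝟙 ∘ R) → SubBox m As R

  SubBox-∷ : ∀ {V : Set} {k m} {A A' : List V} {As : Vec (List V) k} {R : Vec V (suc k) → Bool} →
    Unique A' → length A' ≡ m → (∀ {x} → x ∈ A' → x ∈ A) →
    SubBox m As (λ ω → all (λ x → R (x ∷ ω)) A') → SubBox m (A ∷ As) R
  SubBox-∷ {m = m} {A} {A'} {As} {R} uA' lA' A'⊆A (Bs , sizes , sub) = A' ∷ Bs , sizes' , sub'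
    where
    sizes' : ∀ i → Unique (lookup (A' ∷ Bs) i) × length (lookup (A' ∷ Bs) i) ≡ m
    sizes' zero    = uA' , lA'
    sizes' (suc i) = sizes i
    sub' : ∀ ω → ω ∈□ (A' ∷ Bs) → ω ∈□ (A ∷ As) × T (R ω)
    sub' (x ∷ ω) (p ∷ ps) = (A'⊆A p ∷ proj₁ (sub ω ps)) , all-∈ (λ x → R (x ∷ ω)) (proj₂ (sub ω ps)) p

  erdős-step : ∀ {k N} e m e' N' {{_ : NonZero e}} {{_ : NonZero m}} → 4 * e * 2 ^ (4 * e * m) ≤ e' →
    N ≤ N' → 2 * e * (4 * e * m) < N' → ErdősFor k e' m N → ErdősFor (suc k) e m N'
  erdős-step {k} {N} e m e' N' le N≤ big rec (A ∷ As) fat R dense =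
    let A' , uA' , lA' , A'⊆A , dense' =
          fibre e m A As R (proj₁ (fat zero)) (≤-trans big (proj₂ (fat zero)))
           (vol>0 As (Fat-mono {As = As} (≤-trans (s≤s z≤n) big) (fat ∘ suc))) dense
    in SubBox-∷ uA' lA' A'⊆A (rec As (Fat-mono {As = As} N≤ (fat ∘ suc))
           (λ ω → all (λ x → R (x ∷ ω)) A') (≤-trans dense' (*-monoˡ-≤ _ le)))

  erdős : ∀ k e m → {{NonZero e}} → {{NonZero m}} → Σ ℕ (ErdősFor k e m)
  erdős zero e m = 0 , λ { [] _ R h → [] , (λ ()) , λ { [] _ → [] , 𝟙-pos (nz e (𝟙 (R [])) h) } }
    where
    nz : ∀ e x → 1 ≤ e * x → 1 ≤ x
    nz e zero    h = ⊥-elim (1+n≰n (≤-trans h (≤-reflexive (*-zeroʳ e))))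
    nz e (suc x) h = s≤s z≤n
  erdős (suc k) e m =
    -- The density that `fibre` leaves for the remaining coordinates; the `suc` makes it visibly
    -- nonzero.
    let N , rec = erdős k (suc (4 * e * 2 ^ (4 * e * m))) m
        N'      = suc (N + 2 * e * (4 * e * m))
    in N' , erdős-step e m (suc (4 * e * 2 ^ (4 * e * m))) N' (n≤1+n _)
              (m≤n⇒m≤1+n (m≤m+n N _)) (s≤s (m≤n+m _ N)) rec

-- A union bound: vertices chosen so that disjoint points have unrelated colour lists.

module Clean where

  open Lists
  open Boxes
  open import Data.Fin.Properties using (remQuot-combine; combine-injective)
  open import Data.Vec as Vec using (Vec; []; _∷_; lookup; _[_]≔_; tabulate)
  open import Data.Vec.Properties using (lookup∘tabulate; lookup∘update; lookup∘update′; lookup-map; tabulate-cong)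
  open import Relation.Binary.Definitions using (DecidableEquality)

  allVec : {X : Set} → List X → ∀ k → List (Vec X k)
  allVec xs zero    = [] ∷ []
  allVec xs (suc k) = cartesianProductWith _∷_ xs (allVec xs k)

  ∈-allVec : {X : Set} {xs : List X} {k : ℕ} → (∀ x → x ∈ xs) → (v : Vec X k) → v ∈ allVec xs k
  ∈-allVec h []      = here refl
  ∈-allVec h (x ∷ v) = ∈-cartesianProductWith⁺ _∷_ (h x) (∈-allVec h v)

  vec-ext : {X : Set} {k : ℕ} {u v : Vec X k} → (∀ i → lookup u i ≡ lookup v i) → u ≡ v
  vec-ext {u = []}    {[]}    h = refl
  vec-ext {u = _ ∷ _} {_ ∷ _} h = cong₂ _∷_ (h zero) (vec-ext (h ∘ suc))

  module _ {V : Set} {h : ℕ} where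

    updates-∉ : ∀ {k} (ω : Vec V h) (ps : Vec (Fin h) k) xs {p} → (∀ i → lookup ps i ≢ p) →
                lookup (updates ω ps xs) p ≡ lookup ω p
    updates-∉ ω []       []       ne = refl
    updates-∉ ω (q ∷ ps) (x ∷ xs) ne =
      trans (updates-∉ _ ps xs (ne ∘ suc)) (lookup∘update′ (ne zero ∘ sym) ω x)

    updates-∈ : ∀ {k} (ω : Vec V h) (ps : Vec (Fin h) k) xs →
                (∀ i j → lookup ps i ≡ lookup ps j → i ≡ j) →
                ∀ i → lookup (updates ω ps xs) (lookup ps i) ≡ lookup xs i
    updates-∈ ω (q ∷ ps) (x ∷ xs) inj zero    =
      trans (updates-∉ _ ps xs (λ i e → Finₚ.0≢1+n (sym (inj (suc i) zero e)))) (lookup∘update q ω x)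
    updates-∈ ω (q ∷ ps) (x ∷ xs) inj (suc i) =
      updates-∈ _ ps xs (λ i j e → Finₚ.suc-injective (inj _ _ e)) i

    -- A union bound is run over the coordinates of gs; re-drawing the positions ps first
    -- bounds the weight of one event.
    event-bound : ∀ {k} (gs : Vec (List V) h) (ps : Vec (Fin h) k) (As : Vec (List V) k) →
      Vec.map (lookup gs) ps ≡ As → 0 < vol As → (w : Vec V h → ℕ) (e Q : ℕ) →
      (∀ ω → ω ∈□ gs → e * ∑□ As (λ xs → w (updates ω ps xs)) ≤ Q * vol As) →
      e * ∑□ gs w ≤ Q * vol gs
    event-bound gs ps As refl pos w e Q hyp = *-cancelʳ-≤ _ _ (vol As) {{>-nonZero pos}} (begin
      e * ∑□ gs w * vol As                                       ≡⟨ *-assoc e _ _ ⟩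
      e * (∑□ gs w * vol As)                                     ≡⟨ cong (e *_) (∑□-resample gs ps w) ⟩
      e * ∑□ gs (λ ω → ∑□ As (λ xs → w (updates ω ps xs)))       ≡⟨ sym (∑□-*ˡ gs e _) ⟩
      ∑□ gs (λ ω → e * ∑□ As (λ xs → w (updates ω ps xs)))       ≤⟨ ∑□-mono gs hyp ⟩
      ∑□ gs (λ ω → Q * vol As)                                   ≡⟨ ∑□-const gs _ ⟩
      vol gs * (Q * vol As)                                      ≡⟨ lem (vol gs) Q _ ⟩
      Q * vol gs * vol As                                        ∎)
      where
      open ≤-Reasoning
      lem : ∀ a b c → a * (b * c) ≡ b * a * c
      lem = solve-∀

    -- Each event has expected weight at most Q/e, so the expected total is below 1 and some point
    -- has weight 0 for all events.
    union-bound : {X : Set} (gs : Vec (List V) h) (evs : List X) (w : X → Vec V h → ℕ) (e Q : ℕ) →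
      0 < vol gs → length evs * Q < e → (∀ x → x ∈ evs → e * ∑□ gs (w x) ≤ Q * vol gs) →
      ∃ λ ω → ω ∈□ gs × (∀ x → x ∈ evs → w x ω ≡ 0)
    union-bound gs evs w e Q pos big hyp =
      let ω , m , z = ∑□-zero gs (λ ω → ∑ evs (λ x → w x ω)) small
      in  ω , m , λ x x∈ → n≤0⇒n≡0 (≤-trans (∈⇒≤∑ evs (λ x → w x ω) x∈) (≤-reflexive z))
      where
      open ≤-Reasoning
      small : ∑□ gs (λ ω → ∑ evs (λ x → w x ω)) < vol gs
      small = *-cancelˡ-< e _ _ (begin-strict
        e * ∑□ gs (λ ω → ∑ evs (λ x → w x ω))   ≡⟨ cong (e *_) (∑□-∑ gs evs w) ⟩
        e * ∑ evs (λ x → ∑□ gs (w x))           ≡⟨ sym (∑-*ˡ evs e _) ⟩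
        ∑ evs (λ x → e * ∑□ gs (w x))           ≤⟨ ∑-≤-const evs _ (Q * vol gs) hyp ⟩
        length evs * (Q * vol gs)               ≡⟨ sym (*-assoc (length evs) Q _) ⟩
        length evs * Q * vol gs                 <⟨ *-monoˡ-< (vol gs) {{>-nonZero pos}} big ⟩
        e * vol gs                              ∎)

  lookup-pos : ∀ {V : Set} {d} M (As : Vec (List V) d) (i : Fin d) (a : Fin M) →
    lookup (tabulate {n = d * M} (λ p → lookup As (proj₁ (remQuot {d} M p)))) (combine i a) ≡ lookup As i
  lookup-pos M As i a = trans (lookup∘tabulate _ (combine i a)) (cong (lookup As ∘ proj₁) (remQuot-combine i a))

  ∑-≟ : {V : Set} (_≟_ : DecidableEquality V) (xs : List V) (c : V) → Unique xs →
        ∑ xs (λ x → 𝟙 ⌊ x ≟ c ⌋) ≤ 1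
  ∑-≟ _≟_ []       c u = z≤n
  ∑-≟ _≟_ (x ∷ xs) c u with x ≟ c
  ... | no _     = ∑-≟ _≟_ xs c (Unique-tail u)
  ... | yes refl = s≤s (≤-trans (∑-≤-const xs _ 0 none) (≤-reflexive (*-zeroʳ (length xs))))
    where
    none : ∀ y → y ∈ xs → 𝟙 ⌊ y ≟ x ⌋ ≤ 0
    none y m with y ≟ x
    ... | yes refl = ⊥-elim (Unique-head u m)
    ... | no _     = z≤n

  𝟙⌊⌋-zero : {P : Set} (p? : Dec P) → 𝟙 ⌊ p? ⌋ ≡ 0 → ¬ P
  𝟙⌊⌋-zero (no ¬p) _ p = ¬p p

  ∑-zero : {X : Set} (xs : List X) (f : X → ℕ) → ∑ xs f ≡ 0 → ∀ {x} → x ∈ xs → f x ≡ 0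
  ∑-zero xs f z m = n≤0⇒n≡0 (≤-trans (∈⇒≤∑ xs f m) (≤-reflexive z))

  -- Of the points spanned by `M` chosen vertices per class, only those with a common index in some
  -- class may interact. The condition is asymmetric because `Λ` will be the larger list `Reach L`:
  -- nothing that an edge at one point brings in is a colour of a disjoint point.
  Selection : ∀ {V : Set} {d} (M : ℕ) → Vec (List V) d → (L Λ : Vec V d → List V) → Set
  Selection {V} {d} M As L Λ = Σ (Fin d → Fin M → V) λ B → (∀ i a → B i a ∈ lookup As i) ×
    (∀ (t t' : Fin d → Fin M) → (∀ i → t i ≢ t' i) → ∀ {c} →
      c ∈ Λ (tabulate (λ i → B i (t i))) → c ∉ L (tabulate (λ i → B i (t' i)))) ×
    (∀ (t : Fin d → Fin M) i a → t i ≢ a → B i a ∉ Λ (tabulate (λ i → B i (t i))))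

  module CleanUp (d M Q : ℕ) where

    Idx : Set
    Idx = Vec (Fin M) d

    Event : Set
    Event = (Idx × Idx) ⊎ (Idx × (Fin d × Fin M))

    idxs : List Idx
    idxs = allVec (allFin M) d

    Disj : Idx → Idx → Set
    Disj t t' = ∀ i → lookup t i ≢ lookup t' i

    disj? : ∀ t t' → Dec (Disj t t')
    disj? t t' = Finₚ.all? λ i → ¬? (lookup t i Finₚ.≟ lookup t' i)

    free? : (x : Idx × (Fin d × Fin M)) → Dec (lookup (proj₁ x) (proj₁ (proj₂ x)) ≢ proj₂ (proj₂ x))
    free? (t , i , a) = ¬? (lookup t i Finₚ.≟ a)

    pairs : List (Idx × Idx)
    pairs = filter (λ x → disj? (proj₁ x) (proj₂ x)) (cartesianProduct idxs idxs)

    slots : List (Idx × (Fin d × Fin M))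
    slots = filter free? (cartesianProduct idxs (cartesianProduct (allFin d) (allFin M)))

    events : List Event
    events = map inj₁ pairs ++ map inj₂ slots

    e : ℕ
    -- The least value for which `union-bound` applies; it depends on `d`, `M` and `Q`, hence not on
    -- the size of the graph.
    e = suc (length events * Q)

    module _ {V : Set} (_≟_ : DecidableEquality V) (As : Vec (List V) d) (fat : Fat e As)
             (L Λ : Vec V d → List V)
             (Λ-small : ∀ ω → ω ∈□ As → length (Λ ω) ≤ Q)
             (rare : ∀ c → e * ∑□ As (λ ω → 𝟙 ⌊ DecList._∈?_ _≟_ c (L ω) ⌋) ≤ vol As)
      where
      open DecList _≟_ using (_∈?_)

      private
        -- All vertices are drawn independently: coordinate `combine i a` of one large product holds
        -- the vertex with index `a` in class `i`.
        h = d * M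
        gs : Vec (List V) h
        gs = tabulate (λ p → lookup As (proj₁ (remQuot {d} M p)))

        pos : Idx → Vec (Fin h) d
        pos t = tabulate (λ i → combine i (lookup t i))

        pos-inj : ∀ t i j → lookup (pos t) i ≡ lookup (pos t) j → i ≡ j
        pos-inj t i j eq = proj₁ (combine-injective i (lookup t i) j (lookup t j)
          (trans (sym (lookup∘tabulate (λ i → combine i (lookup t i)) i))
            (trans eq (lookup∘tabulate (λ i → combine i (lookup t i)) j))))

        pos-gs : ∀ t → Vec.map (lookup gs) (pos t) ≡ As
        pos-gs t = vec-ext λ i → trans (lookup-map i (lookup gs) (pos t))
          (trans (cong (lookup gs) (lookup∘tabulate _ i)) (lookup-pos M As i (lookup t i)))

        at : Vec V h → Idx → Vec V d
        at ω t = tabulate (λ i → lookup ω (combine i (lookup t i)))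

        at-∈ : ∀ {ω} → ω ∈□ gs → ∀ t → at ω t ∈□ As
        at-∈ {ω} m t = ∈□-tabulate λ i → subst₂ _∈_ (sym (lookup∘tabulate _ i))
          (lookup-pos M As i (lookup t i)) (∈□-lookup m (combine i (lookup t i)))

        at-upd : ∀ ω t xs → at (updates ω (pos t) xs) t ≡ xs
        at-upd ω t xs = vec-ext λ i → trans (lookup∘tabulate _ i)
          (trans (cong (lookup (updates ω (pos t) xs)) (sym (lookup∘tabulate (λ i → combine i (lookup t i)) i)))
            (updates-∈ ω (pos t) xs (pos-inj t) i))

        at-upd-∉ : ∀ {k} ω t (ps : Vec (Fin h) k) xs → (∀ i j → lookup ps j ≢ combine i (lookup t i)) →
                   at (updates ω ps xs) t ≡ at ω t
        at-upd-∉ ω t ps xs ne = vec-ext λ i → trans (lookup∘tabulate _ i)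
          (trans (updates-∉ ω ps xs (ne i)) (sym (lookup∘tabulate _ i)))

        weight : Event → Vec V h → ℕ
        weight (inj₁ (t , t'))    ω = ∑ (Λ (at ω t)) (λ c → 𝟙 ⌊ c ∈? L (at ω t') ⌋)
        weight (inj₂ (t , i , a)) ω = ∑ (Λ (at ω t)) (λ c → 𝟙 ⌊ lookup ω (combine i a) ≟ c ⌋)

        vol-As : 0 < vol As
        vol-As = vol>0 As (Fat-mono {As = As} (s≤s z≤n) fat)

        -- Everything outside the positions of `t'` is held fixed. As the index tuples are disjoint,
        -- the list at `t` does not change while the point at `t'` runs through the whole box, and
        -- each of its at most `Q` members is a colour there with density at most 1/e.
        bound₁ : ∀ t t' → Disj t t' → e * ∑□ gs (weight (inj₁ (t , t'))) ≤ Q * vol gs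
        bound₁ t t' dj = event-bound gs (pos t') As (pos-gs t') vol-As _ e Q body
          where
          open ≤-Reasoning
          body : ∀ ω → ω ∈□ gs → e * ∑□ As (λ xs → weight (inj₁ (t , t')) (updates ω (pos t') xs)) ≤ Q * vol As
          body ω m = begin
            e * ∑□ As (λ xs → weight (inj₁ (t , t')) (updates ω (pos t') xs))
              ≡⟨ cong (e *_) (∑□-cong As λ xs → cong₂ (λ u v → ∑ (Λ u) (λ c → 𝟙 ⌊ c ∈? L v ⌋))
                   (at-upd-∉ ω t (pos t') xs ne) (at-upd ω t' xs)) ⟩
            e * ∑□ As (λ xs → ∑ Λω (λ c → 𝟙 ⌊ c ∈? L xs ⌋))   ≡⟨ cong (e *_) (∑□-∑ As Λω _) ⟩
            e * ∑ Λω (λ c → ∑□ As (λ xs → 𝟙 ⌊ c ∈? L xs ⌋))   ≡⟨ sym (∑-*ˡ Λω e _) ⟩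
            ∑ Λω (λ c → e * ∑□ As (λ xs → 𝟙 ⌊ c ∈? L xs ⌋))   ≤⟨ ∑-≤-const Λω _ (vol As) (λ c _ → rare c) ⟩
            length Λω * vol As                                ≤⟨ *-monoˡ-≤ (vol As) (Λ-small _ (at-∈ m t)) ⟩
            Q * vol As                                        ∎
            where
            Λω = Λ (at ω t)
            ne : ∀ i j → lookup (pos t') j ≢ combine i (lookup t i)
            ne i j eq with combine-injective j (lookup t' j) i (lookup t i)
                             (trans (sym (lookup∘tabulate (λ i → combine i (lookup t' i)) j)) eq)
            ... | refl , q = dj i (sym q)

        -- Re-drawing a slot that `t` does not use leaves the list at `t` unchanged; each of its at
        -- most `Q` members equals at most one of the at least `e` candidates for the slot.
        bound₂ : ∀ t i a → lookup t i ≢ a → e * ∑□ gs (weight (inj₂ (t , i , a))) ≤ Q * vol gs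
        bound₂ t i a ne = event-bound gs (combine i a ∷ []) (lookup As i ∷ [])
            (cong (_∷ []) (lookup-pos M As i a)) (*-mono-≤ (≤-trans (s≤s z≤n) (proj₂ (fat i))) (s≤s z≤n)) _ e Q body
          where
          open ≤-Reasoning
          p = combine i a
          A = lookup As i
          body : ∀ ω → ω ∈□ gs →
            e * ∑□ (A ∷ []) (λ xs → weight (inj₂ (t , i , a)) (updates ω (p ∷ []) xs)) ≤ Q * vol (A ∷ [])
          body ω m = begin
            e * ∑ A (λ x → weight (inj₂ (t , i , a)) (ω [ p ]≔ x))
              ≡⟨ cong (e *_) (∑-cong A λ x → cong₂ (λ u v → ∑ (Λ u) (λ c → 𝟙 ⌊ v ≟ c ⌋))
                   (at-upd-∉ ω t (p ∷ []) (x ∷ []) (λ { j zero → ne' j })) (lookup∘update p ω x)) ⟩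
            e * ∑ A (λ x → ∑ Λω (λ c → 𝟙 ⌊ x ≟ c ⌋))     ≡⟨ cong (e *_) (∑-swap A Λω _) ⟩
            e * ∑ Λω (λ c → ∑ A (λ x → 𝟙 ⌊ x ≟ c ⌋))
              ≤⟨ *-monoʳ-≤ e (∑-≤-const Λω _ 1 (λ c _ → ∑-≟ _≟_ A c (proj₁ (fat i)))) ⟩
            e * (length Λω * 1)                          ≤⟨ *-monoʳ-≤ e (*-monoˡ-≤ 1 (Λ-small _ (at-∈ m t))) ⟩
            e * (Q * 1)                                  ≡⟨ lem e Q ⟩
            Q * (e * 1)                                  ≤⟨ *-monoʳ-≤ Q (*-monoˡ-≤ 1 (proj₂ (fat i))) ⟩
            Q * (length A * 1)                           ∎
            where
            Λω = Λ (at ω t)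
            ne' : ∀ j → p ≢ combine j (lookup t j)
            ne' j eq with combine-injective i a j (lookup t j) eq
            ... | refl , q = ne (sym q)
            lem : ∀ a b → a * (b * 1) ≡ b * (a * 1)
            lem = solve-∀

        bound : ∀ x → x ∈ events → e * ∑□ gs (weight x) ≤ Q * vol gs
        bound x m with ∈-++⁻ (map inj₁ pairs) m
        ... | inj₁ m' with ∈-map⁻ inj₁ m'
        ...   | (t , t') , q , refl =
                bound₁ t t' (proj₂ (∈-filter⁻ (λ x → disj? (proj₁ x) (proj₂ x)) {xs = cartesianProduct idxs idxs} q))
        bound x m | inj₂ m' with ∈-map⁻ inj₂ m'
        ...   | (t , i , a) , q , refl =
                bound₂ t i a (proj₂ (∈-filter⁻ free? {xs = cartesianProduct idxs (cartesianProduct (allFin d) (allFin M))} q))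

        fat-gs : Fat 1 gs
        fat-gs p = subst (λ A → Unique A × 1 ≤ length A) (sym (lookup∘tabulate _ p))
          (proj₁ (fat _) , ≤-trans (s≤s z≤n) (proj₂ (fat _)))

        solution = union-bound gs events weight e Q (vol>0 gs fat-gs) ≤-refl bound
        ω₀ = proj₁ solution

        B : Fin d → Fin M → V
        B i a = lookup ω₀ (combine i a)

        tuple : (Fin d → Fin M) → Vec V d
        tuple t = tabulate (λ i → B i (t i))

        tuple-at : ∀ t → at ω₀ (tabulate t) ≡ tuple t
        tuple-at t = tabulate-cong λ i → cong (B i) (lookup∘tabulate t i)

        B-∈ : ∀ i a → B i a ∈ lookup As i
        B-∈ i a = subst (B i a ∈_) (lookup-pos M As i a) (∈□-lookup (proj₁ (proj₂ solution)) (combine i a))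

        clean-L : ∀ t t' → (∀ i → t i ≢ t' i) → ∀ {c} → c ∈ Λ (tuple t) → c ∉ L (tuple t')
        clean-L t t' dj {c} c∈ = subst (λ v → c ∉ L v) (tuple-at t')
          (𝟙⌊⌋-zero (c ∈? _) (∑-zero (Λ (at ω₀ u)) _ (proj₂ (proj₂ solution) (inj₁ (u , u')) ev∈)
            (subst (λ v → c ∈ Λ v) (sym (tuple-at t)) c∈)))
          where
          u  = tabulate t
          u' = tabulate t'
          ev∈ : inj₁ (u , u') ∈ events
          ev∈ = ∈-++⁺ˡ (∈-map⁺ inj₁ (∈-filter⁺ (λ x → disj? (proj₁ x) (proj₂ x))
            (∈-cartesianProduct⁺ (∈-allVec ∈-allFin u) (∈-allVec ∈-allFin u'))
            (λ i q → dj i (trans (sym (lookup∘tabulate t i)) (trans q (lookup∘tabulate t' i))))))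

        clean-B : ∀ t i a → t i ≢ a → B i a ∉ Λ (tuple t)
        clean-B t i a ne c∈ =
          𝟙⌊⌋-zero (B i a ≟ B i a) (∑-zero (Λ (at ω₀ u)) _ (proj₂ (proj₂ solution) (inj₂ (u , i , a)) ev∈)
            (subst (λ v → B i a ∈ Λ v) (sym (tuple-at t)) c∈)) refl
          where
          u = tabulate t
          ev∈ : inj₂ (u , i , a) ∈ events
          ev∈ = ∈-++⁺ʳ (map inj₁ pairs) (∈-map⁺ inj₂ (∈-filter⁺ free?
            (∈-cartesianProduct⁺ (∈-allVec ∈-allFin u) (∈-cartesianProduct⁺ (∈-allFin i) (∈-allFin a)))
            (λ q → ne (trans (sym (lookup∘tabulate t i)) q))))

      select : Selection M As L Λ
      select = B , B-∈ , clean-L , clean-B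

-- Popular colours and clean boxes.

module Hyper where

  open Lists
  open Boxes
  open Clean
  open import Data.Nat.DivMod using (m%n<n; m<n⇒m%n≡m)
  open import Data.Vec as Vec using (Vec; []; _∷_; lookup; tabulate; toList)
  open import Data.Vec.Properties using (lookup∘tabulate; length-toList)

  _⊆_ : {A : Set} → List A → List A → Set
  xs ⊆ ys = ∀ {x} → x ∈ xs → x ∈ ys

  -- Edges are tested on lists, so that a colour is simply consed to a point of the box. `E-resp`
  -- allows reordering, and `E-uniq` turns the length of an edge into distinctness of its vertices.
  record IsHypergraph (n r : ℕ) (E : List (Fin n) → Bool) : Set where
    field
      E-resp : ∀ {l l'} → l ⊆ l' → l' ⊆ l → T (E l) → T (E l')
      E-uniq : ∀ l → length l ≡ r → T (E l) → Unique l

  concatMap-length : {A B : Set} (f : A → List B) (b : ℕ) (xs : List A) → (∀ x → length (f x) ≤ b) →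
                     length (concatMap f xs) ≤ length xs * b
  concatMap-length f b []       h = z≤n
  concatMap-length f b (x ∷ xs) h = ≤-trans (≤-reflexive (length-++ (f x))) (+-mono-≤ (h x) (concatMap-length f b xs h))

  module Core {n d : ℕ} (E : List (Fin n) → Bool) (hyp : IsHypergraph n (suc d) E) (t₁ : ℕ) where

    open IsHypergraph hyp public
    open DecList (Finₚ._≟_ {n}) public

    V : Set
    V = Fin n

    Edge : List V → Set
    Edge l = T (E l)

    nbrs : List V → List V
    nbrs f = filterᵇ (λ x → E (x ∷ f)) (allFin n)

    nbrs-∈ : ∀ {f x} → x ∈ nbrs f → Edge (x ∷ f)
    nbrs-∈ m = proj₂ (filterᵇ-∈⁻ _ (allFin n) m)

    nbrs-Unique : ∀ f → Unique (nbrs f)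
    nbrs-Unique f = filterᵇ-Unique _ (Uniq.allFin⁺ n)

    -- The state in which peeling stops; `x` only witnesses that `f` lies in the shadow.
    Full : ℕ → Set
    Full a = ∀ f → length f ≡ d → ∀ x → Edge (x ∷ f) → a ≤ length (nbrs f)

    -- Everything that an edge c ∷ ω with a colour c of the list L ω may bring into play: its
    -- vertices, all the colours of ω, and (for 3-graphs) t₁ neighbours of each pair {c, z}.
    Reach : (Vec V d → List V) → Vec V d → List V
    Reach L ω = toList ω ++ L ω ++
      concatMap (λ c → concatMap (λ z → take t₁ (nbrs (c ∷ z ∷ []))) (toList ω)) (L ω)

    -- Indices are natural numbers below `M` rather than elements of `Fin M`, so that a smaller box
    -- can be cut out by adding an offset. `PL-size` splits the `t₁` colours of a point into those
    -- common to the whole box and its own `q`.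
    record CleanBox (P : List V) (q : ℕ) (L : Vec V d → List V) (M : ℕ) (B : Fin d → ℕ → V) : Set where
      tup : (Fin d → ℕ) → Vec V d
      tup τ = tabulate (λ i → B i (τ i))

      Valid : (Fin d → ℕ) → Set
      Valid τ = ∀ i → τ i < M

      field
        P-uniq  : Unique P
        PL-size : length P + q ≡ t₁
        P-edge  : ∀ {τ c} → Valid τ → c ∈ P → Edge (c ∷ toList (tup τ))
        L-edge  : ∀ {τ c} → Valid τ → c ∈ L (tup τ) → Edge (c ∷ toList (tup τ))
        L-∉P    : ∀ {τ c} → Valid τ → c ∈ L (tup τ) → c ∉ P
        L-size  : ∀ {τ} → Valid τ → length (L (tup τ)) ≡ q
        L-uniq  : ∀ {τ} → Valid τ → Unique (L (tup τ))
        L-clean : ∀ {τ τ' c} → Valid τ → Valid τ' → (∀ i → τ i ≢ τ' i) →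
                  c ∈ Reach L (tup τ) → c ∉ L (tup τ')
        B-clean : ∀ {τ i a} → Valid τ → a < M → τ i ≢ a → B i a ∉ Reach L (tup τ)

  HasCleanBox : ∀ {n d} (E : List (Fin n) → Bool) → IsHypergraph n (suc d) E → ℕ → ℕ → Set
  HasCleanBox {n} {d} E hyp t₁ M = Σ (List (Fin n)) λ P → Σ ℕ λ q → Σ (Vec (Fin n) d → List (Fin n)) λ L →
    Σ (Fin d → ℕ → Fin n) λ B → Core.CleanBox E hyp t₁ P q L M B

  module _ (d t₁ M : ℕ) {{_ : NonZero M}} where

    private
      -- The terms bound the three parts of `Reach`: the point, its colours, and `t₁` neighbours for
      -- each pair of a colour and a vertex of the point.
      Q = d + (t₁ + t₁ * (d * t₁))
      module CU = CleanUp d M Q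

    cleanUp : ∀ {n} (E : List (Fin n) → Bool) (hyp : IsHypergraph n (suc d) E) →
      let open Core E hyp t₁ in
      (As : Vec (List V) d) → Fat CU.e As → (P : List V) (q : ℕ) → Unique P → length P + q ≡ t₁ →
      (∀ c ω → c ∈ P → ω ∈□ As → Edge (c ∷ toList ω)) →
      (L : Vec V d → List V) → (∀ ω → length (L ω) ≤ t₁) → (∀ ω → Unique (L ω)) →
      (∀ ω → ω ∈□ As → length (L ω) ≡ q) →
      (∀ ω c → c ∈ L ω → Edge (c ∷ toList ω) × c ∉ P) →
      (∀ c → CU.e * ∑□ As (λ ω → 𝟙 ⌊ c ∈? L ω ⌋) ≤ vol As) →
      HasCleanBox E hyp t₁ M
    cleanUp {n} E hyp As fat P q uP size P-edge L L≤ L-uniq L-size L-edge rare =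
      build (CU.select Finₚ._≟_ As fat L (Reach L) (λ ω _ → Λ-small ω) rare)
      where
      open Core E hyp t₁
      open ≤-Reasoning
      Λ-small : ∀ ω → length (Reach L ω) ≤ Q
      Λ-small ω = begin
        length (Reach L ω)           ≡⟨ length-++ (toList ω) ⟩
        length (toList ω) + length (L ω ++ N)
          ≡⟨ cong₂ _+_ (length-toList ω) (length-++ (L ω)) ⟩
        d + (length (L ω) + length N)
          ≤⟨ +-monoʳ-≤ d (+-mono-≤ (L≤ ω) (≤-trans (concatMap-length _ (d * t₁) (L ω) inner) (*-monoˡ-≤ (d * t₁) (L≤ ω)))) ⟩
        Q                            ∎
        where
        N = concatMap (λ c → concatMap (λ z → take t₁ (nbrs (c ∷ z ∷ []))) (toList ω)) (L ω)
        inner : ∀ c → length (concatMap (λ z → take t₁ (nbrs (c ∷ z ∷ []))) (toList ω)) ≤ d * t₁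
        inner c = ≤-trans (concatMap-length _ t₁ (toList ω) λ z → length-take-bound t₁ _)
          (≤-reflexive (cong (_* t₁) (length-toList ω)))
      -- Reduction modulo `M` makes the selection total on natural indices; below `M` it is
      -- injective.
      fin : ℕ → Fin M
      fin a = fromℕ< (m%n<n a M)
      fin-inj : ∀ {a b} → a < M → b < M → fin a ≡ fin b → a ≡ b
      fin-inj {a} {b} a< b< eq = trans (sym (val a a<)) (trans (cong Fin.toℕ eq) (val b b<))
        where
        val : ∀ a → a < M → Fin.toℕ (fin a) ≡ a
        val a a< = trans (Finₚ.toℕ-fromℕ< (m%n<n a M)) (m<n⇒m%n≡m a<)
      build : Selection M As L (Reach L) → HasCleanBox E hyp t₁ M
      build (B , B-∈ , clean-L , clean-B) = P , q , L , (λ i a → B i (fin a)) , record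
        { P-uniq  = uP
        ; PL-size = size
        ; P-edge  = λ {τ} v m → P-edge _ _ m (∈As τ)
        ; L-edge  = λ v m → proj₁ (L-edge _ _ m)
        ; L-∉P    = λ v m → proj₂ (L-edge _ _ m)
        ; L-size  = λ {τ} v → L-size _ (∈As τ)
        ; L-uniq  = λ v → L-uniq _
        ; L-clean = λ {τ} {τ'} v v' dj m → clean-L (fin ∘ τ) (fin ∘ τ') (λ i eq → dj i (fin-inj (v i) (v' i) eq)) m
        ; B-clean = λ {τ} {i} {a} v a< ne → clean-B (fin ∘ τ) i (fin a) (ne ∘ fin-inj (v i) a<)
        }
        where
        ∈As : ∀ τ → tabulate (λ i → B i (fin (τ i))) ∈□ As
        ∈As τ = ∈□-tabulate λ i → subst (_∈ lookup As i) (sym (lookup∘tabulate (λ i → B i (fin (τ i))) i)) (B-∈ i (fin (τ i)))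

    CleanFrom : ℕ → ℕ → Set
    CleanFrom j N = ∀ {n} (E : List (Fin n) → Bool) (hyp : IsHypergraph n (suc d) E) →
      let open Core E hyp t₁ in
      (As : Vec (List V) d) → Fat N As → (P : List V) → Unique P → length P ≡ j →
      (∀ c ω → c ∈ P → ω ∈□ As → Edge (c ∷ toList ω)) →
      (∀ ω → ω ∈□ As → t₁ ≤ length (nbrs (toList ω))) → HasCleanBox E hyp t₁ M

    -- The density at which a colour counts as popular is the error 1/e that the union bound
    -- tolerates, so the failure of popularity is exactly the rarity that `cleanUp` asks for.
    rare-step : ∀ j u N N' → j + suc u ≡ t₁ → CU.e ≤ N' →
      (∀ {V : Set} (As : Vec (List V) d) → Fat N' As → (R : Vec V d → Bool) →
        vol As ≤ CU.e * ∑□ As (𝟙 ∘ R) → SubBox N As R) →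
      CleanFrom (suc j) N → CleanFrom j N'
    rare-step j u N N' eq e≤ sub next {n} E hyp As fat P uP lP P-edge full
      with Finₚ.any? (λ c → ¬? (c ∈? P) ×-dec (vol As ≤? CU.e * ∑□ As (λ ω → 𝟙 (E (c ∷ toList ω)))))
      where open Core E hyp t₁
    ... | yes (c , c∉P , dense) =
      let Bs , sizes , inside = sub As fat (λ ω → E (c ∷ toList ω)) dense
      in next E hyp Bs (λ i → proj₁ (sizes i) , ≤-reflexive (sym (proj₂ (sizes i)))) (c ∷ P)
           (Unique-∷ c∉P uP) (cong suc lP)
           (λ { c' ω (here refl) m → proj₂ (inside ω m) ; c' ω (there p) m → P-edge c' ω p (proj₁ (inside ω m)) })
           (λ ω m → full ω (proj₁ (inside ω m)))
    ... | no ¬dense = cleanUp E hyp As (Fat-mono {As = As} e≤ fat) P (suc u) uP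
           (trans (cong (_+ suc u) lP) eq) P-edge L
           (λ ω → ≤-trans (length-take-bound (suc u) (nbrs (toList ω) ∖ P)) (≤-trans (m≤n+m (suc u) j) (≤-reflexive eq)))
           (λ ω → Uniq.take⁺ (suc u) (∖-Unique P (nbrs-Unique (toList ω))))
           L-size (λ ω c m → L-∈ ω m) rare
      where
      open Core E hyp t₁
      open ≤-Reasoning
      L : Vec V d → List V
      -- Cutting the list down to exactly `t₁ - j` colours keeps `Reach` bounded independently of
      -- `n`.
      L ω = take (suc u) (nbrs (toList ω) ∖ P)
      L-∈ : ∀ ω {c} → c ∈ L ω → Edge (c ∷ toList ω) × c ∉ P
      L-∈ ω m with ∖-∈⁻ (nbrs (toList ω)) P (take-∈ (suc u) m)
      ... | a , b = nbrs-∈ a , b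
      L-size : ∀ ω → ω ∈□ As → length (L ω) ≡ suc u
      L-size ω m = length-take-≤ (suc u) (nbrs (toList ω) ∖ P) (+-cancelˡ-≤ j _ _ (begin
        j + suc u                                      ≡⟨ eq ⟩
        t₁                                             ≤⟨ full ω m ⟩
        length (nbrs (toList ω))                       ≤⟨ length-∖ P (nbrs-Unique (toList ω)) ⟩
        length P + length (nbrs (toList ω) ∖ P)        ≡⟨ cong (_+ length (nbrs (toList ω) ∖ P)) lP ⟩
        j + length (nbrs (toList ω) ∖ P)               ∎))
      L≤E : ∀ c ω → 𝟙 ⌊ c ∈? L ω ⌋ ≤ 𝟙 (E (c ∷ toList ω))
      L≤E c ω = 𝟙-mono λ h → proj₁ (L-∈ ω (toWitness h))
      rare : ∀ c → CU.e * ∑□ As (λ ω → 𝟙 ⌊ c ∈? L ω ⌋) ≤ vol As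
      rare c with c ∈? P
      ... | yes p = ≤-trans (*-monoʳ-≤ CU.e (∑□-mono As λ ω _ → none ω))
                     (≤-trans (≤-reflexive (trans (cong (CU.e *_) (trans (∑□-const As 0) (*-zeroʳ (vol As)))) (*-zeroʳ CU.e))) z≤n)
        where
        none : ∀ ω → 𝟙 ⌊ c ∈? L ω ⌋ ≤ 0
        none ω with c ∈? L ω
        ... | yes m = ⊥-elim (proj₂ (L-∈ ω m) p)
        ... | no _  = z≤n
      ... | no c∉P = ≤-trans (*-monoʳ-≤ CU.e (∑□-mono As λ ω _ → L≤E c ω))
                      (<⇒≤ (≰⇒> λ h → ¬dense (c , c∉P , h)))

    -- Popular colours are collected one at a time, each time passing to a sub-box all of whose
    -- points see the new colour; the process stops after at most t₁ colours.
    collect : ∀ u j → j + u ≡ t₁ → Σ ℕ λ N → NonZero N × CleanFrom j N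
    collect zero j eq = suc CU.e , _ , λ E hyp As fat P uP lP P-edge full →
      cleanUp E hyp As (Fat-mono {As = As} (n≤1+n _) fat) P 0 uP (trans (cong (_+ 0) lP) eq) P-edge
        (λ _ → []) (λ _ → z≤n) (λ _ → []) (λ _ _ → refl) (λ _ _ ())
        (λ c → ≤-trans (≤-reflexive (trans (cong (CU.e *_) (trans (∑□-const As 0) (*-zeroʳ (vol As)))) (*-zeroʳ CU.e))) z≤n)
    collect (suc u) j eq =
      let N , nz , next = collect u (suc j) (trans (sym (+-suc j u)) eq)
          N' , sub      = erdős d CU.e N {{_}} {{nz}}
      in suc (CU.e + N') , _ ,
         rare-step j u N (suc (CU.e + N')) eq (m≤n⇒m≤1+n (m≤m+n CU.e N'))
           (λ As fat → sub As (Fat-mono {As = As} (m≤n⇒m≤1+n (m≤n+m N' CU.e)) fat)) next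

    -- The collection starts with no popular colour in a box all of whose points lie in the shadow;
    -- there fullness provides the `t₁` colours of each point.
    cleanBox : ∀ e {{_ : NonZero e}} → Σ ℕ λ N → ∀ n → N ≤ n →
      (E : List (Fin n) → Bool) (hyp : IsHypergraph n (suc d) E) →
      let open Core E hyp t₁ in Full t₁ → (R : Vec V d → Bool) →
      (∀ ω → T (R ω) → ∃ λ x → Edge (x ∷ toList ω)) →
      n ^ d ≤ e * ∑□ (Vec.replicate d (allFin n)) (𝟙 ∘ R) → HasCleanBox E hyp t₁ M
    cleanBox e {{e≢0}} =
      let N , nz , next = collect t₁ 0 refl
          N' , sub      = erdős d e N {{e≢0}} {{nz}}
      in N' , λ n N'≤ E hyp full R shadow dense →
        let open Core E hyp t₁
            As = Vec.replicate d (allFin n)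
            fat : Fat N' As
            fat = λ i → subst (λ A → Unique A × N' ≤ length A) (sym (lookup-replicate i (allFin n)))
                    (Uniq.allFin⁺ n , ≤-trans N'≤ (≤-reflexive (sym (length-tabulate (λ (i : Fin n) → i)))))
            Bs , sizes , inside = sub As fat R (≤-trans (≤-reflexive (vol-replicate n d)) dense)
        in next E hyp Bs (λ i → proj₁ (sizes i) , ≤-reflexive (sym (proj₂ (sizes i)))) [] [] refl
             (λ _ _ ()) (λ ω m → full (toList ω) (length-toList ω) _ (proj₂ (shadow ω (proj₂ (inside ω m)))))
      where
      open import Data.Vec.Properties using (lookup-replicate)
      open import Data.List.Properties using (length-tabulate)
      vol-replicate : ∀ n d → vol (Vec.replicate d (allFin n)) ≡ n ^ d
      vol-replicate n zero    = refl
      vol-replicate n (suc d) = cong₂ _*_ (length-tabulate (λ (i : Fin n) → i)) (vol-replicate n d)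

-- Copies of expansions and of disjoint unions as vertex lists.

module Pattern where

  open Lists
  open import Data.List.Relation.Binary.Pointwise using (Pointwise; []; _∷_)

  Disjoint : {A : Set} → List A → List A → Set
  Disjoint xs ys = ∀ {v} → v ∈ xs → v ∈ ys → ⊥

  module _ {V : Set} where

    -- v₀ is returned past the end of the list.
    look : V → List V → ℕ → V
    look v₀ []       _       = v₀
    look v₀ (x ∷ xs) zero    = x
    look v₀ (x ∷ xs) (suc i) = look v₀ xs i

    look-++ʳ : ∀ v₀ xs {ys} i → look v₀ (xs ++ ys) (length xs + i) ≡ look v₀ ys i
    look-++ʳ v₀ []       i = refl
    look-++ʳ v₀ (x ∷ xs) i = look-++ʳ v₀ xs i

    look-prefix : ∀ v₀ xs {ys} → applyUpTo (look v₀ (xs ++ ys)) (length xs) ≡ xs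
    look-prefix v₀ []       = refl
    look-prefix v₀ (x ∷ xs) = cong (x ∷_) (look-prefix v₀ xs)

    look-∈ : ∀ v₀ xs {i} → i < length xs → look v₀ xs i ∈ xs
    look-∈ v₀ (x ∷ xs) {zero}  h       = here refl
    look-∈ v₀ (x ∷ xs) {suc i} (s≤s h) = there (look-∈ v₀ xs h)

    look-inj : ∀ v₀ {xs} → Unique xs → ∀ i j → i < length xs → j < length xs →
               look v₀ xs i ≡ look v₀ xs j → i ≡ j
    look-inj v₀ {x ∷ xs} u zero    zero    _       _       e = refl
    look-inj v₀ {x ∷ xs} u zero    (suc j) _       (s≤s h) e =
      ⊥-elim (Unique-head u (subst (_∈ xs) (sym e) (look-∈ v₀ xs h)))
    look-inj v₀ {x ∷ xs} u (suc i) zero    (s≤s h) _       e =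
      ⊥-elim (Unique-head u (subst (_∈ xs) e (look-∈ v₀ xs h)))
    look-inj v₀ {x ∷ xs} u (suc i) (suc j) (s≤s h) (s≤s k) e = cong suc (look-inj v₀ (Unique-tail u) i j h k e)

    Unique-insert : ∀ (xs : List V) {ys zs} → Unique (xs ++ zs) → Unique ys → Disjoint ys (xs ++ zs) →
                    Unique (xs ++ (ys ++ zs))
    Unique-insert xs {ys} {zs} u uy dj =
      let ux , uz , dxz = Unique-++⁻ xs u
      in Unique-++ ux (Unique-++ uy uz λ m m' → dj m (∈-++⁺ʳ xs m'))
           λ m m' → [ (λ a → dj a (∈-++⁺ˡ m)) , (λ a → dxz m a) ]′ (∈-++⁻ ys m')

    ∈-insert⁻ : ∀ (xs ys : List V) {zs v} → v ∈ xs ++ (ys ++ zs) → v ∈ ys ⊎ v ∈ xs ++ zs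
    ∈-insert⁻ xs ys m with ∈-++⁻ xs m
    ... | inj₁ a = inj₂ (∈-++⁺ˡ a)
    ... | inj₂ a with ∈-++⁻ ys a
    ...   | inj₁ b = inj₁ b
    ...   | inj₂ b = inj₂ (∈-++⁺ʳ xs b)

  module Realization {V : Set} (v₀ : V) (Edge : List V → Set) (m : ℕ) where

    -- Label `i` goes to entry `i` of `vs`. The edges are demanded for every continuation `zs`,
    -- because in a disjoint union the list of the first part is followed by that of the second.
    record Realizes (H : HGraph) (vs : List V) : Set where
      constructor realizes
      field
        len  : length vs ≡ verts H
        uniq : Unique vs
        edge : ∀ zs → All (λ e → Edge (map (look v₀ (vs ++ zs)) e)) (edges H)
    open Realizes public

    Realizes-⊔ : ∀ {H H' vs vs'} → Realizes H vs → Realizes H' vs' → Disjoint vs vs' →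
                 Realizes (H ⊔ H') (vs ++ vs')
    Realizes-⊔ {H} {H'} {vs} {vs'} R R' dj = realizes
      (trans (length-++ vs) (cong₂ _+_ (len R) (len R')))
      (Unique-++ (uniq R) (uniq R') dj)
      λ zs → Allₚ.++⁺
        (subst (λ l → All (λ e → Edge (map (look v₀ l) e)) (edges H)) (sym (++-assoc vs vs' zs)) (edge R (vs' ++ zs)))
        (Allₚ.map⁺ (All.map (λ {e} → subst Edge (shift zs e)) (edge R' zs)))
      where
      shift : ∀ zs e → map (look v₀ (vs' ++ zs)) e ≡ map (look v₀ ((vs ++ vs') ++ zs)) (map (verts H +_) e)
      shift zs e = trans (map-cong (λ i → sym (trans
          (cong₂ (look v₀) (++-assoc vs vs' zs) (cong (_+ i) (sym (len R))))
          (look-++ʳ v₀ vs i))) e) (map-∘ e)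

    -- `Φ Hs used` is the invariant of a greedy embedding: what is still to be placed and what is
    -- occupied. The embeddings in a clean box and in a graph of large codegrees are both instances.
    assemble : (Φ : List HGraph → List V → Set) →
      (∀ {H Hs used} → Φ (H ∷ Hs) used → ∃ λ vs → Realizes H vs × Disjoint vs used × Φ Hs (vs ++ used)) →
      ∀ Hs used → Φ Hs used → ∃ λ vs → Realizes (⨆ Hs) vs × Disjoint vs used
    assemble Φ step []       used φ = [] , realizes refl [] (λ _ → []) , λ ()
    assemble Φ step (H ∷ Hs) used φ =
      let vs , R , dj , φ'  = step φ
          vs' , R' , dj' = assemble Φ step Hs (vs ++ used) φ'
      in vs ++ vs' , Realizes-⊔ R R' (λ a b → dj' b (∈-++⁺ˡ a)) ,
         λ a b → [ (λ c → dj c b) , (λ c → dj' c (∈-++⁺ʳ vs b)) ]′ (∈-++⁻ vs a)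

    Hyperedge : V → V → List V → Set
    Hyperedge u v ex = length ex ≡ m × Edge (u ∷ v ∷ ex)

    module _ (X : List V) where
      private lk = look v₀ X

      Fits : ℕ × ℕ → List V → Set
      Fits ab ex = Hyperedge (lk (proj₁ ab)) (lk (proj₂ ab)) ex

      -- `pre` holds the vertices already numbered and has length `f`, so the next block of fresh
      -- labels falls exactly on `ex`.
      expandEdges-All : ∀ f es exs pre zs → length pre ≡ f → X ≡ pre ++ (concat exs ++ zs) →
        Pointwise Fits es exs → All (λ e → Edge (map lk e)) (expandEdges m f es)
      expandEdges-All f [] [] pre zs l eq [] = []
      expandEdges-All f ((a , b) ∷ es) (ex ∷ exs) pre zs l eq ((lx , ed) ∷ pw) =
        subst (λ y → Edge (lk a ∷ lk b ∷ y)) (sym fresh) ed ∷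
        expandEdges-All (f + m) es exs (pre ++ ex) zs
          (trans (length-++ pre) (cong₂ _+_ l lx))
          (trans eq (trans (cong (pre ++_) (++-assoc ex (concat exs) zs)) (sym (++-assoc pre ex (concat exs ++ zs))))) pw
        where
        open ≡-Reasoning
        fresh : map lk (map (f +_) (upTo m)) ≡ ex
        fresh = begin
          map lk (map (f +_) (upTo m))                  ≡⟨ sym (map-∘ (upTo m)) ⟩
          map (λ i → lk (f + i)) (upTo m)               ≡⟨ map-applyUpTo id (λ i → lk (f + i)) m ⟩
          applyUpTo (λ i → lk (f + i)) m                ≡⟨ cong (applyUpTo _) (sym lx) ⟩
          applyUpTo (λ i → lk (f + i)) (length ex)      ≡⟨ apply-cong (length ex) step ⟩
          applyUpTo (look v₀ (ex ++ (concat exs ++ zs))) (length ex) ≡⟨ look-prefix v₀ ex ⟩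
          ex                                            ∎
          where
          apply-cong : ∀ {f g : ℕ → V} k → (∀ i → f i ≡ g i) → applyUpTo f k ≡ applyUpTo g k
          apply-cong zero    h = refl
          apply-cong (suc k) h = cong₂ _∷_ (h 0) (apply-cong k (h ∘ suc))
          step : ∀ i → lk (f + i) ≡ look v₀ (ex ++ (concat exs ++ zs)) i
          step i = trans (cong₂ (look v₀) (trans eq (cong (pre ++_) (++-assoc ex (concat exs) zs))) (cong (_+ i) (sym l)))
                     (look-++ʳ v₀ pre i)

    -- `bs` leaves out the end of the walk: a closed walk then lists each vertex of its cycle once,
    -- and a path appends `w`. The vertices `bs` followed by the blocks `exs` come in the order in
    -- which `expansion` numbers them.
    data Walk : V → V → ℕ → List V → List (List V) → Set where
      stop : ∀ {v} → Walk v v 0 [] []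
      _∷_  : ∀ {u v w ℓ ex bs exs} → Hyperedge u v ex → Walk v w ℓ bs exs →
             Walk u w (suc ℓ) (u ∷ bs) (ex ∷ exs)

    Walk-length : ∀ {u w ℓ bs exs} → Walk u w ℓ bs exs → length bs ≡ ℓ
    Walk-length stop    = refl
    Walk-length (_ ∷ W) = cong suc (Walk-length W)

    Walk-start : ∀ {u w ℓ bs exs zs v} → Walk u w ℓ bs exs → zs ≡ bs ++ [ w ] → ∀ {ys} → zs ≡ v ∷ ys → v ≡ u
    Walk-start stop    refl refl = refl
    Walk-start (_ ∷ W) refl refl = refl

    module _ (X : List V) where
      private lk = look v₀ X

      -- The index map `h` is arbitrary because the induction along the walk replaces it by
      -- `h ∘ suc`; the same holds for cycles and stars.
      path-fits : ∀ {u w ℓ bs exs} (h : ℕ → ℕ) → Walk u w ℓ bs exs →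
        applyUpTo (lk ∘ h) (suc ℓ) ≡ bs ++ [ w ] →
        Pointwise (Fits X) (applyUpTo (λ i → h i , h (suc i)) ℓ) exs
      path-fits h stop eq = []
      path-fits {u} h (_∷_ {v = v} (l , ed) W) eq =
        (l , subst₂ (λ a b → Edge (a ∷ b ∷ _)) (sym (∷-injectiveˡ eq)) (sym (Walk-start W (∷-injectiveʳ eq) refl)) ed)
        ∷ path-fits (h ∘ suc) W (∷-injectiveʳ eq)

      cycle-fits : ∀ {u w ℓ bs exs} (h : ℕ → ℕ) (z : ℕ) → Walk u w (suc ℓ) bs exs →
        applyUpTo (lk ∘ h) (suc ℓ) ≡ bs → lk z ≡ w →
        Pointwise (Fits X) (applyUpTo (λ i → h i , h (suc i)) ℓ ++ [ h ℓ , z ]) exs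
      cycle-fits h z ((l , ed) ∷ stop) eq ez =
        (l , subst₂ (λ a b → Edge (a ∷ b ∷ _)) (sym (∷-injectiveˡ eq)) (sym ez) ed) ∷ []
      cycle-fits h z ((l , ed) ∷ W@(_ ∷ _)) eq ez =
        (l , subst₂ (λ a b → Edge (a ∷ b ∷ _)) (sym (∷-injectiveˡ eq)) (sym (∷-injectiveˡ (∷-injectiveʳ eq))) ed)
        ∷ cycle-fits (h ∘ suc) z W (∷-injectiveʳ eq) ez

      star-fits : ∀ {c leaves exs} (h : ℕ → ℕ) → lk 0 ≡ c → Pointwise (Hyperedge c) leaves exs →
        applyUpTo (lk ∘ h) (length leaves) ≡ leaves →
        Pointwise (Fits X) (applyUpTo (λ i → 0 , h i) (length leaves)) exs
      star-fits h e0 [] eq = []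
      star-fits h e0 ((l , ed) ∷ pw) eq =
        (l , subst₂ (λ a b → Edge (a ∷ b ∷ _)) (sym e0) (sym (∷-injectiveˡ eq)) ed)
        ∷ star-fits (h ∘ suc) e0 pw (∷-injectiveʳ eq)

    module _ (r : ℕ) (r∸2 : r ∸ 2 ≡ m) where

      realizes-expansion : ∀ F base exs → length base ≡ gverts F → Unique (base ++ concat exs) →
        (∀ zs → Pointwise (Fits ((base ++ concat exs) ++ zs)) (gedges F) exs) →
        Realizes (expansion r F) (base ++ concat exs)
      realizes-expansion F base exs lb uq pw = realizes
        (trans (length-++ base) (cong₂ _+_ lb (trans (extras ((base ++ concat exs) ++ []) (pw [])) (cong (length (gedges F) *_) (sym r∸2)))))
        uq
        λ zs → subst (λ k → All (λ e → Edge (map (look v₀ ((base ++ concat exs) ++ zs)) e)) (expandEdges k (gverts F) (gedges F)))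
          (sym r∸2)
          (expandEdges-All ((base ++ concat exs) ++ zs) (gverts F) (gedges F) exs base zs lb
            (++-assoc base (concat exs) zs) (pw zs))
        where
        extras : ∀ X {es exs} → Pointwise (Fits X) es exs → length (concat exs) ≡ length es * m
        extras X [] = refl
        extras X (_∷_ {y = ex} (l , _) pw) = trans (length-++ ex) (cong₂ _+_ l (extras X pw))

      prefix : ∀ (base ys zs : List V) {k} → length base ≡ k → applyUpTo (look v₀ ((base ++ ys) ++ zs)) k ≡ base
      prefix base ys zs refl =
        trans (cong (λ l → applyUpTo (look v₀ l) (length base)) (++-assoc base ys zs)) (look-prefix v₀ base)

      realizes-path : ∀ {u w ℓ bs exs} → Walk u w ℓ bs exs → Unique (bs ++ concat exs) → w ∉ bs ++ concat exs →
        Realizes (expansion r (pathG ℓ)) ((bs ++ [ w ]) ++ concat exs)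
      realizes-path {u} {w} {ℓ} {bs} {exs} W uq w∉ = realizes-expansion (pathG ℓ) (bs ++ [ w ]) exs lb
        (subst Unique (sym (++-assoc bs [ w ] (concat exs)))
          (Unique-insert bs uq ([] ∷ []) λ { (here refl) m' → w∉ m' }))
        λ zs → subst (λ es → Pointwise (Fits (((bs ++ [ w ]) ++ concat exs) ++ zs)) es exs)
          (sym (map-applyUpTo id (λ i → i , suc i) ℓ))
          (path-fits (((bs ++ [ w ]) ++ concat exs) ++ zs) id W (prefix (bs ++ [ w ]) (concat exs) zs lb))
        where
        lb : length (bs ++ [ w ]) ≡ suc ℓ
        lb = trans (length-++ bs) (trans (+-comm (length bs) 1) (cong suc (Walk-length W)))

      realizes-cycle : ∀ {u ℓ bs exs} → Walk u u (suc ℓ) bs exs → Unique (bs ++ concat exs) →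
        Realizes (expansion r (cycleG (suc ℓ))) (bs ++ concat exs)
      realizes-cycle {u} {ℓ} {bs} {exs} W uq = realizes-expansion (cycleG (suc ℓ)) bs exs (Walk-length W) uq
        λ zs → subst (λ es → Pointwise (Fits ((bs ++ concat exs) ++ zs)) (es ++ [ ℓ , 0 ]) exs)
          (sym (map-applyUpTo id (λ i → i , suc i) ℓ))
          (cycle-fits ((bs ++ concat exs) ++ zs) id 0 W (prefix bs (concat exs) zs (Walk-length W))
            (first (look v₀ ((bs ++ concat exs) ++ zs)) W (prefix bs (concat exs) zs (Walk-length W))))
        where
        first : ∀ {u w ℓ bs exs} (g : ℕ → V) → Walk u w (suc ℓ) bs exs → applyUpTo g (suc ℓ) ≡ bs → g 0 ≡ u
        first g (_ ∷ _) eq = ∷-injectiveˡ eq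

      realizes-star : ∀ {c leaves exs} → Pointwise (Hyperedge c) leaves exs →
        Unique (leaves ++ concat exs) → c ∉ leaves ++ concat exs →
        Realizes (expansion r (starG (length leaves))) ((c ∷ leaves) ++ concat exs)
      realizes-star {c} {leaves} {exs} pw uq c∉ =
        realizes-expansion (starG (length leaves)) (c ∷ leaves) exs refl (Unique-∷ c∉ uq)
        λ zs → subst (λ es → Pointwise (Fits (((c ∷ leaves) ++ concat exs) ++ zs)) es exs)
          (sym (map-applyUpTo id (λ i → 0 , suc i) (length leaves)))
          (star-fits (((c ∷ leaves) ++ concat exs) ++ zs) suc refl pw (prefix leaves (concat exs) zs refl))

      -- Deleting the first edge of a cycle.
      realizes-cycle-path : ∀ {u ℓ bs exs} → Walk u u (suc ℓ) bs exs → Unique (bs ++ concat exs) →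
        ∃ λ vs → Realizes (expansion r (pathG ℓ)) vs × (∀ {v} → v ∈ vs → v ∈ bs ++ concat exs)
      realizes-cycle-path {u} (_∷_ {ex = ex} {bs} {exs} _ W) uq =
        (bs ++ [ u ]) ++ concat exs , realizes-path W uq' u∉ , sub
        where
        parts = Unique-++⁻ bs (Unique-tail uq)
        uq' : Unique (bs ++ concat exs)
        uq' = Unique-++ (proj₁ parts) (proj₁ (proj₂ (Unique-++⁻ ex (proj₁ (proj₂ parts)))))
                (λ a b → proj₂ (proj₂ parts) a (∈-++⁺ʳ ex b))
        widen : ∀ {v} → v ∈ bs ++ concat exs → v ∈ bs ++ (ex ++ concat exs)
        widen = λ a → [ ∈-++⁺ˡ , (λ b → ∈-++⁺ʳ bs (∈-++⁺ʳ ex b)) ]′ (∈-++⁻ bs a)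
        u∉ : u ∉ bs ++ concat exs
        u∉ = λ a → Unique-head uq (widen a)
        sub : ∀ {v} → v ∈ (bs ++ [ u ]) ++ concat exs → v ∈ (u ∷ bs) ++ (ex ++ concat exs)
        sub a with ∈-insert⁻ bs [ u ] (subst (_ ∈_) (++-assoc bs [ u ] (concat exs)) a)
        ... | inj₁ (here e) = here e
        ... | inj₂ b        = there (widen b)

-- Embedding the forbidden graph in a clean box.

module Embedding where

  open Lists
  open Boxes
  open Hyper
  open Pattern
  open import Data.Nat.DivMod using (_%_; [m+kn]%n≡m%n; m<n⇒m%n≡m; m*n/n≡m; +-distrib-/-∣ʳ)
  open import Data.Nat.Divisibility using (divides)
  open import Data.List.Relation.Binary.Pointwise using (Pointwise; []; _∷_)
  open import Data.Vec using (tabulate; toList)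
  open import Data.Vec.Properties using (tabulate-cong; length-toList)
  open import Relation.Binary.Definitions using (DecidableEquality)

  ∈-toList⁺ : {A : Set} {k : ℕ} {f : Fin k → A} (i : Fin k) → f i ∈ toList (tabulate f)
  ∈-toList⁺ zero    = here refl
  ∈-toList⁺ (suc i) = there (∈-toList⁺ i)

  ∈-toList⁻ : {A : Set} {k : ℕ} {f : Fin k → A} {x : A} → x ∈ toList (tabulate f) → ∃ λ i → x ≡ f i
  ∈-toList⁻ {k = suc k} (here e) = zero , e
  ∈-toList⁻ {k = suc k} (there m) with ∈-toList⁻ m
  ... | i , e = suc i , e

  module _ {d : ℕ} where
    open DecList (Finₚ._≟_ {d}) using () renaming (_∖_ to _∖ᶠ_; ∖-∈⁻ to ∖ᶠ-∈⁻; ∖-∈⁺ to ∖ᶠ-∈⁺; ∖-Unique to ∖ᶠ-Unique; length-∖ to length-∖ᶠ)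

    others : List (Fin d) → List (Fin d)
    others is = allFin d ∖ᶠ is

    others-∈⁺ : ∀ {is i} → i ∉ is → i ∈ others is
    others-∈⁺ h = ∖ᶠ-∈⁺ (∈-allFin _) h

    others-∈⁻ : ∀ is {i} → i ∈ others is → i ∉ is
    others-∈⁻ is m = proj₂ (∖ᶠ-∈⁻ (allFin d) is m)

    others-Unique : ∀ is → Unique (others is)
    others-Unique is = ∖ᶠ-Unique is (Uniq.allFin⁺ d)

    others-length : ∀ {is} → Unique is → length is + length (others is) ≡ d
    others-length {is} u = ≤-antisym
      (≤-trans (≤-reflexive (sym (length-++ is)))
        (≤-trans (Unique-⊆-length (Unique-++ u (others-Unique is) (λ a b → others-∈⁻ is b a)) (λ _ → ∈-allFin _))
          (≤-reflexive (length-tabulate (λ (i : Fin d) → i)))))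
      (≤-trans (≤-reflexive (sym (length-tabulate (λ (i : Fin d) → i)))) (length-∖ᶠ is (Uniq.allFin⁺ d)))

    -- The index tuple of a typical edge of a walk: a new index `k`, except in class `κ`, where the
    -- edge picks up a vertex with the older index `k'`.
    mix : ℕ → Fin d → ℕ → Fin d → ℕ
    mix k κ k' i with i Finₚ.≟ κ
    ... | yes _ = k'
    ... | no  _ = k

    mix-≡ : ∀ {k κ k'} → mix k κ k' κ ≡ k'
    mix-≡ {κ = κ} with κ Finₚ.≟ κ
    ... | yes _ = refl
    ... | no ¬p = ⊥-elim (¬p refl)

    mix-≢ : ∀ {k κ k' i} → i ≢ κ → mix k κ k' i ≡ k
    mix-≢ {κ = κ} {i = i} ne with i Finₚ.≟ κ
    ... | yes p = ⊥-elim (ne p)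
    ... | no  _ = refl

    mix-case : ∀ {k κ k'} (X : ℕ → Set) → X k → X k' → ∀ i → X (mix k κ k' i)
    mix-case {κ = κ} X a b i with i Finₚ.≟ κ
    ... | yes _ = b
    ... | no  _ = a

  -- This is `2 * D ^ n`: each of `n` rows may shrink the set of columns by a factor `D`, and two
  -- columns have to remain.
  need : ℕ → ℕ → ℕ
  need D zero    = 2
  need D (suc n) = D * need D n

  need>0 : ∀ D n → 0 < D → 0 < need D n
  need>0 D zero    h = s≤s z≤n
  need>0 D (suc n) h = *-mono-≤ h (need>0 D n h)

  -- Enough indices for D centres, need D D leaves and one private index for each pair.
  star-room : ℕ → ℕ
  star-room D = (D + need D D) + (D + (D + need D D) * D)

  Unique-map-∈ : {X Y : Set} (f : X → Y) {xs : List X} → Unique xs →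
    (∀ {x y} → x ∈ xs → y ∈ xs → f x ≡ f y → x ≡ y) → Unique (map f xs)
  Unique-map-∈ f {[]}     u h = []
  Unique-map-∈ f {x ∷ xs} u h = Unique-∷
    (λ m → let y , y∈ , e = ∈-map⁻ f m in Unique-head u (subst (_∈ xs) (sym (h (here refl) (there y∈) e)) y∈))
    (Unique-map-∈ f (Unique-tail u) (λ a b → h (there a) (there b)))

  module _ {Y : Set} (_≟ʸ_ : DecidableEquality Y) where

    private
      split : (χ : ℕ → Y) (c : Y) (bs : List ℕ) → Unique bs → ∃ λ as → ∃ λ cs →
        Unique as × Unique cs × (∀ {b} → b ∈ as → b ∈ bs × χ b ≡ c) × (∀ {b} → b ∈ cs → b ∈ bs × χ b ≢ c) ×
        length bs ≡ length as + length cs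
      split χ c []       u = [] , [] , [] , [] , (λ ()) , (λ ()) , refl
      split χ c (b ∷ bs) u with split χ c bs (Unique-tail u) | χ b ≟ʸ c
      ... | as , cs , ua , uc , fa , fc , len | yes e =
            b ∷ as , cs , Unique-∷ (λ m → Unique-head u (proj₁ (fa m))) ua , uc ,
            (λ { (here refl) → here refl , e ; (there m) → there (proj₁ (fa m)) , proj₂ (fa m) }) ,
            (λ m → there (proj₁ (fc m)) , proj₂ (fc m)) , cong suc len
      ... | as , cs , ua , uc , fa , fc , len | no ne =
            as , b ∷ cs , ua , Unique-∷ (λ m → Unique-head u (proj₁ (fc m))) uc ,
            (λ m → there (proj₁ (fa m)) , proj₂ (fa m)) ,
            (λ { (here refl) → here refl , ne ; (there m) → there (proj₁ (fc m)) , proj₂ (fc m) }) ,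
            trans (cong suc len) (sym (+-suc (length as) (length cs)))

    -- Colour classes are split off one by one: a class with at least `K` elements is the constant
    -- list, and otherwise each class costs fewer than `K` elements and contributes one new colour.
    rainbow-or-constant : (χ : ℕ → Y) (D K : ℕ) (bs : List ℕ) → Unique bs → 0 < K → D * K ≤ length bs →
      (∃ λ as → length as ≡ D × Unique as × Unique (map χ as) × (∀ {b} → b ∈ as → b ∈ bs)) ⊎
      (∃ λ as → K ≤ length as × Unique as × (∀ {b} → b ∈ as → b ∈ bs) × (∃ λ c → ∀ {b} → b ∈ as → χ b ≡ c))
    rainbow-or-constant χ zero K bs u K>0 le = inj₁ ([] , refl , [] , [] , λ ())
    rainbow-or-constant χ (suc D) K [] u K>0 le = ⊥-elim (<⇒≱ K>0 (≤-trans (m≤m+n K (D * K)) le))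
    rainbow-or-constant χ (suc D) K (b ∷ bs) u K>0 le with split χ (χ b) (b ∷ bs) u
    ... | as , cs , ua , uc , fa , fc , len with K ≤? length as
    ...   | yes p = inj₂ (as , p , ua , (λ m → proj₁ (fa m)) , χ b , λ m → proj₂ (fa m))
    ...   | no ¬p with rainbow-or-constant χ D K cs uc K>0
                     (+-cancelˡ-≤ K _ _ (≤-trans le (≤-trans (≤-reflexive len) (+-monoˡ-≤ (length cs) (<⇒≤ (≰⇒> ¬p))))))
    ...     | inj₂ (as' , p , u' , sub , const) = inj₂ (as' , p , u' , (λ m → proj₁ (fc (sub m))) , const)
    ...     | inj₁ (as' , l , u' , uχ , sub) = inj₁ (b ∷ as' , cong suc l ,
                Unique-∷ (λ m → proj₂ (fc (sub m)) refl) u' ,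
                Unique-∷ (λ m → let x , x∈ , e = ∈-map⁻ χ m in proj₂ (fc (sub x∈)) (sym e)) uχ ,
                λ { (here e) → here e ; (there m) → proj₁ (fc (sub m)) })

    -- As long as no row is rainbow, the columns are thinned out until the row is constant on them.
    -- This serves to find a star that has only rare colours.
    rainbow-row-or-constant : (χ : ℕ → ℕ → Y) (D : ℕ) → 0 < D → (as bs : List ℕ) → Unique bs →
      need D (length as) ≤ length bs →
      (∃ λ a → a ∈ as × ∃ λ bs' → length bs' ≡ D × Unique bs' × Unique (map (χ a) bs') × (∀ {b} → b ∈ bs' → b ∈ bs)) ⊎
      (∃ λ bs' → 2 ≤ length bs' × Unique bs' × (∀ {b} → b ∈ bs' → b ∈ bs) ×
        (∀ {a} → a ∈ as → ∃ λ c → ∀ {b} → b ∈ bs' → χ a b ≡ c))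
    rainbow-row-or-constant χ D D>0 [] bs u le = inj₂ (bs , le , u , id , λ ())
    rainbow-row-or-constant χ D D>0 (a ∷ as) bs u le
      with rainbow-or-constant (χ a) D (need D (length as)) bs u (need>0 D (length as) D>0) le
    ... | inj₁ (bs' , l , u' , uχ , sub) = inj₁ (a , here refl , bs' , l , u' , uχ , sub)
    ... | inj₂ (bs' , l , u' , sub , c , const) with rainbow-row-or-constant χ D D>0 as bs' u' l
    ...   | inj₁ (a' , a'∈ , bs'' , l' , u'' , uχ , sub') = inj₁ (a' , there a'∈ , bs'' , l' , u'' , uχ , sub ∘ sub')
    ...   | inj₂ (bs'' , l' , u'' , sub' , consts) = inj₂ (bs'' , l' , u'' , sub ∘ sub' ,
              λ { (here refl) → c , (λ m → const (sub' m)) ; (there m) → consts m })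

  data Piece : Set where
    pathOrCycle : Bool → ℕ → Piece
    star        : ℕ → Piece

  pattern-of : ℕ → Piece → HGraph
  pattern-of r (pathOrCycle b ℓ) = Qexp r b ℓ
  pattern-of r (star D)          = expansion r (starG D)

  crosscut : Piece → ℕ
  crosscut (pathOrCycle _ ℓ) = suc ℓ / 2
  crosscut (star _)          = 1

  Large : Piece → Set
  Large (pathOrCycle _ ℓ) = 5 ≤ ℓ
  Large (star D)          = 1 ≤ D

  -- A generous number of box indices, enough for either way of embedding the piece.
  room : Piece → ℕ
  room (pathOrCycle _ ℓ) = ℓ + 8
  room (star D)          = star-room D + (D + 2)

  rooms : List Piece → ℕ
  rooms []       = 0
  rooms (p ∷ ps) = room p + rooms ps

  weights : List Piece → ℕ
  weights []       = 0
  weights (p ∷ ps) = crosscut p + weights ps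

  even-or-odd : ∀ ℓ → ∃ λ i → ℓ ≡ i + i ⊎ ℓ ≡ suc (i + i)
  even-or-odd zero    = 0 , inj₁ refl
  even-or-odd (suc ℓ) with even-or-odd ℓ
  ... | i , inj₁ e = i , inj₂ (cong suc e)
  ... | i , inj₂ e = suc i , inj₁ (trans (cong suc e) (cong suc (sym (+-suc i i))))

  half-even : ∀ m → (m + m) / 2 ≡ m
  half-even m = trans (cong (_/ 2) (lem m)) (m*n/n≡m m 2)
    where
    lem : ∀ m → m + m ≡ m * 2
    lem = solve-∀

  half-odd : ∀ m → suc (m + m) / 2 ≡ m
  half-odd m = trans (+-distrib-/-∣ʳ 1 (divides m (lem m))) (half-even m)
    where
    lem : ∀ m → m + m ≡ m * 2
    lem = solve-∀

  -- Makes the parity of ℓ visible and rids the crosscut number of division. That it is at least 3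
  -- is what allows two popular colours to be saved on one piece.
  large-form : ∀ {ℓ} → 5 ≤ ℓ → ∃ λ s → (ℓ ≡ 6 + (s + s) ⊎ ℓ ≡ 5 + (s + s)) × suc ℓ / 2 ≡ 3 + s
  large-form {suc (suc (suc (suc (suc ℓ))))} (s≤s (s≤s (s≤s (s≤s (s≤s z≤n))))) with even-or-odd ℓ
  ... | s , inj₁ refl = s , inj₂ refl , trans (cong (_/ 2) (lem s)) (half-even (3 + s))
    where
    lem : ∀ s → 6 + (s + s) ≡ (3 + s) + (3 + s)
    lem = solve-∀
  ... | s , inj₂ refl = s , inj₁ refl , trans (cong (_/ 2) (lem s)) (half-odd (3 + s))
    where
    lem : ∀ s → 7 + (s + s) ≡ suc ((3 + s) + (3 + s))
    lem = solve-∀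

  module Embed {n d d₀ : ℕ} (d≡ : 2 + d₀ ≡ d) (E : List (Fin n) → Bool) (hyp : IsHypergraph n (suc d) E)
               (t₁ : ℕ) (v₀ : Fin n) (full : Core.Full E hyp t₁ t₁) where

    open Core E hyp t₁ public
    open Realization v₀ Edge (suc d₀) public

    r : ℕ
    r = suc d

    r∸2 : r ∸ 2 ≡ suc d₀
    r∸2 = cong (_∸ 1) (sym d≡)

    -- The base vertices of a walk with rare colours alternate between these two classes, apart from
    -- one possible visit to a third.
    κ₀ κ₁ : Fin d
    κ₀ = subst Fin d≡ zero
    κ₁ = subst Fin d≡ (suc zero)

    κ₀≢κ₁ : κ₀ ≢ κ₁
    κ₀≢κ₁ = go d≡
      where
      go : ∀ {d} (e : 2 + d₀ ≡ d) → subst Fin e zero ≢ subst Fin e (suc zero)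
      go refl ()

    κ₁≢κ₀ : κ₁ ≢ κ₀
    κ₁≢κ₀ = κ₀≢κ₁ ∘ sym

    -- Walks and small pieces inside one clean box.

    module InBox {P q L M B} (2≤M : 2 ≤ M) (C : CleanBox P q L M B) where

      open CleanBox C

      NotB : V → Set
      NotB v = ∀ i a → a < M → v ≢ B i a

      tup-Reach : ∀ {τ} i → B i (τ i) ∈ Reach L (tup τ)
      tup-Reach i = ∈-++⁺ˡ (∈-toList⁺ i)

      tup-∈⁻ : ∀ τ {x} → x ∈ toList (tup τ) → ∃ λ i → x ≡ B i (τ i)
      tup-∈⁻ τ = ∈-toList⁻

      L-Reach : ∀ {τ c} → c ∈ L (tup τ) → c ∈ Reach L (tup τ)
      L-Reach {τ} m = ∈-++⁺ʳ (toList (tup τ)) (∈-++⁺ˡ m)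

      nb-Reach : ∀ {τ c z u} → c ∈ L (tup τ) → z ∈ toList (tup τ) → u ∈ take t₁ (nbrs (c ∷ z ∷ [])) →
                 u ∈ Reach L (tup τ)
      nb-Reach {τ} m m' m'' = ∈-++⁺ʳ (toList (tup τ)) (∈-++⁺ʳ (L (tup τ))
        (∈-concatMap⁺ _ (Any.map (λ { refl →
           ∈-concatMap⁺ _ (Any.map (λ { refl → m'' }) m') }) m)))

      -- For different indices, the constant tuple at `b` has `B j b` in its `Reach`, which excludes
      -- `B i a`. For equal indices in different classes, changing the index in class `i` alone
      -- keeps `B j a` in the tuple and excludes `B i a`; this takes a second index, whence `2 ≤ M`.
      B-inj : ∀ {i a j b} → a < M → b < M → B i a ≡ B j b → i ≡ j × a ≡ b
      B-inj {i} {a} {j} {b} a< b< eq with a ≟ b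
      ... | no a≢b = ⊥-elim (B-clean (λ _ → b<) a< (a≢b ∘ sym) (subst (_∈ Reach L (tup (λ _ → b))) (sym eq) (tup-Reach j)))
      ... | yes refl with i Finₚ.≟ j
      ...   | yes refl = refl , refl
      ...   | no i≢j = ⊥-elim (B-clean {τ} {i} valid a< ne (subst (_∈ Reach L (tup τ)) (sym eq)
                         (subst (λ x → B j x ∈ Reach L (tup τ)) (mix-≢ (i≢j ∘ sym)) (tup-Reach j))))
        where
        other : ℕ → ℕ
        other zero    = 1
        other (suc _) = 0
        other< : ∀ x → other x < M
        other< zero    = 2≤M
        other< (suc _) = ≤-trans (s≤s z≤n) 2≤M
        other≢ : ∀ x → other x ≢ x
        other≢ zero    ()
        other≢ (suc _) ()
        τ = mix a i (other a)
        valid : Valid τ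
        valid = mix-case {k = a} {i} (_< M) a< (other< a)
        ne : τ i ≢ a
        ne = λ e → other≢ a (trans (sym (mix-≡ {k = a} {i})) e)

      Edge-∉ : ∀ {τ c} → Edge (c ∷ toList (tup τ)) → c ∉ toList (tup τ)
      Edge-∉ {τ} ed = Unique-head (E-uniq _ (cong suc (length-toList (tup τ))) ed)

      -- A box vertex of the point itself would be repeated in an edge; any other box vertex is
      -- excluded by `B-clean`.
      L-NotB : ∀ {τ c} → Valid τ → c ∈ L (tup τ) → NotB c
      L-NotB {τ} v m i a a< refl with τ i ≟ a
      ... | yes refl = Edge-∉ (L-edge v m) (∈-toList⁺ i)
      ... | no ne    = B-clean v a< ne (L-Reach m)

      P-NotB : ∀ {c} → c ∈ P → NotB c
      P-NotB m i a a< refl = Edge-∉ {λ _ → a} (P-edge (λ _ → a<) m) (∈-toList⁺ i)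

      line : List (Fin d) → ℕ → List V
      line is k = map (λ i → B i k) (others is)

      line-∈⁻ : ∀ is k {v} → v ∈ line is k → ∃ λ i → i ∉ is × v ≡ B i k
      line-∈⁻ is k m with ∈-map⁻ (λ i → B i k) m
      ... | i , p , e = i , others-∈⁻ is p , e

      line-∈⁺ : ∀ {is k i} → i ∉ is → B i k ∈ line is k
      line-∈⁺ h = ∈-map⁺ (λ i → B i _) (others-∈⁺ h)

      line-Unique : ∀ is {k} → k < M → Unique (line is k)
      line-Unique is k< = Uniq.map⁺ (λ e → proj₁ (B-inj k< k< e)) (others-Unique is)

      line-length₁ : ∀ κ k → length (line [ κ ] k) ≡ suc d₀
      line-length₁ κ k = trans (length-map _ (others [ κ ])) (suc-injective (trans (others-length {is = [ κ ]} ([] ∷ [])) (sym d≡)))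

      line-length₂ : ∀ {κ κ'} k → κ ≢ κ' → length (line (κ ∷ κ' ∷ []) k) ≡ d₀
      line-length₂ {κ} {κ'} k ne = trans (length-map _ (others (κ ∷ κ' ∷ []))) (suc-injective (suc-injective
        (trans (others-length {is = κ ∷ κ' ∷ []} (Unique-∷ (λ { (here e) → ne e ; (there ()) }) ([] ∷ []))) (sym d≡))))

      -- The colour is an expansion vertex here, so each plain edge needs a colour of its own. All
      -- its other vertices except `B κ' k'` have index `k`.
      plain-edge : ∀ {κ κ' k k' c} → κ ≢ κ' → Edge (c ∷ toList (tup (mix k κ' k'))) →
        Hyperedge (B κ k) (B κ' k') (line (κ ∷ κ' ∷ []) k ++ [ c ])
      plain-edge {κ} {κ'} {k} {k'} {c} ne ed =
        trans (length-++ (line (κ ∷ κ' ∷ []) k)) (trans (cong (_+ 1) (line-length₂ k ne)) (+-comm d₀ 1)) ,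
        E-resp sub sup ed
        where
        l = B κ k ∷ B κ' k' ∷ (line (κ ∷ κ' ∷ []) k ++ [ c ])
        pt : ∀ i → B i (mix k κ' k' i) ∈ l
        pt i with i Finₚ.≟ κ'
        ... | yes refl = there (here refl)
        ... | no i≢κ' with i Finₚ.≟ κ
        ...   | yes refl = here refl
        ...   | no i≢κ = there (there (∈-++⁺ˡ (line-∈⁺ λ { (here e) → i≢κ e ; (there (here e)) → i≢κ' e })))
        sub : (c ∷ toList (tup (mix k κ' k'))) ⊆ l
        sub (here refl) = there (there (∈-++⁺ʳ (line (κ ∷ κ' ∷ []) k) (here refl)))
        sub (there m) with tup-∈⁻ (mix k κ' k') m
        ... | i , refl = pt i
        at : ∀ {i} → i ≢ κ' → B i k ∈ toList (tup (mix k κ' k'))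
        at {i} ne = subst (λ x → B i x ∈ toList (tup (mix k κ' k'))) (mix-≢ ne) (∈-toList⁺ i)
        sup : l ⊆ (c ∷ toList (tup (mix k κ' k')))
        sup (here refl) = there (at ne)
        sup (there (here refl)) = there (subst (λ x → B κ' x ∈ toList (tup (mix k κ' k'))) (mix-≡ {k = k} {κ'} {k'}) (∈-toList⁺ κ'))
        sup (there (there m)) with ∈-++⁻ (line (κ ∷ κ' ∷ []) k) m
        ... | inj₂ (here refl) = here refl
        ... | inj₁ m' with line-∈⁻ (κ ∷ κ' ∷ []) k m'
        ...   | i , i∉ , refl = there (at (λ e → i∉ (there (here e))))

      -- Here the colour is a base vertex. With `hop-out` it accounts for two consecutive edges,
      -- which is why popular colours suffice at the rate of the crosscut number.
      hop-in : ∀ {κ k c} → Edge (c ∷ toList (tup (λ _ → k))) → Hyperedge (B κ k) c (line [ κ ] k)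
      hop-in {κ} {k} {c} ed = line-length₁ κ k , E-resp sub sup ed
        where
        sub : (c ∷ toList (tup (λ _ → k))) ⊆ (B κ k ∷ c ∷ line [ κ ] k)
        sub (here refl) = there (here refl)
        sub (there m) with tup-∈⁻ (λ _ → k) m
        ... | i , refl with i Finₚ.≟ κ
        ...   | yes refl = here refl
        ...   | no ne = there (there (line-∈⁺ λ { (here e) → ne e }))
        sup : (B κ k ∷ c ∷ line [ κ ] k) ⊆ (c ∷ toList (tup (λ _ → k)))
        sup (here refl) = there (∈-toList⁺ κ)
        sup (there (here refl)) = here refl
        sup (there (there m)) with line-∈⁻ [ κ ] k m
        ... | i , _ , refl = there (∈-toList⁺ i)

      hop-out : ∀ {κ k k' c} → Edge (c ∷ toList (tup (mix k κ k'))) → Hyperedge c (B κ k') (line [ κ ] k)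
      hop-out {κ} {k} {k'} {c} ed = line-length₁ κ k , E-resp sub sup ed
        where
        l = c ∷ B κ k' ∷ line [ κ ] k
        pt : ∀ i → B i (mix k κ k' i) ∈ l
        pt i with i Finₚ.≟ κ
        ... | yes refl = there (here refl)
        ... | no ne = there (there (line-∈⁺ λ { (here e) → ne e }))
        sub : (c ∷ toList (tup (mix k κ k'))) ⊆ l
        sub (here refl) = here refl
        sub (there m) with tup-∈⁻ (mix k κ k') m
        ... | i , refl = pt i
        sup : l ⊆ (c ∷ toList (tup (mix k κ k')))
        sup (here refl) = here refl
        sup (there (here refl)) = there (subst (λ x → B κ x ∈ toList (tup (mix k κ k'))) (mix-≡ {k = k} {κ} {k'}) (∈-toList⁺ κ))
        sup (there (there m)) with line-∈⁻ [ κ ] k m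
        ... | i , i∉ , refl = there (subst (λ x → B i x ∈ toList (tup (mix k κ k'))) (mix-≢ (λ e → i∉ (here e))) (∈-toList⁺ i))

      OnB : List ℕ → V → Set
      OnB ks v = ∃ λ i → ∃ λ k → k ∈ ks × v ≡ B i k

      -- Recording the indices `ks` and colours `cs` in use reduces disjointness of old and new
      -- vertices to disjointness of these lists. The end `w` is not recorded, since the walk may
      -- return to it.
      record Seg (ks : List ℕ) (cs : List V) (ℓ : ℕ) (u w : V) : Set where
        field
          bs    : List V
          exs   : List (List V)
          walk  : Walk u w ℓ bs exs
          distinct : Unique (bs ++ concat exs)
          from  : ∀ {v} → v ∈ bs ++ concat exs → OnB ks v ⊎ v ∈ cs
          ks<M  : ∀ {k} → k ∈ ks → k < M
          csB   : ∀ {c} → c ∈ cs → NotB c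
      open Seg public

      seg-stop : ∀ {u} → Seg [] [] 0 u u
      seg-stop = record { bs = [] ; exs = [] ; walk = stop ; distinct = [] ; from = λ () ; ks<M = λ () ; csB = λ () }

      seg-cons : ∀ {u v w ex ks cs ℓ} (nk : List ℕ) (new : List V) → Hyperedge u v ex → Unique (u ∷ ex) →
        (∀ {x} → x ∈ u ∷ ex → OnB nk x ⊎ x ∈ new) → (∀ {k} → k ∈ nk → k < M) → Disjoint nk ks →
        (∀ {c} → c ∈ new → NotB c) → Disjoint new cs →
        Seg ks cs ℓ v w → Seg (nk ++ ks) (new ++ cs) (suc ℓ) u w
      seg-cons {u} {ex = ex} {ks} {cs} nk new he uq fr nk< djk newB djc S = record
        { bs = u ∷ bs S
        ; exs = ex ∷ exs S
        ; walk = he ∷ walk S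
        ; distinct = Unique-∷ (λ m → [ (λ a → Unique-head uq a) , (λ a → apart (here refl) a) ]′ (∈-insert⁻ (bs S) ex m))
                   (Unique-insert (bs S) (distinct S) (Unique-tail uq) (λ a b → apart (there a) b))
        ; from = λ { (here e) → old₁ (fr (here e)) ; (there m) → [ (λ a → old₁ (fr (there a))) , (λ a → old₂ (from S a)) ]′ (∈-insert⁻ (bs S) ex m) }
        ; ks<M = λ m → [ nk< , ks<M S ]′ (∈-++⁻ nk m)
        ; csB = λ m → [ newB , csB S ]′ (∈-++⁻ new m)
        }
        where
        apart : ∀ {x} → x ∈ u ∷ ex → x ∈ bs S ++ concat (exs S) → ⊥
        apart m m' with fr m | from S m'
        ... | inj₁ (i , k , k∈ , refl) | inj₁ (j , l , l∈ , e) =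
              djk k∈ (subst (_∈ ks) (sym (proj₂ (B-inj (nk< k∈) (ks<M S l∈) e))) l∈)
        ... | inj₁ (i , k , k∈ , refl) | inj₂ c = csB S c i k (nk< k∈) refl
        ... | inj₂ c | inj₁ (j , l , l∈ , e) = newB c j l (ks<M S l∈) e
        ... | inj₂ c | inj₂ c' = djc c c'
        old₁ : ∀ {x} → OnB nk x ⊎ x ∈ new → OnB (nk ++ ks) x ⊎ x ∈ new ++ cs
        old₁ (inj₁ (i , k , m , e)) = inj₁ (i , k , ∈-++⁺ˡ m , e)
        old₁ (inj₂ m) = inj₂ (∈-++⁺ˡ m)
        old₂ : ∀ {x} → OnB ks x ⊎ x ∈ cs → OnB (nk ++ ks) x ⊎ x ∈ new ++ cs
        old₂ (inj₁ (i , k , m , e)) = inj₁ (i , k , ∈-++⁺ʳ nk m , e)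
        old₂ (inj₂ m) = inj₂ (∈-++⁺ʳ new m)

      private
        one : ∀ {A : Set} {x : A} {xs : List A} → x ∉ xs → Disjoint [ x ] xs
        one h (here refl) m = h m

      seg-plain : ∀ {κ κ' k k' c ks cs ℓ w} → κ ≢ κ' → k < M → k ∉ ks → NotB c → c ∉ cs →
        Edge (c ∷ toList (tup (mix k κ' k'))) →
        Seg ks cs ℓ (B κ' k') w → Seg (k ∷ ks) (c ∷ cs) (suc ℓ) (B κ k) w
      seg-plain {κ} {κ'} {k} {k'} {c} ne k< k∉ cB c∉ ed S =
        seg-cons [ k ] [ c ] (plain-edge ne ed) uq fr (λ { (here refl) → k< }) (one k∉) (λ { (here refl) → cB }) (one c∉) S
        where
        uq : Unique (B κ k ∷ (line (κ ∷ κ' ∷ []) k ++ [ c ]))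
        uq = Unique-∷ (λ m → [ (λ a → let i , i∉ , e = line-∈⁻ (κ ∷ κ' ∷ []) k a in i∉ (here (sym (proj₁ (B-inj k< k< e)))))
                              , (λ { (here e) → cB κ k k< (sym e) }) ]′ (∈-++⁻ (line (κ ∷ κ' ∷ []) k) m))
               (Unique-++ (line-Unique (κ ∷ κ' ∷ []) k<) ([] ∷ []) λ { a (here refl) → let i , _ , e = line-∈⁻ (κ ∷ κ' ∷ []) k a in cB i k k< e })
        fr : ∀ {x} → x ∈ B κ k ∷ (line (κ ∷ κ' ∷ []) k ++ [ c ]) → OnB [ k ] x ⊎ x ∈ [ c ]
        fr (here e) = inj₁ (κ , k , here refl , e)
        fr (there m) with ∈-++⁻ (line (κ ∷ κ' ∷ []) k) m
        ... | inj₁ a = let i , _ , e = line-∈⁻ (κ ∷ κ' ∷ []) k a in inj₁ (i , k , here refl , e)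
        ... | inj₂ a = inj₂ a

      seg-hop : ∀ {κ κ' k l k' c ks cs ℓ w} → k < M → l < M → k' < M → k ≢ l → k ∉ ks → l ∉ ks → c ∈ P → c ∉ cs →
        Seg ks cs ℓ (B κ' k') w → Seg (k ∷ l ∷ ks) (c ∷ cs) (2 + ℓ) (B κ k) w
      seg-hop {κ} {κ'} {k} {l} {k'} {c} {ks} k< l< k'< k≢l k∉ l∉ c∈ c∉ S =
        seg-cons [ k ] [] (hop-in (P-edge (λ _ → k<) c∈)) uq₁ (inj₁ ∘ fr₁) (λ { (here refl) → k< })
          (one λ { (here e) → k≢l e ; (there m) → k∉ m }) (λ ()) (λ ())
          (seg-cons [ l ] [ c ] (hop-out {κ'} {l} {k'} (P-edge (mix-case {k = l} {κ'} (_< M) l< k'<) c∈)) uq₂ fr₂ (λ { (here refl) → l< })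
            (one l∉) (λ { (here refl) → P-NotB c∈ }) (one c∉) S)
        where
        uq₁ : Unique (B κ k ∷ line [ κ ] k)
        uq₁ = Unique-∷ (λ a → let i , i∉ , e = line-∈⁻ [ κ ] k a in i∉ (here (sym (proj₁ (B-inj k< k< e))))) (line-Unique [ κ ] k<)
        fr₁ : ∀ {x} → x ∈ B κ k ∷ line [ κ ] k → OnB [ k ] x
        fr₁ (here e) = κ , k , here refl , e
        fr₁ (there m) = let i , _ , e = line-∈⁻ [ κ ] k m in i , k , here refl , e
        uq₂ : Unique (c ∷ line [ κ' ] l)
        uq₂ = Unique-∷ (λ a → let i , _ , e = line-∈⁻ [ κ' ] l a in P-NotB c∈ i l l< e) (line-Unique [ κ' ] l<)
        fr₂ : ∀ {x} → x ∈ c ∷ line [ κ' ] l → OnB [ l ] x ⊎ x ∈ [ c ]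
        fr₂ (here e) = inj₂ (here e)
        fr₂ (there m) = let i , _ , e = line-∈⁻ [ κ' ] l m in inj₁ (i , l , here refl , e)

      -- Soft vertices are protected by the cleaning: nothing reached from a disjoint range of
      -- indices meets them. The `Extra` vertices below lack this protection towards one another and
      -- have to be recorded in a list `W`.
      Soft : V → Set
      Soft v = (∃ λ i → ∃ λ a → a < M × v ≡ B i a) ⊎ (∃ λ τ → Valid τ × v ∈ L (tup τ))

      Extra : V → Set
      Extra v = v ∈ P ⊎ (∃ λ τ → Valid τ × v ∈ Reach L (tup τ))

      -- A copy of H inside the box; the vertices xs are those that other boxes may want as well.
      record Comp (H : HGraph) (W : List V) (b : ℕ) : Set where
        field
          vs    : List V
          xs    : List V
          real  : Realizes H vs
          parts : ∀ {v} → v ∈ vs → Soft v ⊎ v ∈ xs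
          extra : ∀ {x} → x ∈ xs → Extra x × x ∉ W
          size  : length xs ≤ b

      Coloured : List V → List V → Set
      Coloured cs xs = ∀ {c} → c ∈ cs → (∃ λ τ → Valid τ × c ∈ L (tup τ)) ⊎ c ∈ xs

      module _ {W : List V} {b : ℕ} (xs : List V) (ext : ∀ {x} → x ∈ xs → Extra x × x ∉ W) (sz : length xs ≤ b) where

        seg-parts : ∀ {ks cs ℓ u w} (S : Seg ks cs ℓ u w) → Coloured cs xs →
                    ∀ {v} → v ∈ bs S ++ concat (exs S) → Soft v ⊎ v ∈ xs
        seg-parts S col m with from S m
        ... | inj₁ (i , k , k∈ , e) = inj₁ (inj₁ (i , k , ks<M S k∈ , e))
        ... | inj₂ c with col c
        ...   | inj₁ s = inj₁ (inj₂ s)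
        ...   | inj₂ x = inj₂ x

        cycle-comp : ∀ {ks cs ℓ u} → Seg ks cs (suc ℓ) u u → Coloured cs xs → Comp (Qexp r false (suc ℓ)) W b
        cycle-comp S col = record
          { vs = bs S ++ concat (exs S) ; xs = xs ; real = realizes-cycle r r∸2 (walk S) (distinct S)
          ; parts = seg-parts S col ; extra = ext ; size = sz }

        path-comp : ∀ {ks cs ℓ u κ e} → Seg ks cs ℓ u (B κ e) → e < M → e ∉ ks → Coloured cs xs →
                    Comp (Qexp r true ℓ) W b
        path-comp {ks} {cs} {ℓ} {u} {κ} {e} S e< e∉ col = record
          { vs = (bs S ++ [ B κ e ]) ++ concat (exs S) ; xs = xs
          ; real = realizes-path r r∸2 (walk S) (distinct S) end∉
          ; parts = parts' ; extra = ext ; size = sz }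
          where
          end∉ : B κ e ∉ bs S ++ concat (exs S)
          end∉ m with from S m
          ... | inj₁ (i , k , k∈ , eq) = e∉ (subst (_∈ ks) (sym (proj₂ (B-inj e< (ks<M S k∈) eq))) k∈)
          ... | inj₂ c = csB S c κ e e< refl
          parts' : ∀ {v} → v ∈ (bs S ++ [ B κ e ]) ++ concat (exs S) → Soft v ⊎ v ∈ xs
          parts' m with ∈-++⁻ (bs S ++ [ B κ e ]) m
          ... | inj₂ m' = seg-parts S col (∈-++⁺ʳ (bs S) m')
          ... | inj₁ m' with ∈-++⁻ (bs S) m'
          ...   | inj₁ m'' = seg-parts S col (∈-++⁺ˡ m'')
          ...   | inj₂ (here eq) = inj₁ (inj₁ (κ , e , e< , eq))

        cycle-path-comp : ∀ {ks cs ℓ u} → Seg ks cs (suc ℓ) u u → Coloured cs xs → Comp (Qexp r true ℓ) W b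
        cycle-path-comp S col =
          let vs , real , sub = realizes-cycle-path r r∸2 (walk S) (distinct S)
          in record { vs = vs ; xs = xs ; real = real ; parts = λ m → seg-parts S col (sub m) ; extra = ext ; size = sz }

      mix-valid : ∀ {k κ k'} → k < M → k' < M → Valid (mix k κ k')
      mix-valid {k} {κ} {k'} a b = mix-case {k = k} {κ} {k'} (_< M) a b

      -- Colours reached from points disjoint from the new one are excluded by the cleaning, so only
      -- the members of `A` have to be avoided by hand, and these are fewer than the `q` candidates.
      pick : ∀ (A cs : List V) {k κ k'} → length A < q → k < M → k' < M →
        (∀ {c} → c ∈ cs → c ∈ A ⊎ (∃ λ τ → Valid τ × c ∈ Reach L (tup τ) × (∀ i → τ i ≢ k × τ i ≢ k'))) →
        ∃ λ c → c ∈ L (tup (mix k κ k')) × c ∉ A × c ∉ cs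
      pick A cs {k} {κ} {k'} sz k< k'< pr =
        let v          = mix-valid {k} {κ} {k'} k< k'<
            c , c∈ , c∉A = avoid A (L-uniq v) (≤-trans sz (≤-reflexive (sym (L-size v))))
        in c , c∈ , c∉A , λ m → [ c∉A , (λ { (τ , vτ , cR , ne) → L-clean vτ v (dis τ ne) cR c∈ }) ]′ (pr m)
        where
        dis : ∀ τ → (∀ i → τ i ≢ k × τ i ≢ k') → ∀ i → τ i ≢ mix k κ k' i
        dis τ ne i = mix-case {k = k} {κ} {k'} (λ x → τ i ≢ x) (proj₁ (ne i)) (proj₂ (ne i)) i

      -- A walk under construction (backwards) whose colours are taken from the lists L.  New
      -- colours avoid the first colour c₁ and Z; fresh indices start at g, those in Sp are reserved.
      record State (base Z : List V) (Sp : List ℕ) (lo g : ℕ) (κ : Fin d) (k ℓ : ℕ) (w : V) : Set where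
        field
          ks    : List ℕ
          c₁    : V
          cs    : List V
          seg   : Seg ks (c₁ ∷ cs) ℓ (B κ k) w
          ks-ok : ∀ {k} → k ∈ ks → k < g × k ∉ Sp × lo ≤ k
          k-ok  : k < g × k ∉ Sp × lo ≤ k × k < M
          inv₁  : c₁ ∈ Z ⊎ (∃ λ τ → Valid τ × c₁ ∈ Reach L (tup τ) × (∀ i → τ i < g × τ i ∉ Sp))
          inv   : ∀ {c} → c ∈ cs → c ∈ Z ⊎
                  (∃ λ τ → Valid τ × c ∈ Reach L (tup τ) × (∀ i → τ i < g × τ i ∉ Sp × τ i ≢ k))
          prov  : ∀ {c} → c ∈ c₁ ∷ cs → c ∈ base ⊎
                  (c ∉ Z × ∃ λ τ → Valid τ × c ∈ L (tup τ) × (∀ i → lo ≤ τ i))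

      module _ {base Z : List V} {Sp : List ℕ} {lo : ℕ} (room : suc (length Z) < q) where

        -- The new point has index `g` everywhere except for `k` in class `κ`. Apart from `Z`, only
        -- the latest colour `c₁` may stem from a point using `k`, so it is avoided explicitly; for
        -- the older ones `inv` gives disjointness.
        grow : ∀ {g κ κ' k ℓ w} → κ' ≢ κ → g < M → g ∉ Sp → lo ≤ g →
          State base Z Sp lo g κ k ℓ w → State base Z Sp lo (suc g) κ' g (suc ℓ) w
        grow {g} {κ} {κ'} {k} κ'≢κ g< g∉ lo≤ S =
          record
            { ks = g ∷ ks ; c₁ = c ; cs = c₁ ∷ cs
            ; seg = seg-plain κ'≢κ g< (λ m → <-irrefl refl (proj₁ (ks-ok m))) (L-NotB v c∈) c∉
                      (L-edge v c∈) seg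
            ; ks-ok = λ { (here refl) → ≤-refl , g∉ , lo≤
                        ; (there m) → let a , b , e = ks-ok m in m≤n⇒m≤1+n a , b , e }
            ; k-ok = ≤-refl , g∉ , lo≤ , g<
            ; inv₁ = inj₂ (mix g κ k , v , L-Reach c∈ ,
                       mix-case {k = g} {κ} {k} (λ x → x < suc g × x ∉ Sp) (≤-refl , g∉) (m≤n⇒m≤1+n k<g , k∉))
            ; inv = λ { (here refl) → inv₁' inv₁ ; (there m) → inv' (inv m) }
            ; prov = λ { (here refl) → inj₂ ((λ z → c∉A (there z)) , mix g κ k , v , c∈ ,
                            mix-case {k = g} {κ} {k} (lo ≤_) lo≤ lo≤k)
                       ; (there m) → prov m }
            }
          where
          open State S
          k<g = proj₁ k-ok
          k∉ = proj₁ (proj₂ k-ok)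
          lo≤k = proj₁ (proj₂ (proj₂ k-ok))
          k< = proj₂ (proj₂ (proj₂ k-ok))
          v = mix-valid {g} {κ} {k} g< k<
          old : ∀ {c'} → c' ∈ c₁ ∷ cs → c' ∈ c₁ ∷ Z ⊎
            (∃ λ τ → Valid τ × c' ∈ Reach L (tup τ) × (∀ i → τ i ≢ g × τ i ≢ k))
          old (here e) = inj₁ (here e)
          old (there m) with inv m
          ... | inj₁ z = inj₁ (there z)
          ... | inj₂ (τ , vτ , cR , ne) = inj₂ (τ , vτ , cR , λ i → <⇒≢ (proj₁ (ne i)) , proj₂ (proj₂ (ne i)))
          choice = pick (c₁ ∷ Z) (c₁ ∷ cs) {g} {κ} {k} room g< k< old
          c = proj₁ choice
          c∈ = proj₁ (proj₂ choice)
          c∉A = proj₁ (proj₂ (proj₂ choice))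
          c∉ = proj₂ (proj₂ (proj₂ choice))
          inv₁' : ∀ {c'} → c' ∈ Z ⊎ (∃ λ τ → Valid τ × c' ∈ Reach L (tup τ) × (∀ i → τ i < g × τ i ∉ Sp)) →
            c' ∈ Z ⊎ (∃ λ τ → Valid τ × c' ∈ Reach L (tup τ) × (∀ i → τ i < suc g × τ i ∉ Sp × τ i ≢ g))
          inv₁' (inj₁ z) = inj₁ z
          inv₁' (inj₂ (τ , vτ , cR , f)) = inj₂ (τ , vτ , cR , λ i → m≤n⇒m≤1+n (proj₁ (f i)) , proj₂ (f i) , <⇒≢ (proj₁ (f i)))
          inv' : ∀ {c'} → c' ∈ Z ⊎ (∃ λ τ → Valid τ × c' ∈ Reach L (tup τ) × (∀ i → τ i < g × τ i ∉ Sp × τ i ≢ k)) →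
            c' ∈ Z ⊎ (∃ λ τ → Valid τ × c' ∈ Reach L (tup τ) × (∀ i → τ i < suc g × τ i ∉ Sp × τ i ≢ g))
          inv' (inj₁ z) = inj₁ z
          inv' (inj₂ (τ , vτ , cR , f)) = inj₂ (τ , vτ , cR ,
            λ i → m≤n⇒m≤1+n (proj₁ (f i)) , proj₁ (proj₂ (f i)) , <⇒≢ (proj₁ (f i)))

        grow₂ : ∀ i {g k ℓ w} → g + (i + i) ≤ M → (∀ {s} → s ∈ Sp → s < g) → lo ≤ g →
          State base Z Sp lo g κ₁ k ℓ w → ∃ λ g' → ∃ λ k' → State base Z Sp lo g' κ₁ k' ((i + i) + ℓ) w
        grow₂ zero le sp lo≤ S = _ , _ , S
        grow₂ (suc i) {g} {k} {ℓ} {w} le sp lo≤ S =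
          let le' : suc (suc g) + (i + i) ≤ M
              le' = ≤-trans (≤-reflexive (lem g i)) le
              g<' : suc g < M
              g<' = ≤-trans (m≤m+n _ _) le'
              S₁ = grow κ₀≢κ₁ (<-trans (n<1+n g) g<') (λ m → <-irrefl refl (sp m)) lo≤ S
              S₂ = grow κ₁≢κ₀ g<' (λ m → <-asym (sp m) (n<1+n g)) (m≤n⇒m≤1+n lo≤) S₁
              g'' , k'' , S₃ = grow₂ i le' (λ m → m≤n⇒m≤1+n (m≤n⇒m≤1+n (sp m))) (m≤n⇒m≤1+n (m≤n⇒m≤1+n lo≤)) S₂
          in g'' , k'' , subst (λ x → State base Z Sp lo g'' κ₁ k'' x w) (lem' i ℓ) S₃
          where
          lem : ∀ g i → suc (suc g) + (i + i) ≡ g + (suc i + suc i)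
          lem = solve-∀
          lem' : ∀ i ℓ → (i + i) + suc (suc ℓ) ≡ (suc i + suc i) + ℓ
          lem' = solve-∀

        -- Ends the construction at a reserved index `s`: apart from colours in `Z` and the latest
        -- one, all colours so far stem from points that use neither `s` nor `k`.
        finish : ∀ {g κ κ' k ℓ w s} → κ' ≢ κ → s < M → s ∈ Sp → (S : State base Z Sp lo g κ k ℓ w) →
          ∃ λ c → c ∈ L (tup (mix s κ k)) × c ∉ Z ×
            Seg (s ∷ State.ks S) (c ∷ State.c₁ S ∷ State.cs S) (suc ℓ) (B κ' s) w
        finish {g} {κ} {κ'} {k} {s = s} κ'≢κ s< s∈ S = c , c∈ , (λ z → c∉A (there z)) ,
          seg-plain κ'≢κ s< (λ m → proj₁ (proj₂ (ks-ok m)) s∈) (L-NotB v c∈) c∉ (L-edge v c∈) seg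
          where
          open State S
          k< = proj₂ (proj₂ (proj₂ k-ok))
          v = mix-valid {s} {κ} {k} s< k<
          old : ∀ {c'} → c' ∈ c₁ ∷ cs → c' ∈ c₁ ∷ Z ⊎
            (∃ λ τ → Valid τ × c' ∈ Reach L (tup τ) × (∀ i → τ i ≢ s × τ i ≢ k))
          old (here e) = inj₁ (here e)
          old (there m) with inv m
          ... | inj₁ z = inj₁ (there z)
          ... | inj₂ (τ , vτ , cR , ne) = inj₂ (τ , vτ , cR ,
                  λ i → (λ e → proj₁ (proj₂ (ne i)) (subst (_∈ Sp) (sym e) s∈)) , proj₂ (proj₂ (ne i)))
          choice = pick (c₁ ∷ Z) (c₁ ∷ cs) {s} {κ} {k} room s< k< old
          c = proj₁ choice
          c∈ = proj₁ (proj₂ choice)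
          c∉A = proj₁ (proj₂ (proj₂ choice))
          c∉ = proj₂ (proj₂ (proj₂ choice))

      -- If index 0 is reserved for closing a cycle, then the first point uses a reserved index and
      -- its colour has to be kept away from all later ones by putting it into `Z`.
      start : ∀ {κ k c} Z Sp lo g → κ ≢ κ₀ → k < M → k < g → k ∉ Sp → lo ≤ k →
        c ∈ L (tup (mix k κ₀ 0)) → c ∈ Z ⊎ 0 ∉ Sp → State [ c ] Z Sp lo g κ k 1 (B κ₀ 0)
      start {κ} {k} {c} Z Sp lo g κ≢ k< k<g k∉ lo≤ c∈ sp = record
        { ks = [ k ] ; c₁ = c ; cs = []
        ; seg = seg-plain κ≢ k< (λ ()) (L-NotB v c∈) (λ ()) (L-edge v c∈) seg-stop
        ; ks-ok = λ { (here refl) → k<g , k∉ , lo≤ }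
        ; k-ok = k<g , k∉ , lo≤ , k<
        ; inv₁ = [ inj₁ , (λ 0∉ → inj₂ (mix k κ₀ 0 , v , L-Reach c∈ ,
                   mix-case {k = k} {κ₀} {0} (λ x → x < g × x ∉ Sp) (k<g , k∉) (≤-trans (s≤s z≤n) k<g , 0∉))) ]′ sp
        ; inv = λ ()
        ; prov = λ { (here e) → inj₁ (here e) }
        }
        where v = mix-valid {k} {κ₀} {0} k< (≤-trans (s≤s z≤n) 2≤M)

      some : 0 < q → ∀ {k κ k'} → k < M → k' < M → ∃ λ c → c ∈ L (tup (mix k κ k'))
      some q>0 {k} {κ} {k'} k< k'< = let c , c∈ , _ = pick [] [] {k} {κ} {k'} q>0 k< k'< (λ ()) in c , c∈

      ColouredCycle : ℕ → List V → Set
      ColouredCycle ℓ xs = ∃ λ ks → ∃ λ cs → Seg ks cs ℓ (B κ₀ 0) (B κ₀ 0) × Coloured cs xs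

      close : ∀ {g c k ℓ} → 3 ≤ q → c ∈ L (tup (mix 2 κ₀ 0)) → 2 < M →
        State [ c ] [ c ] [ 0 ] 2 g κ₁ k ℓ (B κ₀ 0) → ColouredCycle (suc ℓ) []
      close {g} {c} {k} 3≤q c∈ 2<M S = _ , _ , seg' , col
        where
        0<M = ≤-trans (s≤s z≤n) 2≤M
        fin = finish 3≤q κ₀≢κ₁ 0<M (here refl) S
        seg' = proj₂ (proj₂ (proj₂ fin))
        col : Coloured _ []
        col (here refl) = inj₁ (mix 0 κ₁ k , mix-valid {0} {κ₁} {k} 0<M (proj₂ (proj₂ (proj₂ (State.k-ok S)))) , proj₁ (proj₂ fin))
        col (there m) with State.prov S m
        ... | inj₁ (here refl) = inj₁ (mix 2 κ₀ 0 , mix-valid {2} {κ₀} {0} 2<M 0<M , c∈)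
        ... | inj₂ (_ , τ , v , c∈' , _) = inj₁ (τ , v , c∈')

      -- Alternation between two classes gives even lengths only. Three colours per point are needed
      -- because a new edge avoids the preceding colour and also that of the first edge, which
      -- shares index 0 with the closing edge.
      rare-even : 3 ≤ q → ∀ i → 3 + (i + i) ≤ M → ColouredCycle (2 + (i + i)) []
      rare-even 3≤q i le =
        let 2<M = ≤-trans (m≤m+n 3 (i + i)) le
            c , c∈ = some (≤-trans (s≤s z≤n) 3≤q) {2} {κ₀} {0} 2<M (≤-trans (s≤s z≤n) 2≤M)
            S = start {κ₁} {2} [ c ] [ 0 ] 2 3 κ₁≢κ₀ 2<M ≤-refl (λ { (here ()) ; (there ()) }) ≤-refl c∈ (inj₁ (here refl))
            _ , _ , S' = grow₂ 3≤q i le (λ { (here refl) → s≤s z≤n }) (s≤s (s≤s z≤n)) S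
        in subst (λ ℓ → ColouredCycle ℓ []) (cong suc (+-comm (i + i) 1)) (close 3≤q c∈ 2<M S')

      -- One visit to the third class `κ₂` changes the parity.
      rare-odd : 3 ≤ q → ∀ κ₂ → κ₂ ≢ κ₀ → κ₂ ≢ κ₁ → ∀ i → 4 + (i + i) ≤ M → ColouredCycle (3 + (i + i)) []
      rare-odd 3≤q κ₂ ne₀ ne₁ i le =
        let 3<M = ≤-trans (m≤m+n 4 (i + i)) le
            2<M = <-trans (n<1+n 2) 3<M
            c , c∈ = some (≤-trans (s≤s z≤n) 3≤q) {2} {κ₀} {0} 2<M (≤-trans (s≤s z≤n) 2≤M)
            S = start {κ₂} {2} [ c ] [ 0 ] 2 3 ne₀ 2<M ≤-refl (λ { (here ()) ; (there ()) }) ≤-refl c∈ (inj₁ (here refl))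
            S₁ = grow 3≤q (ne₁ ∘ sym) 3<M (λ { (here ()) ; (there ()) }) (s≤s (s≤s z≤n)) S
            _ , _ , S' = grow₂ 3≤q i le (λ { (here refl) → s≤s z≤n }) (s≤s (s≤s z≤n)) S₁
        in subst (λ ℓ → ColouredCycle ℓ []) (cong suc (+-comm (i + i) 2)) (close 3≤q c∈ 2<M S')

      -- For 3-graphs the box is bipartite, so the parity of a cycle has to be changed: the edge
      -- {x, y, c} is replaced by the two edges {x, c, w} and {c, v, y}, which exist by fullness.
      module Parity (d₀≡0 : d₀ ≡ 0) (3≤q : 3 ≤ q) (6≤M : 6 ≤ M) where

        d≡2 : d ≡ 2
        d≡2 = trans (sym d≡) (cong (2 +_) d₀≡0)

        only : ∀ i → i ≡ κ₀ ⊎ i ≡ κ₁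
        only = go d₀≡0 d≡
          where
          go : ∀ {d₀ d} → d₀ ≡ 0 → (e : 2 + d₀ ≡ d) → ∀ i → i ≡ subst Fin e zero ⊎ i ≡ subst Fin e (suc zero)
          go refl refl zero       = inj₁ refl
          go refl refl (suc zero) = inj₂ refl

        mix-swap : ∀ {k l} → tup (mix k κ₀ l) ≡ tup (mix l κ₁ k)
        mix-swap {k} {l} = tabulate-cong λ i → cong (B i) (eq i (only i))
          where
          eq : ∀ i → i ≡ κ₀ ⊎ i ≡ κ₁ → mix k κ₀ l i ≡ mix l κ₁ k i
          eq i (inj₁ refl) = trans (mix-≡ {k = k} {κ₀} {l}) (sym (mix-≢ {k = l} {κ₁} {k} κ₀≢κ₁))
          eq i (inj₂ refl) = trans (mix-≢ {k = k} {κ₀} {l} κ₁≢κ₀) (sym (mix-≡ {k = l} {κ₁} {k}))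

        pair : ∀ {κ κ' k l c} → κ ≢ κ' → Edge (c ∷ toList (tup (mix k κ l))) → Edge (B κ l ∷ c ∷ B κ' k ∷ [])
        pair {κ} {κ'} {k} {l} {c} ne ed = E-resp sub sup ed
          where
          τ = mix k κ l
          atκ : B κ (τ κ) ≡ B κ l
          atκ = cong (B κ) (mix-≡ {k = k} {κ} {l})
          atκ' : B κ' (τ κ') ≡ B κ' k
          atκ' = cong (B κ') (mix-≢ {k = k} {κ} {l} (ne ∘ sym))
          which : ∀ i → i ≡ κ ⊎ i ≡ κ'
          which i with only i | only κ | only κ'
          ... | inj₁ a | inj₁ b | _      = inj₁ (trans a (sym b))
          ... | inj₁ a | inj₂ _ | inj₁ b = inj₂ (trans a (sym b))
          ... | inj₁ a | inj₂ b | inj₂ e = ⊥-elim (ne (trans b (sym e)))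
          ... | inj₂ a | inj₂ b | _      = inj₁ (trans a (sym b))
          ... | inj₂ a | inj₁ _ | inj₂ b = inj₂ (trans a (sym b))
          ... | inj₂ a | inj₁ b | inj₁ e = ⊥-elim (ne (trans b (sym e)))
          sub : (c ∷ toList (tup τ)) ⊆ (B κ l ∷ c ∷ B κ' k ∷ [])
          sub (here refl) = there (here refl)
          sub (there m) with tup-∈⁻ τ m
          ... | i , refl with which i
          ...   | inj₁ refl = here atκ
          ...   | inj₂ refl = there (there (here atκ'))
          sup : (B κ l ∷ c ∷ B κ' k ∷ []) ⊆ (c ∷ toList (tup τ))
          sup (here refl) = there (subst (_∈ toList (tup τ)) atκ (∈-toList⁺ κ))
          sup (there (here refl)) = here refl
          sup (there (there (here refl))) = there (subst (_∈ toList (tup τ)) atκ' (∈-toList⁺ κ'))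

        x y : V
        x = B κ₀ 0
        y = B κ₁ 1

        0<M = ≤-trans (s≤s z≤n) 6≤M
        1<M = ≤-trans (s≤s (s≤s z≤n)) 6≤M

        τ₀ : Fin d → ℕ
        τ₀ = mix 0 κ₁ 1

        vτ₀ : Valid τ₀
        vτ₀ = mix-valid {0} {κ₁} {1} 0<M 1<M

        module _ (c : V) (c∈ : c ∈ L (tup τ₀)) where

          xyc : Edge (y ∷ c ∷ x ∷ [])
          xyc = pair κ₁≢κ₀ (L-edge vτ₀ c∈)

          yxc : Edge (x ∷ c ∷ y ∷ [])
          yxc = pair κ₀≢κ₁ (subst (λ ω → Edge (c ∷ toList ω)) (sym mix-swap) (L-edge vτ₀ c∈))

          -- The new vertex v next to z = B κ b and the index a of the neighbour of z on the walk:
          -- if the colour c is repeated at z then the box itself supplies v.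
          data Side (κ κ' : Fin d) (b o₁ o₂ : ℕ) (A : List V) : V → ℕ → Set where
            inside  : c ∈ L (tup (mix b κ' o₁)) → Side κ κ' b o₁ o₂ A (B κ' o₁) o₂
            outside : ∀ {v} → c ∉ L (tup (mix b κ' o₁)) → v ∈ take t₁ (nbrs (c ∷ B κ b ∷ [])) → v ∉ A →
                      Side κ κ' b o₁ o₂ A v o₁

          side : ∀ κ κ' b o₁ o₂ A z' → Edge (z' ∷ c ∷ B κ b ∷ []) → length A < t₁ →
                 ∃ λ v → ∃ λ a → Side κ κ' b o₁ o₂ A v a
          side κ κ' b o₁ o₂ A z' ed lt with c ∈? L (tup (mix b κ' o₁))
          ... | yes p = _ , _ , inside p
          ... | no ¬p =
            let f = c ∷ B κ b ∷ []
                enough : t₁ ≤ length (nbrs f)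
                enough = full f (sym d≡2) z' ed
                v , v∈ , v∉ = avoid A (Uniq.take⁺ t₁ (nbrs-Unique f))
                  (≤-trans lt (≤-reflexive (sym (length-take-≤ t₁ (nbrs f) enough))))
            in v , _ , outside ¬p v∈ v∉

          -- A common interface to both kinds of `Side`. Of the two indices `lo` and `1 + lo` the
          -- walk continues with `a`, while `o` is left to `v`; `nk` records `o` if `v` is the box
          -- vertex there, and otherwise `new` records `v` itself.
          record Status (κ' : Fin d) (b lo : ℕ) (A : List V) (z v : V) (a : ℕ) : Set where
            field
              o      : ℕ
              nk     : List ℕ
              new    : List V
              v-from : OnB nk v ⊎ v ∈ new
              nk-o   : ∀ {k} → k ∈ nk → k ≡ o
              hard   : ∀ {u} → u ∈ new → u ≡ v × u ∈ Reach L (tup τ₀) × u ∉ A × NotB u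
              few    : length new ≤ 1
              ed     : Edge (v ∷ c ∷ z ∷ [])
              ranges : (lo ≤ a × a < 2 + lo) × (lo ≤ o × o < 2 + lo) × a ≢ o
              choose₃ : ∀ u → ∃ λ c' → c' ∈ L (tup (mix b κ' a)) × c' ≢ c × c' ≢ v × c' ≢ u

          -- `choose₃` dodges three vertices although a point may have just three rare colours,
          -- because one exclusion is free: inside, `v` is a box vertex and hence no colour;
          -- outside, `c` does not belong to the list at all.
          status : ∀ {κ κ' b lo A v a} → κ' ≢ κ → 2 + lo ≤ M → b < M → (z∈ : B κ b ∈ toList (tup τ₀)) →
            x ∈ B κ b ∷ A → y ∈ B κ b ∷ A →
            Side κ κ' b lo (suc lo) A v a → Status κ' b lo A (B κ b) v a
          status {κ} {κ'} {b} {lo} {A} ne lo< b< z∈ x∈ y∈ (inside p) = record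
            { o = lo ; nk = [ lo ] ; new = [] ; v-from = inj₁ (κ' , lo , here refl , refl)
            ; nk-o = λ { (here e) → e } ; hard = λ () ; few = z≤n
            ; ed = pair ne (L-edge (mix-valid {b} {κ'} {lo} b< (<-trans (n<1+n lo) lo<)) p)
            ; ranges = (n≤1+n lo , ≤-refl) , (≤-refl , m≤n⇒m≤1+n ≤-refl) , 1+n≢n
            ; choose₃ = λ u → let c' , c'∈ , c'∉ , _ = pick (c ∷ u ∷ []) [] {b} {κ'} {suc lo} 3≤q b< lo< (λ ())
                             in c' , c'∈ , (λ e → c'∉ (here e)) ,
                                L-NotB (mix-valid {b} {κ'} {suc lo} b< lo<) c'∈ κ' lo (<-trans (n<1+n lo) lo<) ,
                                (λ e → c'∉ (there (here e)))
            }
          status {κ} {κ'} {b} {lo} {A} {v} ne lo< b< z∈ x∈ y∈ (outside c∉ v∈ v∉) = record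
            { o = suc lo ; nk = [] ; new = [ v ] ; v-from = inj₂ (here refl) ; nk-o = λ ()
            ; hard = λ { (here refl) → refl , inReach , v∉ , notB } ; few = ≤-refl
            ; ed = ed'
            ; ranges = (≤-refl , m≤n⇒m≤1+n ≤-refl) , (n≤1+n lo , ≤-refl) , (1+n≢n ∘ sym)
            ; choose₃ = λ u → let c' , c'∈ , c'∉ , _ = pick (v ∷ u ∷ []) [] {b} {κ'} {lo} 3≤q b< (<-trans (n<1+n lo) lo<) (λ ())
                             in c' , c'∈ , (λ e → c∉ (subst (_∈ L (tup (mix b κ' lo))) e c'∈)) ,
                                (λ e → c'∉ (here e)) , (λ e → c'∉ (there (here e)))
            }
            where
            ed' : Edge (v ∷ c ∷ B κ b ∷ [])
            ed' = nbrs-∈ {c ∷ B κ b ∷ []} (take-∈ t₁ v∈)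
            inReach : v ∈ Reach L (tup τ₀)
            inReach = nb-Reach c∈ z∈ v∈
            v∉zA : v ∉ B κ b ∷ A
            v∉zA (here e) = Unique-head (E-uniq _ (cong suc (sym d≡2)) ed') (there (here e))
            v∉zA (there m) = v∉ m
            -- As a neighbour of a pair at `τ₀`, the vertex `v` belongs to the `Reach` of that
            -- point, so only the two vertices of the point itself could be box vertices equal to
            -- it; these lie in `B κ b ∷ A`.
            notB : NotB v
            notB i a a< refl with τ₀ i ≟ a
            ... | no ne' = B-clean vτ₀ a< ne' inReach
            ... | yes refl with only i
            ...   | inj₁ refl = v∉zA (subst (_∈ B κ b ∷ A) (cong (B κ₀) (sym (mix-≢ {k = 0} {κ₁} {1} κ₀≢κ₁))) x∈)
            ...   | inj₂ refl = v∉zA (subst (_∈ B κ b ∷ A) (cong (B κ₁) (sym (mix-≡ {k = 0} {κ₁} {1}))) y∈)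

        three : ∀ {u z w} → Edge (u ∷ z ∷ w ∷ []) → Unique (u ∷ z ∷ w ∷ [])
        three = E-uniq _ (cong suc (sym d≡2))

        rotate : ∀ {u z w} → Edge (u ∷ z ∷ w ∷ []) → Edge (z ∷ w ∷ u ∷ [])
        rotate = E-resp
          (λ { (here e) → there (there (here e)) ; (there (here e)) → here e ; (there (there (here e))) → there (here e) })
          (λ { (here e) → there (here e) ; (there (here e)) → there (there (here e)) ; (there (there (here e))) → here e })

        swap₃ : ∀ {u z w} → Edge (u ∷ z ∷ w ∷ []) → Edge (w ∷ z ∷ u ∷ [])
        swap₃ = E-resp
          (λ { (here e) → there (there (here e)) ; (there (here e)) → there (here e) ; (there (there (here e))) → here e })
          (λ { (here e) → there (there (here e)) ; (there (here e)) → there (here e) ; (there (there (here e))) → here e })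

        x∈τ₀ : x ∈ toList (tup τ₀)
        x∈τ₀ = subst (λ k → B κ₀ k ∈ toList (tup τ₀)) (mix-≢ {k = 0} {κ₁} {1} κ₀≢κ₁) (∈-toList⁺ κ₀)

        y∈τ₀ : y ∈ toList (tup τ₀)
        y∈τ₀ = subst (λ k → B κ₁ k ∈ toList (tup τ₀)) (mix-≡ {k = 0} {κ₁} {1}) (∈-toList⁺ κ₁)

        2≤4 : 2 ≤ 4
        2≤4 = s≤s (s≤s z≤n)

        4≤M : 4 ≤ M
        4≤M = ≤-trans (s≤s (s≤s (s≤s (s≤s z≤n)))) 6≤M

        apart₁ : ∀ {m a} → 4 ≤ m → 2 ≤ a → ∀ j → mix m κ₀ 0 j ≢ mix 1 κ₀ a j
        apart₁ {m} {a} m≥4 a≥2 j with j Finₚ.≟ κ₀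
        ... | yes _ = <⇒≢ (≤-trans (s≤s z≤n) a≥2)
        ... | no  _ = λ e → <⇒≢ (≤-trans 2≤4 m≥4) (sym e)

        -- The cycle runs x, c, y, `B κ₀ a`, and so on to `B κ₁ m` and back to x; `c₁` and `cl`
        -- colour the edges that leave y and enter x. Indices 0 and 1 belong to x and y, 2 and 3 to
        -- the side of y, 4 and 5 to the side of x, and fresh ones start at 6.
        module Detour (W : List V) (c : V) (c∈ : c ∈ L (tup τ₀)) (v : V) (a : ℕ)
                      (VSt : Status c c∈ κ₀ 1 2 (x ∷ W) y v a) (w : V) (m : ℕ)
                      (WSt : Status c c∈ κ₁ 0 4 (y ∷ v ∷ W) x w m)
                      (c₁ cl : V) (c₁∈ : c₁ ∈ L (tup (mix 1 κ₀ a))) (cl∈ : cl ∈ L (tup (mix m κ₀ 0)))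
                      (c₁≢ : c₁ ≢ c × c₁ ≢ v × c₁ ≢ w) (cl≢ : cl ≢ c × cl ≢ v × cl ≢ w) where

          private
            module VS = Status VSt
            module WS = Status WSt

          a≥2 : 2 ≤ a
          a≥2 = proj₁ (proj₁ VS.ranges)
          a<4 : a < 4
          a<4 = proj₂ (proj₁ VS.ranges)
          o≥2 : 2 ≤ VS.o
          o≥2 = proj₁ (proj₁ (proj₂ VS.ranges))
          o<4 : VS.o < 4
          o<4 = proj₂ (proj₁ (proj₂ VS.ranges))
          m≥4 : 4 ≤ m
          m≥4 = proj₁ (proj₁ WS.ranges)
          m<6 : m < 6
          m<6 = proj₂ (proj₁ WS.ranges)
          p≥4 : 4 ≤ WS.o
          p≥4 = proj₁ (proj₁ (proj₂ WS.ranges))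
          p<6 : WS.o < 6
          p<6 = proj₂ (proj₁ (proj₂ WS.ranges))
          a<M : a < M
          a<M = <-≤-trans a<4 4≤M
          v₁ : Valid (mix 1 κ₀ a)
          v₁ = mix-valid {1} {κ₀} {a} 1<M a<M
          vl : Valid (mix m κ₀ 0)
          vl = mix-valid {m} {κ₀} {0} (<-≤-trans m<6 6≤M) 0<M

          cl≢c₁ : cl ≢ c₁
          cl≢c₁ e = L-clean vl v₁ (apart₁ m≥4 a≥2) (L-Reach cl∈) (subst (_∈ L (tup (mix 1 κ₀ a))) (sym e) c₁∈)

          c≢v : c ≢ v
          c≢v e = Unique-head (three VS.ed) (here (sym e))

          w≢c : w ≢ c
          w≢c e = Unique-head (three WS.ed) (here e)

          low : (τ : Fin d → ℕ) → (∀ j → 2 ≤ τ j) → ∀ j → τ₀ j ≢ τ j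
          low τ h j = mix-case {k = 0} {κ₁} {1} (λ z → z ≢ τ j) (<⇒≢ (≤-trans (s≤s z≤n) (h j))) (<⇒≢ (h j)) j

          module Closing (ks : List ℕ) (cs : List V) (ℓ : ℕ) (S : Seg (a ∷ ks) cs ℓ (B κ₀ a) x)
                         (ks-ok : ∀ {k} → k ∈ ks → 4 ≤ k × k ≢ WS.o)
                         (cs-ok : ∀ {u} → u ∈ cs → u ≡ cl ⊎ (u ≢ c₁ ×
                            ∃ λ τ → Valid τ × u ∈ L (tup τ) × (∀ j → 2 ≤ τ j))) where

            c₁∉ : c₁ ∉ cs
            c₁∉ m with cs-ok m
            ... | inj₁ e = cl≢c₁ (sym e)
            ... | inj₂ (ne , _) = ne refl

            1∉ : 1 ∉ a ∷ ks
            1∉ (here e)  = <⇒≢ a≥2 e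
            1∉ (there m) = <⇒≱ 2≤4 (proj₁ (ks-ok m))

            Sy : Seg (1 ∷ a ∷ ks) (c₁ ∷ cs) (suc ℓ) y x
            Sy = seg-plain κ₁≢κ₀ 1<M 1∉ (L-NotB v₁ c₁∈) c₁∉ (L-edge v₁ c₁∈) S

            far : ∀ {u} → u ∈ Reach L (tup τ₀) → u ≢ c₁ → u ≢ cl → u ∉ c₁ ∷ cs
            far uR n₁ nl (here e) = n₁ e
            far uR n₁ nl (there m) with cs-ok m
            ... | inj₁ e = nl e
            ... | inj₂ (_ , τ , vτ , u∈ , h) = L-clean vτ₀ vτ (low τ h) uR u∈

            nkV-dis : Disjoint VS.nk (1 ∷ a ∷ ks)
            nkV-dis k∈ (here e) = <⇒≢ o≥2 (trans (sym e) (VS.nk-o k∈))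
            nkV-dis k∈ (there (here e)) = proj₂ (proj₂ VS.ranges) (trans (sym e) (VS.nk-o k∈))
            nkV-dis k∈ (there (there m)) = <⇒≱ o<4 (subst (4 ≤_) (VS.nk-o k∈) (proj₁ (ks-ok m)))

            newV-far : Disjoint (c ∷ VS.new) (c₁ ∷ cs)
            newV-far (here refl) = far (L-Reach c∈) (proj₁ c₁≢ ∘ sym) (proj₁ cl≢ ∘ sym)
            newV-far (there u∈) with VS.hard u∈
            ... | refl , uR , _ = far uR (proj₁ (proj₂ c₁≢) ∘ sym) (proj₁ (proj₂ cl≢) ∘ sym)

            Sc : Seg (VS.nk ++ 1 ∷ a ∷ ks) ((c ∷ VS.new) ++ c₁ ∷ cs) (2 + ℓ) c x
            Sc = seg-cons VS.nk (c ∷ VS.new)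
                   (cong suc (sym d₀≡0) , rotate VS.ed)
                   (Unique-∷ (λ { (here e) → c≢v e }) ([] ∷ []))
                   (λ { (here e) → inj₂ (here e) ; (there (here refl)) → [ inj₁ , (λ z → inj₂ (there z)) ]′ VS.v-from })
                   (λ k∈ → ≤-trans (≤-trans (s≤s (≤-reflexive (VS.nk-o k∈))) o<4) 4≤M)
                   nkV-dis
                   (λ { (here refl) → L-NotB vτ₀ c∈ ; (there u∈) → proj₂ (proj₂ (proj₂ (VS.hard u∈))) })
                   newV-far Sy

            nkW-dis : Disjoint (0 ∷ WS.nk) (VS.nk ++ 1 ∷ a ∷ ks)
            nkW-dis k∈ q∈ with ∈-++⁻ VS.nk q∈
            nkW-dis (here refl) q∈ | inj₁ l = <⇒≢ (≤-trans (s≤s z≤n) o≥2) (VS.nk-o l)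
            nkW-dis (here refl) q∈ | inj₂ (here ())
            nkW-dis (here refl) q∈ | inj₂ (there (here e)) = <⇒≢ (≤-trans (s≤s z≤n) a≥2) e
            nkW-dis (here refl) q∈ | inj₂ (there (there l)) = <⇒≱ (s≤s z≤n) (proj₁ (ks-ok l))
            nkW-dis (there k∈) q∈ | inj₁ l = <⇒≢ (<-≤-trans o<4 p≥4) (trans (sym (VS.nk-o l)) (WS.nk-o k∈))
            nkW-dis (there k∈) q∈ | inj₂ (here e) = <⇒≢ (≤-trans 2≤4 p≥4) (trans (sym e) (WS.nk-o k∈))
            nkW-dis (there k∈) q∈ | inj₂ (there (here e)) = <⇒≢ (<-≤-trans a<4 p≥4) (trans (sym e) (WS.nk-o k∈))
            nkW-dis (there k∈) q∈ | inj₂ (there (there l)) = proj₂ (ks-ok l) (WS.nk-o k∈)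

            newW-far : Disjoint WS.new ((c ∷ VS.new) ++ c₁ ∷ cs)
            newW-far u∈ (here e) = w≢c (trans (sym (proj₁ (WS.hard u∈))) e)
            newW-far u∈ (there q∈) with WS.hard u∈ | ∈-++⁻ VS.new q∈
            ... | refl , _ , u∉ , _ | inj₁ l = u∉ (there (here (proj₁ (VS.hard l))))
            ... | refl , uR , _ | inj₂ l = far uR (proj₂ (proj₂ c₁≢) ∘ sym) (proj₂ (proj₂ cl≢) ∘ sym) l

            Sx : Seg ((0 ∷ WS.nk) ++ VS.nk ++ 1 ∷ a ∷ ks) (WS.new ++ (c ∷ VS.new) ++ c₁ ∷ cs) (3 + ℓ) x x
            Sx = seg-cons (0 ∷ WS.nk) WS.new
                   (cong suc (sym d₀≡0) , swap₃ WS.ed)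
                   (Unique-∷ (λ { (here e) → Unique-head (three WS.ed) (there (here (sym e))) }) ([] ∷ []))
                   (λ { (here e) → inj₁ (κ₀ , 0 , here refl , e)
                      ; (there (here refl)) → [ (λ { (j , k , k∈ , e) → inj₁ (j , k , there k∈ , e) }) , inj₂ ]′ WS.v-from })
                   (λ { (here refl) → 0<M ; (there k∈) → ≤-trans (≤-trans (s≤s (≤-reflexive (WS.nk-o k∈))) p<6) 6≤M })
                   nkW-dis (λ u∈ → proj₂ (proj₂ (proj₂ (WS.hard u∈)))) newW-far Sc

            ext : ∀ {u} → u ∈ VS.new ++ WS.new → Extra u × u ∉ W
            ext u∈ with ∈-++⁻ VS.new u∈
            ... | inj₁ l = let _ , uR , u∉ , _ = VS.hard l in inj₂ (τ₀ , vτ₀ , uR) , λ z → u∉ (there z)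
            ... | inj₂ l = let _ , uR , u∉ , _ = WS.hard l in inj₂ (τ₀ , vτ₀ , uR) , λ z → u∉ (there (there z))

            col : Coloured (WS.new ++ (c ∷ VS.new) ++ c₁ ∷ cs) (VS.new ++ WS.new)
            col q∈ with ∈-++⁻ WS.new q∈
            ... | inj₁ l = inj₂ (∈-++⁺ʳ VS.new l)
            ... | inj₂ (here refl) = inj₁ (τ₀ , vτ₀ , c∈)
            ... | inj₂ (there l) with ∈-++⁻ VS.new l
            ...   | inj₁ l' = inj₂ (∈-++⁺ˡ l')
            ...   | inj₂ (here refl) = inj₁ (_ , v₁ , c₁∈)
            ...   | inj₂ (there l') with cs-ok l'
            ...     | inj₁ refl = inj₁ (_ , vl , cl∈)
            ...     | inj₂ (_ , τ , vτ , u∈ , _) = inj₁ (τ , vτ , u∈)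

            closed : ∃ λ xs → length xs ≤ 2 × (∀ {u} → u ∈ xs → Extra u × u ∉ W) × ColouredCycle (3 + ℓ) xs
            closed = VS.new ++ WS.new ,
              ≤-trans (≤-reflexive (length-++ VS.new)) (+-mono-≤ VS.few WS.few) , ext , _ , _ , Sx , col

          -- The growing walk must leave `a` for its last step and `WS.o` for `w`, in case `w` is a
          -- box vertex.
          Sp : List ℕ
          Sp = a ∷ WS.o ∷ []

          S₀ : State [ cl ] [ c₁ ] Sp 4 6 κ₁ m 1 x
          S₀ = start {κ₁} {m} [ c₁ ] Sp 4 6 κ₁≢κ₀ (<-≤-trans m<6 6≤M) m<6
                 (λ { (here e) → <⇒≢ (<-≤-trans a<4 m≥4) (sym e) ; (there (here e)) → proj₂ (proj₂ WS.ranges) e })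
                 m≥4 cl∈
                 (inj₂ λ { (here e) → <⇒≢ (≤-trans (s≤s z≤n) a≥2) e ; (there (here e)) → <⇒≢ (≤-trans (s≤s z≤n) p≥4) e })

          finale : ∀ {g k ℓ} → State [ cl ] [ c₁ ] Sp 4 g κ₁ k ℓ x →
            ∃ λ xs → length xs ≤ 2 × (∀ {u} → u ∈ xs → Extra u × u ∉ W) × ColouredCycle (4 + ℓ) xs
          finale {g} {k} {ℓ} S =
            let cₐ , cₐ∈ , cₐ∉ , Sₐ = finish 3≤q κ₀≢κ₁ a<M (here refl) S
            in Closing.closed (State.ks S) (cₐ ∷ State.c₁ S ∷ State.cs S) (suc ℓ) Sₐ ks-ok (cs-ok cₐ∈ cₐ∉)
            where
            k-ok = State.k-ok S
            ks-ok : ∀ {j} → j ∈ State.ks S → 4 ≤ j × j ≢ WS.o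
            ks-ok m = let _ , j∉ , j≥ = State.ks-ok S m in j≥ , λ e → j∉ (there (here e))
            cs-ok : ∀ {cₐ} → cₐ ∈ L (tup (mix a κ₁ k)) → cₐ ∉ [ c₁ ] → ∀ {u} → u ∈ cₐ ∷ State.c₁ S ∷ State.cs S →
              u ≡ cl ⊎ (u ≢ c₁ × ∃ λ τ → Valid τ × u ∈ L (tup τ) × (∀ j → 2 ≤ τ j))
            cs-ok cₐ∈ cₐ∉ (here refl) = inj₂ ((λ e → cₐ∉ (here e)) , mix a κ₁ k ,
              mix-valid {a} {κ₁} {k} a<M (proj₂ (proj₂ (proj₂ k-ok))) , cₐ∈ ,
              mix-case {k = a} {κ₁} {k} (2 ≤_) a≥2 (≤-trans 2≤4 (proj₁ (proj₂ (proj₂ k-ok)))))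
            cs-ok _ _ (there m) with State.prov S m
            ... | inj₁ (here e) = inj₁ e
            ... | inj₂ (u∉ , τ , vτ , u∈ , h) =
                  inj₂ ((λ e → u∉ (here e)) , τ , vτ , u∈ , λ j → ≤-trans 2≤4 (h j))

          detour : ∀ i → 6 + (i + i) ≤ M →
            ∃ λ xs → length xs ≤ 2 × (∀ {u} → u ∈ xs → Extra u × u ∉ W) × ColouredCycle (4 + ((i + i) + 1)) xs
          detour i le =
            let _ , _ , S = grow₂ 3≤q i le
                  (λ { (here refl) → ≤-trans a<4 (s≤s (s≤s (s≤s (s≤s z≤n)))) ; (there (here refl)) → p<6 })
                  (s≤s (s≤s (s≤s (s≤s z≤n)))) S₀
            in finale S

        Detoured : List V → ℕ → Set
        Detoured W ℓ = ∃ λ xs → length xs ≤ 2 × (∀ {u} → u ∈ xs → Extra u × u ∉ W) × ColouredCycle ℓ xs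

        -- The side of y is settled before that of x, so `w` is the vertex with the most to avoid,
        -- namely y, `v` and all of `W`; the bound on `W` leaves a neighbour for it.
        parity-cycle : ∀ W → 3 + length W ≤ t₁ → ∀ i → 6 + (i + i) ≤ M → Detoured W (4 + ((i + i) + 1))
        parity-cycle W room i le = pick-c (some (≤-trans (s≤s z≤n) 3≤q) {0} {κ₁} {1} 0<M 1<M)
          where
          module _ (c : V) (c∈ : c ∈ L (tup τ₀)) where
            colours : ∀ {v a w m} (VSt : Status c c∈ κ₀ 1 2 (x ∷ W) y v a) (WSt : Status c c∈ κ₁ 0 4 (y ∷ v ∷ W) x w m) →
              (∃ λ c₁ → c₁ ∈ L (tup (mix 1 κ₀ a)) × c₁ ≢ c × c₁ ≢ v × c₁ ≢ w) →
              (∃ λ cl → cl ∈ L (tup (mix 0 κ₁ m)) × cl ≢ c × cl ≢ w × cl ≢ v) → Detoured W (4 + ((i + i) + 1))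
            colours {v} {a} {w} {m} VSt WSt (c₁ , c₁∈ , n₁ , n₂ , n₃) (cl , cl∈ , l₁ , l₂ , l₃) =
              Detour.detour W c c∈ v a VSt w m WSt c₁ cl c₁∈ (subst (λ ω → cl ∈ L ω) (sym mix-swap) cl∈)
                (n₁ , n₂ , n₃) (l₁ , l₃ , l₂) i le
            second : ∀ {v a} → Status c c∈ κ₀ 1 2 (x ∷ W) y v a →
              (∃ λ w → ∃ λ m → Side c c∈ κ₀ κ₁ 0 4 5 (y ∷ v ∷ W) w m) → Detoured W (4 + ((i + i) + 1))
            second {v} VSt (w , m , sw) =
              colours VSt WSt (Status.choose₃ VSt w) (Status.choose₃ WSt v)
              where WSt = status c c∈ κ₁≢κ₀ 6≤M 0<M x∈τ₀ (here refl) (there (here refl)) sw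
            first : (∃ λ v → ∃ λ a → Side c c∈ κ₁ κ₀ 1 2 3 (x ∷ W) v a) → Detoured W (4 + ((i + i) + 1))
            first (v , a , sv) =
              second (status c c∈ κ₀≢κ₁ 4≤M 1<M y∈τ₀ (there (here refl)) (here refl) sv)
                (side c c∈ κ₀ κ₁ 0 4 5 (y ∷ v ∷ W) y (xyc c c∈) room)
          pick-c : (∃ λ c → c ∈ L (tup τ₀)) → Detoured W (4 + ((i + i) + 1))
          pick-c (c , c∈) = first c c∈ (side c c∈ κ₁ κ₀ 1 2 3 (x ∷ W) x (yxc c c∈) (≤-trans (n≤1+n _) room))

      -- Paths and cycles with popular colours.

      hops : ∀ ps → Unique ps → ps ⊆ P → ∀ {g ks cs ℓ κ k w} → g + (length ps + length ps) ≤ M → k < M →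
        (∀ {j} → j ∈ ks → j < g) → Disjoint ps cs → Seg ks cs ℓ (B κ k) w →
        ∃ λ ks' → ∃ λ cs' → ∃ λ κ' → ∃ λ k' → Seg ks' cs' ((length ps + length ps) + ℓ) (B κ' k') w × k' < M ×
          (∀ {j} → j ∈ ks' → (j ∈ ks ⊎ g ≤ j) × j < g + (length ps + length ps)) × (∀ {c} → c ∈ cs' → c ∈ ps ⊎ c ∈ cs)
      hops [] u sub {g} le k< ks< dj S = _ , _ , _ , _ , S , k< , (λ m → inj₁ m , ≤-trans (ks< m) (m≤m+n g 0)) , inj₂
      hops (p ∷ ps) u sub {g} {ks} {cs} {ℓ} {κ} {k} {w} le k< ks< dj S =
        let ks' , cs' , κ' , k' , S' , k'< , ok , cok =
              hops ps (Unique-tail u) (sub ∘ there) {suc (suc g)} le' g<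
                (λ { (here refl) → n≤1+n _ ; (there (here refl)) → ≤-refl ; (there (there m)) → m≤n⇒m≤1+n (m≤n⇒m≤1+n (ks< m)) })
                (λ { m (here refl) → Unique-head u m ; m (there m') → dj (there m) m' }) S₁
        in ks' , cs' , κ' , k' , subst (λ x → Seg ks' cs' x (B κ' k') w) (lem' (length ps) ℓ) S' , k'< ,
           (λ {j} m → let a , b = ok m in idx a , ≤-trans b (≤-reflexive (lem g (length ps)))) ,
           (λ m → col (cok m))
        where
        lem : ∀ g i → suc (suc g) + (i + i) ≡ g + (suc i + suc i)
        lem = solve-∀
        lem' : ∀ i ℓ → (i + i) + suc (suc ℓ) ≡ (suc i + suc i) + ℓ
        lem' = solve-∀
        le' : suc (suc g) + (length ps + length ps) ≤ M
        le' = ≤-trans (≤-reflexive (lem g (length ps))) le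
        sg< : suc g < M
        sg< = ≤-trans (m≤m+n _ _) le'
        g< : g < M
        g< = <-trans (n<1+n g) sg<
        S₁ : Seg (g ∷ suc g ∷ ks) (p ∷ cs) (2 + ℓ) (B κ₀ g) w
        S₁ = seg-hop g< sg< k< (<⇒≢ (n<1+n g)) (λ m → <-irrefl refl (ks< m)) (λ m → <-asym (n<1+n g) (ks< m))
               (sub (here refl)) (λ m → dj (here refl) m) S
        idx : ∀ {j} → j ∈ g ∷ suc g ∷ ks ⊎ suc (suc g) ≤ j → j ∈ ks ⊎ g ≤ j
        idx (inj₁ (here refl)) = inj₂ ≤-refl
        idx (inj₁ (there (here refl))) = inj₂ (n≤1+n _)
        idx (inj₁ (there (there m))) = inj₁ m
        idx (inj₂ h) = inj₂ (≤-trans (m≤n+m g 2) h)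
        col : ∀ {c} → c ∈ ps ⊎ c ∈ p ∷ cs → c ∈ p ∷ ps ⊎ c ∈ cs
        col (inj₁ m) = inj₁ (there m)
        col (inj₂ (here e)) = inj₁ (here e)
        col (inj₂ (there m)) = inj₂ m

      -- The final stretch of a path or cycle, which avoids popular colours; the indices e and 1 stay
      -- free, since the walk starts at one of them (a cycle at e, a path at 1).
      record Plain (a : ℕ) (xs : List V) : Set where
        field
          κe κ   : Fin d
          e k    : ℕ
          ks     : List ℕ
          cs     : List V
          seg    : Seg ks cs a (B κ k) (B κe e)
          e-ok   : e < 6 × e ≢ 1
          ks-ok  : ∀ {j} → j ∈ ks → j < 6 × j ≢ e × j ≢ 1
          k<M    : k < M
          cols   : Coloured cs xs

      module _ {a : ℕ} {xs₀ : List V} (6<M : 6 < M) (Pl : Plain a xs₀) {W : List V} (p : V) (ps : List V)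
               (uq : Unique (xs₀ ++ p ∷ ps)) (sub : (xs₀ ++ p ∷ ps) ⊆ P) (W∌ : Disjoint (xs₀ ++ p ∷ ps) W)
               (room : 7 + (length ps + length ps) ≤ M) where

        private
          open Plain Pl
          6≤M = <⇒≤ 6<M
          parts = Unique-++⁻ xs₀ uq

          dj : Disjoint (p ∷ ps) cs
          dj m m' with cols m'
          ... | inj₁ (τ , v , c∈) = L-∉P v c∈ (sub (∈-++⁺ʳ xs₀ m))
          ... | inj₂ x = proj₂ (proj₂ parts) x m

          H = hops ps (Unique-tail (proj₁ (proj₂ parts))) (λ m → sub (∈-++⁺ʳ xs₀ (there m))) {6} {ks} {cs} {a} {κ} {k} {B κe e}
                (<⇒≤ room) k<M (proj₁ ∘ ks-ok) (dj ∘ there) seg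
          ks' = proj₁ H
          cs' = proj₁ (proj₂ H)
          S' = proj₁ (proj₂ (proj₂ (proj₂ (proj₂ H))))
          k'< = proj₁ (proj₂ (proj₂ (proj₂ (proj₂ (proj₂ H)))))
          kok = proj₁ (proj₂ (proj₂ (proj₂ (proj₂ (proj₂ (proj₂ H))))))
          cok = proj₂ (proj₂ (proj₂ (proj₂ (proj₂ (proj₂ (proj₂ H))))))
          -- The first index beyond those spent by `hops`; it serves the outgoing edge of the last
          -- hop.
          f = 6 + (length ps + length ps)
          xs = xs₀ ++ p ∷ ps

          p∉ : p ∉ cs'
          p∉ m with cok m
          ... | inj₁ x = Unique-head (proj₁ (proj₂ parts)) x
          ... | inj₂ x = dj (here refl) x

          col : Coloured (p ∷ cs') xs
          col (here refl) = inj₂ (∈-++⁺ʳ xs₀ (here refl))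
          col (there m) with cok m
          ... | inj₁ x = inj₂ (∈-++⁺ʳ xs₀ (there x))
          ... | inj₂ x with cols x
          ...   | inj₁ y = inj₁ y
          ...   | inj₂ y = inj₂ (∈-++⁺ˡ y)

          s∉ : ∀ {s} → s < 6 → (∀ {j} → j ∈ ks → j ≢ s) → s ∉ ks'
          s∉ s< h m with proj₁ (kok m)
          ... | inj₁ x = h x refl
          ... | inj₂ x = <⇒≱ s< x

          last : ∀ κ s → s < 6 → (∀ {j} → j ∈ ks → j ≢ s) →
                 Seg (s ∷ f ∷ ks') (p ∷ cs') (2 + ((length ps + length ps) + a)) (B κ s) (B κe e)
          last κ s s< h = seg-hop (<-≤-trans s< 6≤M) room k'< (<⇒≢ (<-≤-trans s< (m≤m+n 6 _)))
            (s∉ s< h) (λ m → <-irrefl refl (proj₂ (kok m))) (sub (∈-++⁺ʳ xs₀ (here refl))) p∉ S'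

          ext : ∀ {x} → x ∈ xs → Extra x × x ∉ W
          ext m = inj₁ (sub m) , W∌ m

        plain-comp : ∀ b → Comp (Qexp r b (2 + ((length ps + length ps) + a))) W (length xs)
        plain-comp false = cycle-comp xs ext ≤-refl (last κe e (proj₁ e-ok) (λ m → proj₁ (proj₂ (ks-ok m)))) col
        plain-comp true  = path-comp xs ext ≤-refl (last κ₀ 1 (s≤s (s≤s z≤n)) (λ m → proj₂ (proj₂ (ks-ok m))))
          (<-≤-trans (proj₁ e-ok) 6≤M)
          (λ { (here eq) → proj₂ e-ok eq ; (there (here eq)) → <⇒≢ (<-≤-trans (proj₁ e-ok) (m≤m+n 6 _)) eq
             ; (there (there m)) → s∉ (proj₁ e-ok) (λ m → proj₁ (proj₂ (ks-ok m))) m }) col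

      module _ (6<M : 6 < M) where

        private
          lt : ∀ {k} → k ≤ 6 → k < M
          lt h = ≤-<-trans h 6<M
          0<M = lt z≤n
          2<M = lt (s≤s (s≤s z≤n))
          3<M = lt (s≤s (s≤s (s≤s z≤n)))
          4<M = lt (s≤s (s≤s (s≤s (s≤s z≤n))))
          5<M = lt (s≤s (s≤s (s≤s (s≤s (s≤s z≤n)))))
          0<6 : 0 < 6
          0<6 = s≤s z≤n
          2<6 : 2 < 6
          2<6 = s≤s (s≤s (s≤s z≤n))
          3<6 : 3 < 6
          3<6 = s≤s (s≤s (s≤s (s≤s z≤n)))
          4<6 : 4 < 6
          4<6 = s≤s (s≤s (s≤s (s≤s (s≤s z≤n))))

        plain₀ : Plain 0 []
        plain₀ = record { κe = κ₀ ; κ = κ₀ ; e = 0 ; k = 0 ; ks = [] ; cs = [] ; seg = seg-stop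
          ; e-ok = 0<6 , (λ ()) ; ks-ok = λ () ; k<M = 0<M ; cols = λ () }

        plain₁ : ∀ {c xs} → NotB c → Edge (c ∷ toList (tup (mix 2 κ₀ 0))) → Coloured [ c ] xs → Plain 1 xs
        plain₁ cB ed col = record { κe = κ₀ ; κ = κ₁ ; e = 0 ; k = 2 ; ks = [ 2 ] ; cs = _
          ; seg = seg-plain κ₁≢κ₀ 2<M (λ ()) cB (λ ()) ed seg-stop
          ; e-ok = 0<6 , (λ ()) ; ks-ok = λ { (here refl) → 2<6 , (λ ()) , λ () } ; k<M = 2<M ; cols = col }

        -- For odd ℓ without rare colours one edge consumes a popular colour alone: this is the
        -- rounding in ⌊(ℓ+1)/2⌋.
        plain₁-popular : ∀ {c} → c ∈ P → Plain 1 [ c ]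
        plain₁-popular c∈ = plain₁ (P-NotB c∈) (P-edge (mix-valid {2} {κ₀} {0} 2<M 0<M) c∈) inj₂

        plain₁-rare : 0 < q → Plain 1 []
        plain₁-rare q>0 =
          let c , c∈ = some q>0 {2} {κ₀} {0} 2<M 0<M
              v = mix-valid {2} {κ₀} {0} 2<M 0<M
          in plain₁ (L-NotB v c∈) (L-edge v c∈) λ { (here refl) → inj₁ (_ , v , c∈) }

        -- Of three consecutive edges with one colour each, the first and the third colour differ,
        -- so two consecutive ones do.
        plain₂ : 0 < q → Plain 2 []
        plain₂ q>0 with some q>0 {2} {κ₀} {0} 2<M 0<M | some q>0 {3} {κ₁} {2} 3<M 2<M | some q>0 {4} {κ₀} {3} 4<M 3<M
        ... | c₁ , c₁∈ | c₂ , c₂∈ | c₃ , c₃∈ with c₁ Finₚ.≟ c₂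
        ...   | no ne = record { κe = κ₀ ; κ = κ₀ ; e = 0 ; k = 3 ; ks = 3 ∷ 2 ∷ [] ; cs = c₂ ∷ c₁ ∷ []
            ; seg = seg-plain κ₀≢κ₁ 3<M (λ { (here ()) ; (there ()) }) (L-NotB v₂ c₂∈) (λ { (here e) → ne (sym e) }) (L-edge v₂ c₂∈)
                      (seg-plain κ₁≢κ₀ 2<M (λ ()) (L-NotB v₁ c₁∈) (λ ()) (L-edge v₁ c₁∈) seg-stop)
            ; e-ok = 0<6 , (λ ()) ; ks-ok = λ { (here refl) → 3<6 , (λ ()) , (λ ()) ; (there (here refl)) → 2<6 , (λ ()) , λ () }
            ; k<M = 3<M ; cols = λ { (here refl) → inj₁ (_ , v₂ , c₂∈) ; (there (here refl)) → inj₁ (_ , v₁ , c₁∈) } }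
          where
          v₁ = mix-valid {2} {κ₀} {0} 2<M 0<M
          v₂ = mix-valid {3} {κ₁} {2} 3<M 2<M
        ...   | yes refl = record { κe = κ₁ ; κ = κ₁ ; e = 2 ; k = 4 ; ks = 4 ∷ 3 ∷ [] ; cs = c₃ ∷ c₁ ∷ []
            ; seg = seg-plain κ₁≢κ₀ 4<M (λ { (here ()) ; (there ()) }) (L-NotB v₃ c₃∈) (λ { (here e) → ne e }) (L-edge v₃ c₃∈)
                      (seg-plain κ₀≢κ₁ 3<M (λ ()) (L-NotB v₂ c₂∈) (λ ()) (L-edge v₂ c₂∈) seg-stop)
            ; e-ok = 2<6 , (λ ()) ; ks-ok = λ { (here refl) → 4<6 , (λ ()) , (λ ()) ; (there (here refl)) → 3<6 , (λ ()) , λ () }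
            ; k<M = 4<M ; cols = λ { (here refl) → inj₁ (_ , v₃ , c₃∈) ; (there (here refl)) → inj₁ (_ , v₂ , c₂∈) } }
          where
          v₁ = mix-valid {2} {κ₀} {0} 2<M 0<M
          v₂ = mix-valid {3} {κ₁} {2} 3<M 2<M
          v₃ = mix-valid {4} {κ₀} {3} 4<M 3<M
          dis : ∀ i → mix 2 κ₀ 0 i ≢ mix 4 κ₀ 3 i
          dis i with i Finₚ.≟ κ₀
          ... | yes _ = λ ()
          ... | no  _ = λ ()
          ne : c₃ ≢ c₁
          ne e = L-clean v₁ v₃ dis (L-Reach c₁∈) (subst (_∈ L (tup (mix 4 κ₀ 3))) e c₃∈)

        private
          state-plain : ∀ {c g κ k a} → g ≤ 6 → c ∈ L (tup (mix 2 κ₀ 0)) →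
            State [ c ] [] [] 2 g κ k a (B κ₀ 0) → Plain a []
          state-plain {c} {κ = κ} {k} g≤ c∈ S = record { κe = κ₀ ; κ = κ ; e = 0 ; k = k ; ks = State.ks S ; cs = _
            ; seg = State.seg S ; e-ok = 0<6 , (λ ())
            ; ks-ok = λ m → let a , _ , b = State.ks-ok S m in
                <-≤-trans a g≤ , (λ e → <⇒≢ (≤-trans (s≤s z≤n) b) (sym e)) , (λ e → <⇒≢ b (sym e))
            ; k<M = proj₂ (proj₂ (proj₂ (State.k-ok S))) ; cols = col }
            where
            col : Coloured (State.c₁ S ∷ State.cs S) []
            col m with State.prov S m
            ... | inj₁ (here refl) = inj₁ (_ , mix-valid {2} {κ₀} {0} 2<M 0<M , c∈)
            ... | inj₂ (_ , τ , v , c∈' , _) = inj₁ (τ , v , c∈')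

        -- An open stretch has no closing conflict, so `Z` is empty and two rare colours per point
        -- suffice.
        plain₃ : 1 < q → Plain 3 []
        plain₃ q>1 =
          let c , c∈ = some (<-trans (s≤s z≤n) q>1) {2} {κ₀} {0} 2<M 0<M
              S₁ = start {κ₁} {2} [] [] 2 3 κ₁≢κ₀ 2<M ≤-refl (λ ()) ≤-refl c∈ (inj₂ λ ())
              S₂ = grow q>1 κ₀≢κ₁ 3<M (λ ()) (s≤s (s≤s z≤n)) S₁
              S₃ = grow q>1 κ₁≢κ₀ 4<M (λ ()) (s≤s (s≤s z≤n)) S₂
          in state-plain (s≤s (s≤s (s≤s (s≤s (s≤s z≤n))))) c∈ S₃

        plain₄ : 1 < q → Plain 4 []
        plain₄ q>1 =
          let c , c∈ = some (<-trans (s≤s z≤n) q>1) {2} {κ₀} {0} 2<M 0<M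
              S₁ = start {κ₁} {2} [] [] 2 3 κ₁≢κ₀ 2<M ≤-refl (λ ()) ≤-refl c∈ (inj₂ λ ())
              S₂ = grow q>1 κ₀≢κ₁ 3<M (λ ()) (s≤s (s≤s z≤n)) S₁
              S₃ = grow q>1 κ₁≢κ₀ 4<M (λ ()) (s≤s (s≤s z≤n)) S₂
              S₄ = grow q>1 κ₀≢κ₁ 5<M (λ ()) (s≤s (s≤s z≤n)) S₃
          in state-plain ≤-refl c∈ S₄

        -- Rare colours save q' of the 3 + s crosscut vertices.
        popular-Q : ∀ b q' s {ℓ W} → q' ≤ 2 → q' ≤ q → ℓ ≡ 6 + (s + s) ⊎ ℓ ≡ 5 + (s + s) →
          (xs : List V) → Unique xs → xs ⊆ P → Disjoint xs W → length xs ≡ (3 + s) ∸ q' → 11 + (s + s) ≤ M →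
          Comp (Qexp r b ℓ) W ((3 + s) ∸ q')
        popular-Q b q' s {ℓ} {W} q'≤2 q'≤q ℓ≡ xs uq sub W∌ len room =
          go ℓ≡ xs q' refl uq sub W∌ len
          where
          resize : ∀ {m k k'} → k ≡ ℓ → m ≡ k' → Comp (Qexp r b k) W m → Comp (Qexp r b ℓ) W k'
          resize refl refl K = K
          bound : ∀ {ps : List V} j → j ≤ 2 → length ps ≡ j + s → 7 + (length ps + length ps) ≤ M
          bound {ps} j j≤ refl' = ≤-trans (+-monoʳ-≤ 7 (≤-trans (≤-reflexive (cong₂ _+_ refl' refl')) (≤-trans (+-mono-≤ (+-monoˡ-≤ s j≤) (+-monoˡ-≤ s j≤)) (≤-reflexive (lem s))))) room
            where
            lem : ∀ s → (2 + s) + (2 + s) ≡ 4 + (s + s)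
            lem = solve-∀
          use : ∀ {a xs₀} j → Plain a xs₀ → (p : V) (ps : List V) →
            j ≤ 2 → length ps ≡ j + s → 2 + (((j + s) + (j + s)) + a) ≡ ℓ →
            Unique (xs₀ ++ p ∷ ps) → (xs₀ ++ p ∷ ps) ⊆ P → Disjoint (xs₀ ++ p ∷ ps) W →
            length (xs₀ ++ p ∷ ps) ≡ (3 + s) ∸ q' → Comp (Qexp r b ℓ) W ((3 + s) ∸ q')
          use {a} {xs₀} j Pl p ps j≤ lps eℓ uq sub W∌ len =
            resize (trans (cong (λ x → 2 + ((x + x) + a)) lps) eℓ) len
              (plain-comp 6<M Pl p ps uq sub W∌ (bound {ps} j j≤ lps) b)
          e₀ : ∀ s → 2 + (((2 + s) + (2 + s)) + 0) ≡ 6 + (s + s)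
          e₀ = solve-∀
          e₁ : ∀ s → 2 + (((1 + s) + (1 + s)) + 2) ≡ 6 + (s + s)
          e₁ = solve-∀
          e₂ : ∀ s → 2 + ((s + s) + 4) ≡ 6 + (s + s)
          e₂ = solve-∀
          o₁ : ∀ s → 2 + (((1 + s) + (1 + s)) + 1) ≡ 5 + (s + s)
          o₁ = solve-∀
          o₂ : ∀ s → 2 + ((s + s) + 3) ≡ 5 + (s + s)
          o₂ = solve-∀
          go : ℓ ≡ 6 + (s + s) ⊎ ℓ ≡ 5 + (s + s) → (xs : List V) → ∀ q'' → q'' ≡ q' →
            Unique xs → xs ⊆ P → Disjoint xs W → length xs ≡ (3 + s) ∸ q' → Comp (Qexp r b ℓ) W ((3 + s) ∸ q')
          -- Saving `q'` popular colours takes a stretch of rare edges of length `2 * q'` for even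
          -- ℓ, and `2 * q' - 1` for odd ℓ when `q'` is positive. The other edges come in hops,
          -- except for the one edge of `plain₁-popular`.
          go (inj₁ e) (p ∷ ps) 0 refl uq sub W∌ len =
            use 2 plain₀ p ps ≤-refl (suc-injective len) (trans (e₀ s) (sym e)) uq sub W∌ len
          go (inj₁ e) (p ∷ ps) 1 refl uq sub W∌ len =
            use 1 (plain₂ q'≤q) p ps (s≤s z≤n) (suc-injective len) (trans (e₁ s) (sym e)) uq sub W∌ len
          go (inj₁ e) (p ∷ ps) 2 refl uq sub W∌ len =
            use 0 (plain₄ q'≤q) p ps z≤n (suc-injective len) (trans (e₂ s) (sym e)) uq sub W∌ len
          go (inj₂ e) (c ∷ p ∷ ps) 0 refl uq sub W∌ len =
            use 1 (plain₁-popular (sub (here refl))) p ps (s≤s z≤n) (suc-injective (suc-injective len)) (trans (o₁ s) (sym e)) uq sub W∌ len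
          go (inj₂ e) (p ∷ ps) 1 refl uq sub W∌ len =
            use 1 (plain₁-rare q'≤q) p ps (s≤s z≤n) (suc-injective len) (trans (o₁ s) (sym e)) uq sub W∌ len
          go (inj₂ e) (p ∷ ps) 2 refl uq sub W∌ len =
            use 0 (plain₃ q'≤q) p ps z≤n (suc-injective len) (trans (o₂ s) (sym e)) uq sub W∌ len
          go _ _ (suc (suc (suc _))) refl = λ _ _ _ _ → ⊥-elim (1+n≰n (≤-trans (s≤s (s≤s (s≤s z≤n))) q'≤2))

      -- Stars with a popular centre or with rare colours.

      record StarSeg (ks : List ℕ) (cs : List V) (z : V) (D : ℕ) : Set where
        field
          leaves : List V
          fins   : List (List V)
          num    : length leaves ≡ D
          rays   : Pointwise (Hyperedge z) leaves fins
          apart  : Unique (leaves ++ concat fins)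
          origin : ∀ {v} → v ∈ leaves ++ concat fins → OnB ks v ⊎ v ∈ cs
          ks-M   : ∀ {k} → k ∈ ks → k < M
          cs-B   : ∀ {c} → c ∈ cs → NotB c

      open StarSeg

      star-nil : ∀ {z} → StarSeg [] [] z 0
      star-nil = record { leaves = [] ; fins = [] ; num = refl ; rays = [] ; apart = []
        ; origin = λ () ; ks-M = λ () ; cs-B = λ () }

      star-cons : ∀ {z l ex ks cs D} (nk : List ℕ) (new : List V) → Hyperedge z l ex → Unique (l ∷ ex) →
        (∀ {x} → x ∈ l ∷ ex → OnB nk x ⊎ x ∈ new) → (∀ {k} → k ∈ nk → k < M) → Disjoint nk ks →
        (∀ {c} → c ∈ new → NotB c) → Disjoint new cs →
        StarSeg ks cs z D → StarSeg (nk ++ ks) (new ++ cs) z (suc D)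
      star-cons {z} {l} {ex} {ks} {cs} nk new he uq fr nk< djk newB djc S = record
        { leaves = l ∷ leaves S
        ; fins = ex ∷ fins S
        ; num = cong suc (num S)
        ; rays = he ∷ rays S
        ; apart = Unique-∷ (λ m → [ (λ a → Unique-head uq a) , (λ a → clash (here refl) a) ]′ (∈-insert⁻ (leaves S) ex m))
                   (Unique-insert (leaves S) (apart S) (Unique-tail uq) (λ a b → clash (there a) b))
        ; origin = λ { (here e) → old₁ (fr (here e)) ; (there m) → [ (λ a → old₁ (fr (there a))) , (λ a → old₂ (origin S a)) ]′ (∈-insert⁻ (leaves S) ex m) }
        ; ks-M = λ m → [ nk< , ks-M S ]′ (∈-++⁻ nk m)
        ; cs-B = λ m → [ newB , cs-B S ]′ (∈-++⁻ new m)
        }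
        where
        clash : ∀ {x} → x ∈ l ∷ ex → x ∈ leaves S ++ concat (fins S) → ⊥
        clash m m' with fr m | origin S m'
        ... | inj₁ (i , k , k∈ , refl) | inj₁ (j , l , l∈ , e) =
              djk k∈ (subst (_∈ ks) (sym (proj₂ (B-inj (nk< k∈) (ks-M S l∈) e))) l∈)
        ... | inj₁ (i , k , k∈ , refl) | inj₂ c = cs-B S c i k (nk< k∈) refl
        ... | inj₂ c | inj₁ (j , l , l∈ , e) = newB c j l (ks-M S l∈) e
        ... | inj₂ c | inj₂ c' = djc c c'
        old₁ : ∀ {x} → OnB nk x ⊎ x ∈ new → OnB (nk ++ ks) x ⊎ x ∈ new ++ cs
        old₁ (inj₁ (i , k , m , e)) = inj₁ (i , k , ∈-++⁺ˡ m , e)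
        old₁ (inj₂ m) = inj₂ (∈-++⁺ˡ m)
        old₂ : ∀ {x} → OnB ks x ⊎ x ∈ cs → OnB (nk ++ ks) x ⊎ x ∈ new ++ cs
        old₂ (inj₁ (i , k , m , e)) = inj₁ (i , k , ∈-++⁺ʳ nk m , e)
        old₂ (inj₂ m) = inj₂ (∈-++⁺ʳ new m)

      star-comp : ∀ {ks cs z D W b} xs → (∀ {x} → x ∈ xs → Extra x × x ∉ W) → length xs ≤ b →
        StarSeg ks cs z D → (∀ {k} → k ∈ ks → ∀ i → z ≢ B i k) → z ∉ cs → Coloured cs xs → Soft z ⊎ z ∈ xs →
        Comp (expansion r (starG D)) W b
      star-comp {ks} {cs} {z} {D} {W} {b} xs ext sz S z≢ z∉ col zok = record
        { vs = (z ∷ leaves S) ++ concat (fins S) ; xs = xs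
        ; real = subst (λ D → Realizes (expansion r (starG D)) _) (num S) (realizes-star r r∸2 (rays S) (apart S) out)
        ; parts = λ { (here refl) → zok ; (there m) → parts' m } ; extra = ext ; size = sz }
        where
        out : z ∉ leaves S ++ concat (fins S)
        out m with origin S m
        ... | inj₁ (i , k , k∈ , e) = z≢ k∈ i e
        ... | inj₂ c = z∉ c
        parts' : ∀ {v} → v ∈ leaves S ++ concat (fins S) → Soft v ⊎ v ∈ xs
        parts' m with origin S m
        ... | inj₁ (i , k , k∈ , e) = inj₁ (inj₁ (i , k , ks-M S k∈ , e))
        ... | inj₂ c with col c
        ...   | inj₁ s = inj₁ (inj₂ s)
        ...   | inj₂ x = inj₂ x

      swap-edge : ∀ {u v ex} → Hyperedge u v ex → Hyperedge v u ex
      swap-edge (l , ed) = l , E-resp swap swap ed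
        where
        swap : ∀ {u v : V} {ex} → (u ∷ v ∷ ex) ⊆ (v ∷ u ∷ ex)
        swap (here e)          = there (here e)
        swap (there (here e))  = here e
        swap (there (there m)) = there (there m)

      -- The popular colour is the centre, and each ray takes all box vertices of one index.
      popular-star : ∀ D {p W} → p ∈ P → p ∉ W → D ≤ M → Comp (expansion r (starG D)) W 1
      popular-star D {p} {W} p∈ p∉ D≤ =
        let S = build D D≤
        in star-comp [ p ] (λ { (here refl) → inj₁ p∈ , p∉ }) ≤-refl S
             (λ k∈ i e → P-NotB p∈ i _ (ks-M S k∈) e) (λ ()) (λ ()) (inj₂ (here refl))
        where
        build : ∀ D → D ≤ M → StarSeg (downFrom D) [] p D
        build zero    le = star-nil
        build (suc D) le = star-cons [ D ] [] (swap-edge (hop-in {κ₀} {D} {p} (P-edge (λ _ → le) p∈)))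
          (Unique-∷ (λ a → let i , i∉ , e = line-∈⁻ [ κ₀ ] D a in i∉ (here (sym (proj₁ (B-inj le le e))))) (line-Unique [ κ₀ ] le))
          (λ { (here e) → inj₁ (κ₀ , D , here refl , e)
             ; (there m) → let i , _ , e = line-∈⁻ [ κ₀ ] D m in inj₁ (i , D , here refl , e) })
          (λ { (here refl) → le }) (λ { (here refl) m → <-irrefl refl (∈-downFrom⁻ m) }) (λ ()) (λ ())
          (build D (<⇒≤ le))

      -- The two ends of a ray have indices `a` and `b`; the index `p` of the remaining classes is
      -- private to the pair, so that rays with a common end do not meet elsewhere in the box.
      cell : ℕ → ℕ → ℕ → Fin d → ℕ
      cell a b p i with i Finₚ.≟ κ₀
      ... | yes _ = a
      ... | no _ with i Finₚ.≟ κ₁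
      ...   | yes _ = b
      ...   | no _  = p

      cell-κ₀ : ∀ a b p → cell a b p κ₀ ≡ a
      cell-κ₀ a b p with κ₀ Finₚ.≟ κ₀
      ... | yes _ = refl
      ... | no ¬e = ⊥-elim (¬e refl)

      cell-κ₁ : ∀ a b p → cell a b p κ₁ ≡ b
      cell-κ₁ a b p with κ₁ Finₚ.≟ κ₀
      ... | yes e = ⊥-elim (κ₁≢κ₀ e)
      ... | no _ with κ₁ Finₚ.≟ κ₁
      ...   | yes _ = refl
      ...   | no ¬e = ⊥-elim (¬e refl)

      cell-rest : ∀ a b p {i} → i ≢ κ₀ → i ≢ κ₁ → cell a b p i ≡ p
      cell-rest a b p {i} n₀ n₁ with i Finₚ.≟ κ₀
      ... | yes e = ⊥-elim (n₀ e)
      ... | no _ with i Finₚ.≟ κ₁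
      ...   | yes e = ⊥-elim (n₁ e)
      ...   | no _  = refl

      cell-valid : ∀ {a b p} → a < M → b < M → p < M → Valid (cell a b p)
      cell-valid a< b< p< i with i Finₚ.≟ κ₀
      ... | yes _ = a<
      ... | no _ with i Finₚ.≟ κ₁
      ...   | yes _ = b<
      ...   | no _  = p<

      cell-disjoint : ∀ {a b p a' b' p'} → a ≢ a' → b ≢ b' → p ≢ p' → ∀ i → cell a b p i ≢ cell a' b' p' i
      cell-disjoint na nb np i with i Finₚ.≟ κ₀
      ... | yes _ = na
      ... | no _ with i Finₚ.≟ κ₁
      ...   | yes _ = nb
      ...   | no _  = np

      rest : ℕ → List V
      rest p = line (κ₀ ∷ κ₁ ∷ []) p

      cell-edge : ∀ {a b p c} → Edge (c ∷ toList (tup (cell a b p))) → Hyperedge (B κ₀ a) (B κ₁ b) (rest p ++ [ c ])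
      cell-edge {a} {b} {p} {c} ed =
        trans (length-++ (rest p)) (trans (cong (_+ 1) (line-length₂ p κ₀≢κ₁)) (+-comm d₀ 1)) , E-resp sub sup ed
        where
        τ = cell a b p
        l = B κ₀ a ∷ B κ₁ b ∷ (rest p ++ [ c ])
        sub : (c ∷ toList (tup τ)) ⊆ l
        sub (here refl) = there (there (∈-++⁺ʳ (rest p) (here refl)))
        sub (there m) with tup-∈⁻ τ m
        ... | i , refl = pt i
          where
          pt : ∀ i → B i (cell a b p i) ∈ l
          pt i with i Finₚ.≟ κ₀
          ... | yes refl = here refl
          ... | no n₀ with i Finₚ.≟ κ₁
          ...   | yes refl = there (here refl)
          ...   | no n₁ = there (there (∈-++⁺ˡ (line-∈⁺ λ { (here e) → n₀ e ; (there (here e)) → n₁ e })))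
        at : ∀ i {k} → τ i ≡ k → B i k ∈ c ∷ toList (tup τ)
        at i refl = there (∈-toList⁺ i)
        sup : l ⊆ (c ∷ toList (tup τ))
        sup (here refl) = at κ₀ (cell-κ₀ a b p)
        sup (there (here refl)) = at κ₁ (cell-κ₁ a b p)
        sup (there (there m)) with ∈-++⁻ (rest p) m
        ... | inj₂ (here refl) = here refl
        ... | inj₁ m' with line-∈⁻ (κ₀ ∷ κ₁ ∷ []) p m'
        ...   | i , i∉ , refl = at i (cell-rest a b p (λ e → i∉ (here e)) (λ e → i∉ (there (here e))))

      -- p t is the index of the private vertices of the edge at leaf t, c t its colour.
      rare-build : ∀ {z} κ (p : ℕ → ℕ) (c : ℕ → V) (ts : List ℕ) → Unique ts → Unique (map c ts) →
        (∀ {t} → t ∈ ts → t < M × p t < M × NotB (c t) × Hyperedge z (B κ t) (rest (p t) ++ [ c t ])) →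
        (∀ {t t'} → t ∈ ts → t' ∈ ts → p t ≡ p t' → t ≡ t') → (∀ {t t'} → t ∈ ts → t' ∈ ts → t ≢ p t') →
        StarSeg (concatMap (λ t → t ∷ p t ∷ []) ts) (map c ts) z (length ts)
      rare-build κ p c [] u uc ok pinj tp = star-nil
      rare-build κ p c (t ∷ ts) u uc ok pinj tp =
        star-cons (t ∷ p t ∷ []) [ c t ] (proj₂ (proj₂ (proj₂ okt))) uq fr
          (λ { (here refl) → t< ; (there (here refl)) → pt< }) dj
          (λ { (here refl) → cB }) (λ { (here refl) m → Unique-head uc m })
          (rare-build κ p c ts (Unique-tail u) (Unique-tail uc) (ok ∘ there)
            (λ a b → pinj (there a) (there b)) (λ a b → tp (there a) (there b)))
        where
        okt = ok (here refl)
        t< = proj₁ okt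
        pt< = proj₁ (proj₂ okt)
        cB = proj₁ (proj₂ (proj₂ okt))
        fr : ∀ {x} → x ∈ B κ t ∷ (rest (p t) ++ [ c t ]) → OnB (t ∷ p t ∷ []) x ⊎ x ∈ [ c t ]
        fr (here e) = inj₁ (κ , t , here refl , e)
        fr (there m) with ∈-++⁻ (rest (p t)) m
        ... | inj₁ a = let i , _ , e = line-∈⁻ (κ₀ ∷ κ₁ ∷ []) (p t) a in inj₁ (i , p t , there (here refl) , e)
        ... | inj₂ a = inj₂ a
        uq : Unique (B κ t ∷ (rest (p t) ++ [ c t ]))
        uq = Unique-∷ (λ m → [ (λ a → let i , _ , e = line-∈⁻ (κ₀ ∷ κ₁ ∷ []) (p t) a in tp (here refl) (here refl) (proj₂ (B-inj t< pt< e)))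
                             , (λ { (here e) → cB κ t t< (sym e) }) ]′ (∈-++⁻ (rest (p t)) m))
               (Unique-++ (line-Unique (κ₀ ∷ κ₁ ∷ []) pt<) ([] ∷ [])
                 λ { a (here refl) → let i , _ , e = line-∈⁻ (κ₀ ∷ κ₁ ∷ []) (p t) a in cB i (p t) pt< e })
        dj : Disjoint (t ∷ p t ∷ []) (concatMap (λ t → t ∷ p t ∷ []) ts)
        dj m m' with find (∈-concatMap⁻ (λ t → t ∷ p t ∷ []) {xs = ts} m')
        dj (here refl) m' | t' , t'∈ , here refl = Unique-head u t'∈
        dj (here refl) m' | t' , t'∈ , there (here e) = tp (here refl) (there t'∈) e
        dj (there (here refl)) m' | t' , t'∈ , here e = tp (there t'∈) (here refl) (sym e)
        dj (there (here refl)) m' | t' , t'∈ , there (here e) =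
          Unique-head u (subst (_∈ ts) (sym (pinj (here refl) (there t'∈) e)) t'∈)

      module _ (D : ℕ) {{_ : NonZero D}} (q>0 : 0 < q) (W : List V) where

        private
          K = need D D
          N = D + K

          -- Encodes the pair in base `D`, shifted beyond all row and column indices.
          pr : ℕ → ℕ → ℕ
          pr a b = N + (a + b * D)

          pr-inj : ∀ {a b a' b'} → a < D → a' < D → pr a b ≡ pr a' b' → a ≡ a' × b ≡ b'
          pr-inj {a} {b} {a'} {b'} a< a'< e = a≡ , *-cancelʳ-≡ b b' D (+-cancelˡ-≡ a _ _ (trans e' (cong (_+ b' * D) (sym a≡))))
            where
            e' : a + b * D ≡ a' + b' * D
            e' = +-cancelˡ-≡ N _ _ e
            a≡ : a ≡ a'
            a≡ = trans (sym (trans ([m+kn]%n≡m%n a b D) (m<n⇒m%n≡m a<)))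
                   (trans (cong (_% D) e') (trans ([m+kn]%n≡m%n a' b' D) (m<n⇒m%n≡m a'<)))

          ys = map (D +_) (upTo K)

          ys-∈ : ∀ {b} → b ∈ ys → D ≤ b × b < N
          ys-∈ m with ∈-map⁻ (D +_) m
          ... | x , x∈ , refl = m≤m+n D x , +-monoʳ-< D (∈-upTo⁻ x∈)

          head : List V → V
          -- This default is never taken, since a valid point has `q > 0` colours.
          head []      = v₀
          head (x ∷ _) = x

          χ : ℕ → ℕ → V
          χ a b = head (L (tup (cell a b (pr a b))))

        -- A rainbow row gives a star centred in class `κ₀`. Otherwise there are columns `b` and
        -- `b'` on which all rows are constant: the colour of (a', b) is that of (a', b'), a cell
        -- disjoint from (a, b), so the colours of column `b` are distinct and the centre lies in
        -- class `κ₁`.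
        rare-star : star-room D ≤ M → Comp (expansion r (starG D)) W 0
        rare-star room = [ row , column ]′
            (rainbow-row-or-constant Finₚ._≟_ χ D (>-nonZero⁻¹ D) (upTo D) ys (Uniq.map⁺ (+-cancelˡ-≡ D _ _) (Uniq.upTo⁺ K))
              (≤-reflexive (trans (cong (need D) (length-upTo D)) (sym (trans (length-map (D +_) (upTo K)) (length-upTo K))))))
          where
          N≤M : N ≤ M
          N≤M = ≤-trans (m≤m+n N _) room
          D≤M : D ≤ M
          D≤M = ≤-trans (m≤m+n D K) N≤M
          module _ {a b : ℕ} (a< : a < D) (b∈ : b ∈ ys) where
            a<M : a < M
            a<M = <-≤-trans a< D≤M
            b<M : b < M
            b<M = <-≤-trans (proj₂ (ys-∈ b∈)) N≤M
            p<M : pr a b < M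
            p<M = <-≤-trans (+-monoʳ-< N (+-mono-<-≤ a< (*-monoˡ-≤ D (<⇒≤ (proj₂ (ys-∈ b∈)))))) room
            valid : Valid (cell a b (pr a b))
            valid = cell-valid a<M b<M p<M
            χ∈ : χ a b ∈ L (tup (cell a b (pr a b)))
            χ∈ with L (tup (cell a b (pr a b))) | L-size valid
            ... | []    | e = ⊥-elim (<-irrefl e q>0)
            ... | _ ∷ _ | _ = here refl
          above : ∀ {k} a b → k < N → k ≢ pr a b
          above a b k< = <⇒≢ (<-≤-trans k< (m≤m+n N _))
          row : _ → Comp (expansion r (starG D)) W 0
          row (a , a∈ , ts , lts , u , uχ , sub) =
            subst (λ D → Comp (expansion r (starG D)) W 0) lts (star-comp [] (λ ()) z≤n
              (rare-build κ₁ (pr a) (χ a) ts u uχ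
                (λ m → b<M a< (sub m) , p<M a< (sub m) , L-NotB (valid a< (sub m)) (χ∈ a< (sub m)) ,
                       cell-edge (L-edge (valid a< (sub m)) (χ∈ a< (sub m))))
                (λ _ _ e → proj₂ (pr-inj a< a< e)) (λ {_} {t'} m _ → above a t' (proj₂ (ys-∈ (sub m)))))
              z≢ z∉ col (inj₁ (inj₁ (κ₀ , a , aM , refl))))
            where
            a< : a < D
            a< = ∈-upTo⁻ a∈
            aM = <-≤-trans a< D≤M
            z≢ : ∀ {k} → k ∈ concatMap (λ t → t ∷ pr a t ∷ []) ts → ∀ i → B κ₀ a ≢ B i k
            z≢ m i e with find (∈-concatMap⁻ (λ t → t ∷ pr a t ∷ []) {xs = ts} m)
            ... | t , t∈ , here refl = <⇒≢ (<-≤-trans a< (proj₁ (ys-∈ (sub t∈)))) (proj₂ (B-inj aM (b<M a< (sub t∈)) e))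
            ... | t , t∈ , there (here refl) = above a t (<-≤-trans a< (m≤m+n D K)) (proj₂ (B-inj aM (p<M a< (sub t∈)) e))
            z∉ : B κ₀ a ∉ map (χ a) ts
            z∉ m with ∈-map⁻ (χ a) m
            ... | t , t∈ , e = L-NotB (valid a< (sub t∈)) (χ∈ a< (sub t∈)) κ₀ a aM (sym e)
            col : Coloured (map (χ a) ts) []
            col m with ∈-map⁻ (χ a) m
            ... | t , t∈ , refl = inj₁ (_ , valid a< (sub t∈) , χ∈ a< (sub t∈))
          column : _ → Comp (expansion r (starG D)) W 0
          column ([] , () , _)
          column (_ ∷ [] , s≤s () , _)
          column (b ∷ b' ∷ _ , _ , u , sub , consts) =
            subst (λ D → Comp (expansion r (starG D)) W 0) (length-upTo D) (star-comp [] (λ ()) z≤n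
              (rare-build κ₀ (λ a → pr a b) (λ a → χ a b) (upTo D) (Uniq.upTo⁺ D)
                (Unique-map-∈ (λ a → χ a b) (Uniq.upTo⁺ D) inj)
                (λ m → <-≤-trans (∈-upTo⁻ m) D≤M , p<M (∈-upTo⁻ m) b∈ , L-NotB (valid (∈-upTo⁻ m) b∈) (χ∈ (∈-upTo⁻ m) b∈) ,
                       swap-edge (cell-edge (L-edge (valid (∈-upTo⁻ m) b∈) (χ∈ (∈-upTo⁻ m) b∈))))
                (λ m m' e → proj₁ (pr-inj {b = b} {b' = b} (∈-upTo⁻ m) (∈-upTo⁻ m') e)) (λ {_} {t'} m _ → above t' b (<-≤-trans (∈-upTo⁻ m) (m≤m+n D K))))
              z≢ z∉ col (inj₁ (inj₁ (κ₁ , b , bM , refl))))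
            where
            b∈ = sub (here refl)
            b'∈ = sub (there (here refl))
            bM = <-≤-trans (proj₂ (ys-∈ b∈)) N≤M
            b≢b' : b ≢ b'
            b≢b' e = Unique-head u (here e)
            inj : ∀ {a a'} → a ∈ upTo D → a' ∈ upTo D → χ a b ≡ χ a' b → a ≡ a'
            inj {a} {a'} m m' e with a ≟ a'
            ... | yes p = p
            ... | no ne = ⊥-elim (L-clean (valid (∈-upTo⁻ m) b∈) (valid (∈-upTo⁻ m') b'∈)
                    (cell-disjoint ne b≢b' (λ h → ne (proj₁ (pr-inj {b = b} {b' = b'} (∈-upTo⁻ m) (∈-upTo⁻ m') h))))
                    (L-Reach (χ∈ (∈-upTo⁻ m) b∈))
                    (subst (_∈ L (tup (cell a' b' (pr a' b')))) (trans (same m') (sym e)) (χ∈ (∈-upTo⁻ m') b'∈)))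
              where
              same : ∀ {a'} → a' ∈ upTo D → χ a' b' ≡ χ a' b
              same m' = let c , h = consts m' in trans (h (there (here refl))) (sym (h (here refl)))
            z≢ : ∀ {k} → k ∈ concatMap (λ t → t ∷ pr t b ∷ []) (upTo D) → ∀ i → B κ₁ b ≢ B i k
            z≢ m i e with find (∈-concatMap⁻ (λ t → t ∷ pr t b ∷ []) {xs = upTo D} m)
            ... | t , t∈ , here refl = <⇒≢ (<-≤-trans (∈-upTo⁻ t∈) (proj₁ (ys-∈ b∈))) (sym (proj₂ (B-inj bM (<-≤-trans (∈-upTo⁻ t∈) D≤M) e)))
            ... | t , t∈ , there (here refl) = above t b (proj₂ (ys-∈ b∈)) (proj₂ (B-inj bM (p<M (∈-upTo⁻ t∈) b∈) e))
            z∉ : B κ₁ b ∉ map (λ a → χ a b) (upTo D)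
            z∉ m with ∈-map⁻ (λ a → χ a b) m
            ... | t , t∈ , e = L-NotB (valid (∈-upTo⁻ t∈) b∈) (χ∈ (∈-upTo⁻ t∈) b∈) κ₁ b bM (sym e)
            col : Coloured (map (λ a → χ a b) (upTo D)) []
            col m with ∈-map⁻ (λ a → χ a b) m
            ... | t , t∈ , refl = inj₁ (_ , valid (∈-upTo⁻ t∈) b∈ , χ∈ (∈-upTo⁻ t∈) b∈)

      rare-cycle : ∀ ℓ W → 5 ≤ ℓ → 3 ≤ q → 3 + length W ≤ t₁ → ℓ + 7 ≤ M →
        ∃ λ xs → length xs ≤ 2 × (∀ {u} → u ∈ xs → Extra u × u ∉ W) × ColouredCycle ℓ xs
      rare-cycle (suc (suc (suc (suc (suc ℓ))))) W (s≤s (s≤s (s≤s (s≤s (s≤s z≤n))))) 3≤q rm le with even-or-odd ℓ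
      ... | i , inj₂ refl = [] , z≤n , (λ ()) , subst (λ x → ColouredCycle x []) (lem i)
              (rare-even 3≤q (2 + i) (≤-trans (≤-reflexive (lem₂ i)) (≤-trans (m≤m+n (7 + (i + i)) 6) (≤-trans (≤-reflexive (lem₃ i)) le))))
        where
        lem : ∀ i → 2 + ((2 + i) + (2 + i)) ≡ 6 + (i + i)
        lem = solve-∀
        lem₂ : ∀ i → 3 + ((2 + i) + (2 + i)) ≡ 7 + (i + i)
        lem₂ = solve-∀
        lem₃ : ∀ i → 7 + (i + i) + 6 ≡ 6 + (i + i) + 7
        lem₃ = solve-∀
      ... | i , inj₁ refl = odd d₀ refl
        where
        lem₄ : ∀ i → 4 + ((i + i) + 1) ≡ 5 + (i + i)
        lem₄ = solve-∀
        lem₅ : ∀ i → 3 + ((1 + i) + (1 + i)) ≡ 5 + (i + i)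
        lem₅ = solve-∀
        lem₆ : ∀ i → 4 + ((1 + i) + (1 + i)) ≡ 6 + (i + i)
        lem₆ = solve-∀
        lem₇ : ∀ i → 6 + (i + i) + 6 ≡ 5 + (i + i) + 7
        lem₇ = solve-∀
        le' : 6 + (i + i) ≤ M
        le' = ≤-trans (m≤m+n (6 + (i + i)) 6) (≤-trans (≤-reflexive (lem₇ i)) le)
        odd : ∀ x → x ≡ d₀ → ∃ λ xs → length xs ≤ 2 × (∀ {u} → u ∈ xs → Extra u × u ∉ W) × ColouredCycle (5 + (i + i)) xs
        odd zero e =
          let xs , l , ext , cyc = Parity.parity-cycle (sym e) 3≤q (≤-trans (m≤m+n 6 (i + i)) le') W rm i le'
          in xs , l , ext , subst (λ x → ColouredCycle x xs) (lem₄ i) cyc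
        odd (suc x) e = [] , z≤n , (λ ()) , subst (λ x → ColouredCycle x []) (lem₅ i)
          (rare-odd 3≤q κ₂ (ne₀ e d≡) (ne₁ e d≡) (1 + i) (≤-trans (≤-reflexive (lem₆ i)) le'))
          where
          third : ∀ {x d₀ d} → suc x ≡ d₀ → 2 + d₀ ≡ d → Fin d
          third refl refl = suc (suc zero)
          κ₂ = third e d≡
          ne₀ : ∀ {x d₀ d} (e : suc x ≡ d₀) (d≡ : 2 + d₀ ≡ d) → third e d≡ ≢ subst Fin d≡ zero
          ne₀ refl refl ()
          ne₁ : ∀ {x d₀ d} (e : suc x ≡ d₀) (d≡ : 2 + d₀ ≡ d) → third e d≡ ≢ subst Fin d≡ (suc zero)
          ne₁ refl refl ()

      -- A path is obtained from a cycle one edge longer, which is why `room` has `ℓ + 8`. The two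
      -- unprotected vertices can only come from the parity detour.
      rare-Q : ∀ b ℓ W → 5 ≤ ℓ → 3 ≤ q → 3 + length W ≤ t₁ → ℓ + 8 ≤ M → Comp (Qexp r b ℓ) W 2
      rare-Q false (suc ℓ) W 5≤ 3≤q rm le =
        from-cycle (rare-cycle (suc ℓ) W 5≤ 3≤q rm (≤-trans (+-monoʳ-≤ (suc ℓ) (n≤1+n 7)) le))
        where
        from-cycle : (∃ λ xs → length xs ≤ 2 × (∀ {u} → u ∈ xs → Extra u × u ∉ W) × ColouredCycle (suc ℓ) xs) → _
        from-cycle (xs , l , ext , _ , _ , S , col) = cycle-comp xs ext l S col
      rare-Q true ℓ W 5≤ 3≤q rm le =
        from-cycle (rare-cycle (suc ℓ) W (m≤n⇒m≤1+n 5≤) 3≤q rm (≤-trans (≤-reflexive (sym (+-suc ℓ 7))) le))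
        where
        from-cycle : (∃ λ xs → length xs ≤ 2 × (∀ {u} → u ∈ xs → Extra u × u ∉ W) × ColouredCycle (suc ℓ) xs) → _
        from-cycle (xs , l , ext , _ , _ , S , col) = cycle-path-comp xs ext l S col

      Comp-≤ : ∀ {H W b b'} → b ≤ b' → Comp H W b → Comp H W b'
      Comp-≤ le K = record { vs = Comp.vs K ; xs = Comp.xs K ; real = Comp.real K ; parts = Comp.parts K
        ; extra = Comp.extra K ; size = ≤-trans (Comp.size K) le }

      -- A path or cycle adds at most two vertices to `W` and has crosscut number at least 3; a star
      -- adds none. So the budget that governs popular colours also keeps `W` short enough for the
      -- detours.
      rare-piece : ∀ p W → Large p → 3 ≤ q → length W + crosscut p ≤ t₁ → room p ≤ M →
        Comp (pattern-of r p) W (crosscut p)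
      rare-piece (pathOrCycle b ℓ) W lg 3≤q cap rm =
        let s , _ , e = large-form lg
            3≤σ : 3 ≤ suc ℓ / 2
            3≤σ = ≤-trans (m≤m+n 3 s) (≤-reflexive (sym e))
        in Comp-≤ (≤-trans (n≤1+n 2) 3≤σ)
             (rare-Q b ℓ W lg 3≤q (≤-trans (≤-reflexive (+-comm 3 (length W))) (≤-trans (+-monoʳ-≤ (length W) 3≤σ) cap)) rm)
      rare-piece (star (suc D)) W lg 3≤q cap rm =
        Comp-≤ z≤n (rare-star (suc D) (≤-trans (s≤s z≤n) 3≤q) W (≤-trans (m≤m+n _ _) rm))

      unused : ∀ W k → k + length W ≤ length P →
        ∃ λ xs → Unique xs × xs ⊆ P × Disjoint xs W × length xs ≡ k
      unused W k le = take k (P ∖ W) , Uniq.take⁺ k (∖-Unique W P-uniq) ,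
        (λ m → proj₁ (∖-∈⁻ P W (take-∈ k m))) , (λ m → proj₂ (∖-∈⁻ P W (take-∈ k m))) ,
        length-take-≤ k (P ∖ W) (+-cancelʳ-≤ (length W) k _
          (≤-trans le (≤-trans (length-∖ W P-uniq) (≤-reflexive (+-comm (length W) _)))))

      popular-piece-Q : ∀ b ℓ W q' → q' ≤ 2 → q' ≤ q → 5 ≤ ℓ → length W + (suc ℓ / 2 ∸ q') ≤ length P → ℓ + 8 ≤ M →
        Comp (Qexp r b ℓ) W (suc ℓ / 2 ∸ q')
      popular-piece-Q b ℓ W q' q'≤2 q'≤q lg cap rm =
        let s , ℓ≡ , e = large-form lg
            xs , u , sub , dj , len = unused W (suc ℓ / 2 ∸ q') (≤-trans (≤-reflexive (+-comm _ (length W))) cap)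
        in subst (λ x → Comp (Qexp r b ℓ) W (x ∸ q')) (sym e)
             (popular-Q (≤-trans (≤-trans (n≤1+n 7) (m≤n+m 8 ℓ)) rm) b q' s q'≤2 q'≤q ℓ≡ xs u sub dj
               (trans len (cong (_∸ q') e)) (≤-trans (bound {s} ℓ≡) rm))
        where
        lem : ∀ s → 11 + (s + s) + 2 ≡ 5 + (s + s) + 8
        lem = solve-∀
        lem' : ∀ s → 11 + (s + s) + 3 ≡ 6 + (s + s) + 8
        lem' = solve-∀
        bound : ∀ {s} → ℓ ≡ 6 + (s + s) ⊎ ℓ ≡ 5 + (s + s) → 11 + (s + s) ≤ ℓ + 8
        bound {s} (inj₁ refl) = ≤-trans (m≤m+n _ 3) (≤-reflexive (lem' s))
        bound {s} (inj₂ refl) = ≤-trans (m≤m+n _ 2) (≤-reflexive (lem s))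

      popular-piece : ∀ p W → Large p → length W + crosscut p ≤ length P → room p ≤ M →
        Comp (pattern-of r p) W (crosscut p)
      popular-piece (pathOrCycle b ℓ) W lg cap rm = popular-piece-Q b ℓ W 0 z≤n z≤n lg cap rm
      popular-piece (star D) W lg cap rm with unused W 1 (≤-trans (≤-reflexive (+-comm 1 (length W))) cap)
      ... | p ∷ _ , u , sub , dj , _ = popular-star D (sub (here refl)) (dj (here refl))
              (≤-trans (m≤m+n D 2) (≤-trans (m≤n+m (D + 2) (star-room D)) rm))

    -- Placing all pieces in consecutive ranges of indices.

    module _ {P q L M B} (C : CleanBox P q L M B) where

      open CleanBox C

      -- The conditions of a clean box only compare indices for equality, so they survive an offset.
      slice : ∀ N h → N + h ≤ M → CleanBox P q L h (λ i a → B i (N + a))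
      slice N h le = record
        { P-uniq = P-uniq ; PL-size = PL-size
        ; P-edge = λ v → P-edge (up v) ; L-edge = λ v → L-edge (up v) ; L-∉P = λ v → L-∉P (up v)
        ; L-size = λ v → L-size (up v) ; L-uniq = λ v → L-uniq (up v)
        ; L-clean = λ v v' dj → L-clean (up v) (up v') (λ i e → dj i (+-cancelˡ-≡ N _ _ e))
        ; B-clean = λ {τ} {i} {a} v a< ne → B-clean (up v) (<-≤-trans (+-monoʳ-< N a<) le) (λ e → ne (+-cancelˡ-≡ N _ _ e)) }
        where
        up : ∀ {τ : Fin d → ℕ} → (∀ i → τ i < h) → ∀ i → N + τ i < M
        up v i = <-≤-trans (+-monoʳ-< N (v i)) le

      Below : ℕ → V → Set
      Below N v = (∃ λ i → ∃ λ a → a < N × v ≡ B i a) ⊎ (∃ λ τ → (∀ i → τ i < N) × v ∈ L (tup τ))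

      Outer : ℕ → V → Set
      Outer N v = v ∈ P ⊎ (∃ λ τ → (∀ i → τ i < N) × v ∈ Reach L (tup τ))

      record Progress (used : List V) (N : ℕ) (W : List V) : Set where
        field
          N≤M    : N ≤ M
          used-ok : ∀ {u} → u ∈ used → Below N u ⊎ u ∈ W
          W-ok   : ∀ {w} → w ∈ W → Outer N w

      2≤room : ∀ p → 2 ≤ room p
      2≤room (pathOrCycle _ ℓ) = ≤-trans (s≤s (s≤s z≤n)) (m≤n+m 8 ℓ)
      2≤room (star D) = ≤-trans (m≤n+m 2 D) (m≤n+m (D + 2) (star-room D))

      module _ (2≤M : 2 ≤ M) where

        -- New soft vertices have indices from `N` on, and the cleaning separates them from
        -- everything reached by lower ones. New unprotected vertices are either popular or reached
        -- from indices above `N`, so the same argument separates them from old soft ones; from `W`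
        -- they are separate by choice.
        advance : ∀ {H used N W h b} (le : N + h ≤ M) (2≤h : 2 ≤ h) → Progress used N W →
          (K : InBox.Comp 2≤h (slice N h le) H W b) →
          ∃ λ vs → ∃ λ W' → Realizes H vs × Disjoint vs used × Progress (vs ++ used) (N + h) W' × length W' ≤ b + length W
        advance {H} {used} {N} {W} {h} {b} le 2≤h Pr K = vs , xs ++ W , real , dj ,
            record { N≤M = le ; used-ok = used' ; W-ok = W' } ,
            ≤-trans (≤-reflexive (length-++ xs)) (+-monoˡ-≤ (length W) size)
          where
          open InBox.Comp K
          SliceSoft : V → Set
          SliceSoft = InBox.Soft 2≤h (slice N h le)
          open Progress Pr
          up : ∀ {τ : Fin d → ℕ} → (∀ i → τ i < N) → ∀ i → τ i < M
          up f i = <-≤-trans (f i) N≤M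
          shift : ∀ {a} → a < h → N + a < M
          shift a< = <-≤-trans (+-monoʳ-< N a<) le
          soft-B : ∀ {v} → SliceSoft v → ∀ i a → a < N → v ≢ B i a
          soft-B (inj₁ (j , b , b< , refl)) i a a< e =
            <⇒≢ (<-≤-trans a< (m≤m+n N b)) (sym (proj₂ (InBox.B-inj 2≤M C (shift b<) (<-≤-trans a< N≤M) e)))
          soft-B (inj₂ (τ , vτ , v∈)) i a a< e = InBox.L-NotB 2≤M C (λ j → shift (vτ j)) v∈ i a (<-≤-trans a< N≤M) e
          soft-Reach : ∀ {v} → SliceSoft v → ∀ τ → (∀ i → τ i < N) → v ∉ Reach L (tup τ)
          soft-Reach (inj₁ (j , b , b< , refl)) τ f m =
            B-clean (up f) (shift b<) (<⇒≢ (<-≤-trans (f j) (m≤m+n N b))) m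
          soft-Reach (inj₂ (τ' , vτ' , v∈)) τ f m =
            L-clean (up f) (λ j → shift (vτ' j)) (λ i → <⇒≢ (<-≤-trans (f i) (m≤m+n N (τ' i)))) m v∈
          soft-P : ∀ {v} → SliceSoft v → v ∉ P
          soft-P (inj₁ (j , b , b< , refl)) m = InBox.P-NotB 2≤M C m j (N + b) (shift b<) refl
          soft-P (inj₂ (τ , vτ , v∈)) m = L-∉P (λ j → shift (vτ j)) v∈ m
          dj : Disjoint vs used
          dj m m' with parts m | used-ok m'
          ... | inj₁ s | inj₁ (inj₁ (i , a , a< , e)) = soft-B s i a a< e
          ... | inj₁ s | inj₁ (inj₂ (τ , f , v∈)) = soft-Reach s τ f (InBox.L-Reach 2≤M C v∈)
          ... | inj₁ s | inj₂ w with W-ok w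
          ...   | inj₁ p = soft-P s p
          ...   | inj₂ (τ , f , v∈) = soft-Reach s τ f v∈
          dj m m' | inj₂ x | inj₂ w = proj₂ (extra x) w
          dj m m' | inj₂ x | inj₁ b with extra x | b
          ... | inj₁ p , _ | inj₁ (i , a , a< , e) = InBox.P-NotB 2≤M C p i a (<-≤-trans a< N≤M) e
          ... | inj₁ p , _ | inj₂ (τ , f , v∈) = L-∉P (up f) v∈ p
          ... | inj₂ (τ' , vτ' , xR) , _ | inj₁ (i , a , a< , refl) =
                B-clean (λ j → shift (vτ' j)) (<-≤-trans a< N≤M) (λ e → <⇒≢ (<-≤-trans a< (m≤m+n N (τ' i))) (sym e)) xR
          ... | inj₂ (τ' , vτ' , xR) , _ | inj₂ (τ , f , v∈) =
                L-clean (λ j → shift (vτ' j)) (up f) (λ i e → <⇒≢ (<-≤-trans (f i) (m≤m+n N (τ' i))) (sym e)) xR v∈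
          grow-τ : ∀ {τ : Fin d → ℕ} → (∀ i → τ i < N) → ∀ i → τ i < N + h
          grow-τ f i = <-≤-trans (f i) (m≤m+n N h)
          used' : ∀ {u} → u ∈ vs ++ used → Below (N + h) u ⊎ u ∈ xs ++ W
          used' m with ∈-++⁻ vs m
          used' m | inj₁ m' with parts m'
          ... | inj₁ (inj₁ (j , b , b< , e)) = inj₁ (inj₁ (j , N + b , +-monoʳ-< N b< , e))
          ... | inj₁ (inj₂ (τ , vτ , v∈)) = inj₁ (inj₂ ((λ i → N + τ i) , (λ i → +-monoʳ-< N (vτ i)) , v∈))
          ... | inj₂ x = inj₂ (∈-++⁺ˡ x)
          used' m | inj₂ m' with used-ok m'
          ... | inj₁ (inj₁ (i , a , a< , e)) = inj₁ (inj₁ (i , a , <-≤-trans a< (m≤m+n N h) , e))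
          ... | inj₁ (inj₂ (τ , f , v∈)) = inj₁ (inj₂ (τ , grow-τ f , v∈))
          ... | inj₂ w = inj₂ (∈-++⁺ʳ xs w)
          W' : ∀ {w} → w ∈ xs ++ W → Outer (N + h) w
          W' m with ∈-++⁻ xs m
          W' m | inj₁ x with extra x
          ... | inj₁ p , _ = inj₁ p
          ... | inj₂ (τ , vτ , xR) , _ = inj₂ ((λ i → N + τ i) , (λ i → +-monoʳ-< N (vτ i)) , xR)
          W' m | inj₂ w with W-ok w
          ... | inj₁ p = inj₁ p
          ... | inj₂ (τ , f , v∈) = inj₂ (τ , grow-τ f , v∈)

        -- `cap` bounds the unprotected vertices ever used: it is `t₁` when rare colours supply the
        -- pieces and `length P` when popular ones do.
        Supply : ℕ → Set
        Supply cap = ∀ {h B'} (2≤h : 2 ≤ h) (C' : CleanBox P q L h B') p W → Large p →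
          length W + crosscut p ≤ cap → room p ≤ h → InBox.Comp 2≤h C' (pattern-of r p) W (crosscut p)

        Goal : ℕ → List HGraph → List V → Set
        Goal cap Hs used = ∃ λ ps → ∃ λ N → ∃ λ W → Hs ≡ map (pattern-of r) ps × All Large ps ×
          Progress used N W × N + rooms ps ≤ M × length W + weights ps ≤ cap

        supply-all : ∀ {cap} → Supply cap → ∀ Hs used → Goal cap Hs used → ∃ λ vs → Realizes (⨆ Hs) vs × Disjoint vs used
        supply-all {cap} sup = assemble (Goal cap) step
          where
          step : ∀ {H Hs used} → Goal cap (H ∷ Hs) used → ∃ λ vs → Realizes H vs × Disjoint vs used × Goal cap Hs (vs ++ used)
          step (p ∷ ps , N , W , refl , lg ∷ lgs , Pr , rm , bud) =
            let le : N + room p ≤ M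
                le = ≤-trans (+-monoʳ-≤ N (m≤m+n (room p) _)) rm
                K = sup (2≤room p) (slice N (room p) le) p W lg (≤-trans (+-monoʳ-≤ (length W) (m≤m+n _ _)) bud) ≤-refl
                vs , W' , R , dj , Pr' , lW = advance le (2≤room p) Pr K
            in vs , R , dj , ps , N + room p , W' , refl , lgs , Pr' ,
               ≤-trans (≤-reflexive (+-assoc N (room p) _)) rm ,
               ≤-trans (+-monoˡ-≤ (weights ps) lW) (≤-trans (≤-reflexive (lem (crosscut p) (length W) (weights ps))) bud)
            where
            lem : ∀ a b c → a + b + c ≡ b + (a + c)
            lem = solve-∀

        realize-dense : ∀ b ℓ ps → 5 ≤ ℓ → All Large ps → weights (pathOrCycle b ℓ ∷ ps) ≡ t₁ →
          rooms (pathOrCycle b ℓ ∷ ps) ≤ M → ∃ λ vs → Realizes (⨆ (map (pattern-of r) (pathOrCycle b ℓ ∷ ps))) vs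
        realize-dense b ℓ ps 5≤ℓ lgs wt rm = by-case (q ≤? 2)
          where
          p₁ = pathOrCycle b ℓ
          init : Progress [] 0 []
          init = record { N≤M = z≤n ; used-ok = λ () ; W-ok = λ () }
          le₁ : 0 + room p₁ ≤ M
          le₁ = ≤-trans (m≤m+n (room p₁) _) rm
          q≤σ : q ≤ 2 → q ≤ suc ℓ / 2
          q≤σ h = let s , _ , e = large-form 5≤ℓ in ≤-trans h (≤-trans (≤-trans (n≤1+n 2) (m≤m+n 3 s)) (≤-reflexive (sym e)))
          by-case : Dec (q ≤ 2) → ∃ λ vs → Realizes (⨆ (map (pattern-of r) (p₁ ∷ ps))) vs
          by-case (no q>2) =
            let vs , R , _ = supply-all {t₁} (λ 2≤h C' p W lg cap rm → InBox.rare-piece 2≤h C' p W lg (≰⇒> q>2) cap rm)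
                               _ [] (p₁ ∷ ps , 0 , [] , refl , 5≤ℓ ∷ lgs , init , rm , ≤-reflexive wt)
            in vs , R
          by-case (yes q≤2) =
            let cap₁ : suc ℓ / 2 ∸ q ≤ length P
                cap₁ = ≤-trans (∸-monoˡ-≤ q (≤-trans (m≤m+n _ (weights ps)) (≤-reflexive (trans wt (sym PL-size))))) (≤-reflexive (m+n∸n≡m (length P) q))
                K = InBox.popular-piece-Q (2≤room p₁) (slice 0 (room p₁) le₁) b ℓ [] q q≤2 ≤-refl 5≤ℓ cap₁ ≤-refl
                vs , W , R , _ , Pr , lW = advance le₁ (2≤room p₁) init K
                -- The first piece spent `q` popular colours less than its crosscut number, and the
                -- crosscut numbers sum to `t₁`, which is `length P + q`; so the popular colours
                -- suffice exactly.
                budget : length W + weights ps ≤ length P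
                budget = ≤-trans (+-monoˡ-≤ (weights ps) (≤-trans lW (≤-reflexive (+-identityʳ _)))) (+-cancelʳ-≤ q _ _
                  (≤-reflexive (trans (lem (suc ℓ / 2 ∸ q) (weights ps) q) (trans (cong (_+ weights ps) (m∸n+n≡m (q≤σ q≤2))) (trans wt (sym PL-size))))))
                vs' , R' , dj = supply-all {length P} (λ 2≤h C' p W lg cap rm → InBox.popular-piece 2≤h C' p W lg cap rm)
                               (map (pattern-of r) ps) (vs ++ []) (ps , room p₁ , W , refl , lgs , Pr , rm , budget)
            in vs ++ vs' , Realizes-⊔ R R' (λ a b → dj b (∈-++⁺ˡ a))
            where
            lem : ∀ a b c → a + b + c ≡ a + c + b
            lem = solve-∀

-- Greedy embedding when all codegrees in the shadow are large.

module Greedy where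

  open Lists
  open Hyper
  open Pattern
  open Embedding using (Piece; pathOrCycle; star; pattern-of; Large)
  open import Data.List.Relation.Binary.Pointwise using (Pointwise; []; _∷_)

  -- Each new edge adds at most `d` vertices to the avoided list; the three further multiples of `d`
  -- leave room for the starting edge.
  cost : ℕ → Piece → ℕ
  cost d (pathOrCycle _ ℓ) = (3 + ℓ) * d
  cost d (star k)          = (3 + k) * d

  -- `verts` enters because the vertices of a placed piece are avoided by all later ones.
  costs : ℕ → List Piece → ℕ
  costs d []       = 0
  costs d (p ∷ ps) = cost d p + (verts (pattern-of (suc d) p) + costs d ps)

  module GreedyCase {n d d₀ : ℕ} (d≡ : 2 + d₀ ≡ d) (E : List (Fin n) → Bool) (hyp : IsHypergraph n (suc d) E)
               (D : ℕ) (v₀ : Fin n) (full : Core.Full E hyp D D) where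

    open Core E hyp D
    open Realization v₀ Edge (suc d₀) public

    private
      r∸2 : suc d ∸ 2 ≡ suc d₀
      r∸2 = cong (_∸ 1) (sym d≡)

      front : ∀ (pre : List V) {y ys} → (pre ++ y ∷ ys) ⊆ (y ∷ (pre ++ ys))
      front pre {y} {ys} m with ∈-insert⁻ pre [ y ] {ys} m
      ... | inj₁ (here e) = here e
      ... | inj₂ m' = there m'

      back : ∀ (pre : List V) {y ys} → (y ∷ (pre ++ ys)) ⊆ (pre ++ y ∷ ys)
      back pre (here e) = ∈-++⁺ʳ pre (here e)
      back pre {y} {ys} (there m) = [ ∈-++⁺ˡ , (λ a → ∈-++⁺ʳ pre (there a)) ]′ (∈-++⁻ pre m)

      Fresh : List V → List V → List V → Set
      Fresh U pre ys = Unique ys × Disjoint ys U × Edge (pre ++ ys)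

    -- The vertices outside pre can be replaced one at a time, since each d-set of the edge is full.
    refresh : ∀ pre ys U → Edge (pre ++ ys) → length (pre ++ ys) ≡ suc d → length U + length ys ≤ D →
      ∃ λ ys' → length ys' ≡ length ys × Fresh U pre ys'
    refresh pre [] U ed l le = [] , refl , [] , (λ ()) , ed
    refresh pre (y ∷ ys) U ed l le = replace (avoid U (nbrs-Unique (pre ++ ys))
        (<-≤-trans (m<m+n (length U) (s≤s z≤n)) (≤-trans le (full (pre ++ ys) lf y (E-resp (front pre) (back pre) ed)))))
      where
      lf : length (pre ++ ys) ≡ d
      lf = suc-injective (trans (sym (trans (length-++ pre) (trans (+-suc (length pre) (length ys)) (cong suc (sym (length-++ pre)))))) l)
      replace : (∃ λ y' → y' ∈ nbrs (pre ++ ys) × y' ∉ U) → ∃ λ ys' → length ys' ≡ suc (length ys) × Fresh U pre ys'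
      replace (y' , y'∈ , y'∉) = gather (refresh (pre ++ [ y' ]) ys (y' ∷ U)
          (subst Edge (sym (++-assoc pre [ y' ] ys)) (E-resp (back pre) (front pre) (nbrs-∈ y'∈)))
          (trans (cong length (++-assoc pre [ y' ] ys)) (trans (length-++ pre) (trans (sym (length-++ pre {y ∷ ys})) l)))
          (≤-trans (≤-reflexive (sym (+-suc (length U) (length ys)))) le))
        where
        gather : (∃ λ ys'' → length ys'' ≡ length ys × Fresh (y' ∷ U) (pre ++ [ y' ]) ys'') →
          ∃ λ ys' → length ys' ≡ suc (length ys) × Fresh U pre ys'
        gather (ys'' , l'' , u , dj , ed'') = y' ∷ ys'' , cong suc l'' , Unique-∷ (λ m → dj m (here refl)) u ,
          (λ { (here refl) m → y'∉ m ; (there m) m' → dj m (there m') }) , subst Edge (++-assoc pre [ y' ] ys'') ed''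

    refresh-∷ : ∀ {k} pre ys U → length ys ≡ suc k → Edge (pre ++ ys) → length (pre ++ ys) ≡ suc d →
      length U + suc k ≤ D → ∃ λ y' → ∃ λ ys' → length ys' ≡ k × Fresh U pre (y' ∷ ys')
    refresh-∷ {k} pre ys U ly ed l le = uncons (refresh pre ys U ed l (≤-trans (≤-reflexive (cong (length U +_) ly)) le))
      where
      uncons : (∃ λ ys' → length ys' ≡ length ys × Fresh U pre ys') → ∃ λ y' → ∃ λ ys' → length ys' ≡ k × Fresh U pre (y' ∷ ys')
      uncons ([] , e , _)        = ⊥-elim (0≢1+n (trans e ly))
      uncons (y' ∷ ys' , e , fr) = y' , ys' , suc-injective (trans e ly) , fr

    private
      swap₂ : ∀ {a b : V} {l} → (a ∷ b ∷ l) ⊆ (b ∷ a ∷ l)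
      swap₂ (here e) = there (here e)
      swap₂ (there (here e)) = here e
      swap₂ (there (there m)) = there (there m)

      perm₁ : ∀ {a b c : V} {l} → (a ∷ b ∷ c ∷ l) ⊆ (b ∷ c ∷ a ∷ l)
      perm₁ (here e) = there (there (here e))
      perm₁ (there (here e)) = here e
      perm₁ (there (there (here e))) = there (here e)
      perm₁ (there (there (there m))) = there (there (there m))

      perm₂ : ∀ {a b c : V} {l} → (b ∷ c ∷ a ∷ l) ⊆ (a ∷ b ∷ c ∷ l)
      perm₂ (here e) = there (here e)
      perm₂ (there (here e)) = there (there (here e))
      perm₂ (there (there (here e))) = here e
      perm₂ (there (there (there m))) = there (there (there m))

      perm₃ : ∀ {a b c : V} {l} → (a ∷ b ∷ c ∷ l) ⊆ (a ∷ c ∷ b ∷ l)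
      perm₃ (here e) = here e
      perm₃ (there m) = there (swap₂ m)

      len₂ : ∀ {k} → k ≡ suc d₀ → suc (suc k) ≡ suc d
      len₂ refl = cong suc d≡

      room₁ : ∀ x {a} (k : ℕ) → a ≤ d → x + suc k * d ≤ D → x + a ≤ D
      room₁ x k a≤ le = ≤-trans (+-monoʳ-≤ x (≤-trans a≤ (m≤m+n d (k * d)))) le

      suc-d₀≤d : suc d₀ ≤ d
      suc-d₀≤d = ≤-trans (n≤1+n _) (≤-reflexive d≡)

      1≤d : 1 ≤ d
      1≤d = ≤-trans (s≤s z≤n) (≤-reflexive d≡)

      suc-d≤ : ∀ j → suc d ≤ (3 + j) * d
      suc-d≤ j = ≤-trans (+-monoˡ-≤ d 1≤d) (+-monoʳ-≤ d (m≤m+n d _))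

    -- The start `b` may lie in `U`, as it was chosen earlier and counts as occupied.
    WalkAvoiding : ℕ → V → V → List V → Set
    WalkAvoiding ℓ b a U = ∃ λ bs → ∃ λ exs → Walk b a ℓ bs exs × Unique (bs ++ concat exs) ×
      (∀ {v} → v ∈ bs ++ concat exs → v ≡ b ⊎ v ∉ U)

    prepend : ∀ {ℓ b b' a ex U} → Hyperedge b b' ex → Unique ex → Disjoint ex (b' ∷ U) → b ∈ U → b' ∉ U →
      WalkAvoiding ℓ b' a (b' ∷ (ex ++ U)) → WalkAvoiding (suc ℓ) b a U
    prepend {ℓ} {b} {b'} {a} {ex} {U} he ux djx b∈ b'∉ (bs , exs , W , uq , prov) =
      b ∷ bs , ex ∷ exs , he ∷ W ,
      Unique-∷ (λ m → [ (λ x → djx x (there b∈)) , (λ x → out x (here refl)) ]′ (∈-insert⁻ bs ex m))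
        (Unique-insert bs uq ux (λ x y → out y (there x))) , prov'
      where
      out : ∀ {v} → v ∈ bs ++ concat exs → v ∉ b ∷ ex
      out m m' with prov m
      out m (here refl) | inj₁ refl = b'∉ b∈
      out m (there x)   | inj₁ refl = djx x (here refl)
      out m (here refl) | inj₂ v∉   = v∉ (there (∈-++⁺ʳ ex b∈))
      out m (there x)   | inj₂ v∉   = v∉ (there (∈-++⁺ˡ x))
      prov' : ∀ {v} → v ∈ (b ∷ bs) ++ (ex ++ concat exs) → v ≡ b ⊎ v ∉ U
      prov' (here e) = inj₁ e
      prov' (there m) with ∈-insert⁻ bs ex m
      ... | inj₁ x = inj₂ λ y → djx x (there y)
      ... | inj₂ x with prov x
      ...   | inj₁ refl = inj₂ b'∉
      ...   | inj₂ v∉   = inj₂ λ y → v∉ (there (∈-++⁺ʳ ex y))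

    private
      lU : ∀ {b' : V} (U ex : List V) → length ex ≡ suc d₀ → length (b' ∷ (ex ++ U)) ≡ length U + d
      lU U ex lx = trans (cong suc (trans (length-++ ex) (cong (_+ length U) lx))) (trans (lem d₀ (length U)) (cong (length U +_) d≡))
        where
        lem : ∀ x y → suc (suc x + y) ≡ y + (2 + x)
        lem = solve-∀

    -- All vertices of the walk share edges with the hub a, so that it can be closed at any time.
    return-walk : ∀ j a b rest U → Edge (a ∷ b ∷ rest) → length rest ≡ suc d₀ → a ∈ U → b ∈ U →
      length U + suc j * d ≤ D → WalkAvoiding (suc j) b a U
    return-walk zero a b rest U ed l a∈ b∈ le =
      let ex , lx , u , dj , ed' = refresh (b ∷ a ∷ []) rest U (E-resp swap₂ swap₂ ed) (len₂ l)
                                     (room₁ (length U) 0 (≤-trans (≤-reflexive l) suc-d₀≤d) le)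
      in b ∷ [] , ex ∷ [] , (trans lx l , ed') ∷ stop ,
         subst (λ x → Unique (b ∷ x)) (sym (++-identityʳ ex)) (Unique-∷ (λ m → dj m b∈) u) ,
         λ { (here e) → inj₁ e ; (there m) → inj₂ (dj (subst (_ ∈_) (++-identityʳ ex) m)) }
    return-walk (suc j) a b rest U ed l a∈ b∈ le =
      extend (refresh-∷ (a ∷ b ∷ []) rest U l ed (len₂ l) (room₁ (length U) (suc j) suc-d₀≤d le))
      where
      rm : ∀ {k} → k ≡ d₀ → suc (length U) + suc k ≤ D
      rm refl = ≤-trans (≤-reflexive (trans (sym (+-suc (length U) (suc d₀))) (cong (length U +_) d≡)))
        (room₁ (length U) (suc j) ≤-refl le)
      extend : (∃ λ b' → ∃ λ rest' → length rest' ≡ d₀ × Fresh U (a ∷ b ∷ []) (b' ∷ rest')) → WalkAvoiding (2 + j) b a U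
      extend (b' , rest' , lr' , ur , djr , edr) =
        -- The edge through `a`, `b`, `b'` is kept as the link to the hub; the walk itself takes a
        -- copy in which the hub and the other vertices have been exchanged for new ones.
        further (refresh (b ∷ b' ∷ []) (a ∷ rest') (b' ∷ U) (E-resp perm₁ perm₂ edr) (len₂ (cong suc lr')) (rm lr'))
        where
        further : (∃ λ ex → length ex ≡ suc (length rest') × Fresh (b' ∷ U) (b ∷ b' ∷ []) ex) → WalkAvoiding (2 + j) b a U
        further (ex , lx , ux , djx , edx) = prepend (lx' , edx) ux djx b∈ (djr (here refl))
          (return-walk j a b' (b ∷ rest') (b' ∷ (ex ++ U)) (E-resp perm₃ perm₃ edr) (cong suc lr')
            (there (∈-++⁺ʳ ex a∈)) (here refl)
            (≤-trans (≤-reflexive (trans (cong (_+ suc j * d) (lU {b'} U ex lx')) (+-assoc (length U) d (suc j * d)))) le))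
          where
          lx' : length ex ≡ suc d₀
          lx' = trans lx (cong suc lr')

    close-walk : ∀ {ℓ a b ex f rest U} → Disjoint (a ∷ f) U → Disjoint (b ∷ rest) (a ∷ U) →
      Disjoint ex (a ∷ b ∷ U) → Hyperedge a b ex → Unique ex → WalkAvoiding ℓ b a (a ∷ b ∷ (ex ++ U)) →
      ∃ λ bs → ∃ λ exs → Walk a a (suc ℓ) bs exs × Unique (bs ++ concat exs) × Disjoint (bs ++ concat exs) U
    close-walk {a = a} {b} {ex} {U = U} dj dj' djx he ux (bs , exs , W , uq , prov) = a ∷ bs , ex ∷ exs , he ∷ W ,
        Unique-∷ (λ m → [ (λ x → djx x (here refl)) , a∉ ]′ (∈-insert⁻ bs ex m)) (Unique-insert bs uq ux ex∉) , av
      where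
      a∉ : a ∉ bs ++ concat exs
      a∉ m with prov m
      ... | inj₁ refl = dj' (here refl) (here refl)
      ... | inj₂ v∉ = v∉ (here refl)
      ex∉ : Disjoint ex (bs ++ concat exs)
      ex∉ x m with prov m
      ... | inj₁ refl = djx x (there (here refl))
      ... | inj₂ v∉ = v∉ (there (there (∈-++⁺ˡ x)))
      av : Disjoint ((a ∷ bs) ++ (ex ++ concat exs)) U
      av (here refl) y = dj (here refl) y
      av (there m) y with ∈-insert⁻ bs ex m
      ... | inj₁ x = djx x (there (there y))
      ... | inj₂ x with prov x
      ...   | inj₁ refl = dj' (here refl) (there y)
      ...   | inj₂ v∉ = v∉ (there (there (∈-++⁺ʳ ex y)))

    Rays : ℕ → V → List V → Set
    Rays k z U = ∃ λ leaves → ∃ λ exs → length leaves ≡ k × Pointwise (Hyperedge z) leaves exs ×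
      Unique (leaves ++ concat exs) × Disjoint (leaves ++ concat exs) U

    prepend-ray : ∀ {k z y ex U} → Hyperedge z y ex → Unique (y ∷ ex) → Disjoint (y ∷ ex) U →
      Rays k z ((y ∷ ex) ++ U) → Rays (suc k) z U
    prepend-ray {z = z} {y} {ex} {U} he u dj (leaves , exs , num , rays , uq , djr) =
      y ∷ leaves , ex ∷ exs , cong suc num , he ∷ rays ,
      Unique-∷ (λ m → [ Unique-head u , (λ x → djr x (here refl)) ]′ (∈-insert⁻ leaves ex m))
        (Unique-insert leaves uq (Unique-tail u) (λ x m → djr m (there (∈-++⁺ˡ x)))) , av
      where
      av : Disjoint ((y ∷ leaves) ++ (ex ++ concat exs)) U
      av (here refl) m = dj (here refl) m
      av (there m) m' with ∈-insert⁻ leaves ex m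
      ... | inj₁ x = dj (there x) m'
      ... | inj₂ x = djr x (there (∈-++⁺ʳ ex m'))

    -- All rays are refreshed copies of one and the same edge through the centre.
    greedy-rays : ∀ k z f U → Edge (z ∷ f) → length f ≡ d → z ∈ U → length U + k * d ≤ D → Rays k z U
    greedy-rays zero    z f U ed lf z∈ le = [] , [] , refl , [] , [] , λ ()
    greedy-rays (suc k) z f U ed lf z∈ le =
      let y , ex , lx , u , dj , ed' = refresh-∷ [ z ] f U (trans lf (sym d≡)) ed (cong suc lf)
            (room₁ (length U) k (≤-reflexive d≡) le)
      in prepend-ray (lx , ed') u dj (greedy-rays k z f ((y ∷ ex) ++ U) ed lf (there (∈-++⁺ʳ ex z∈))
            (≤-trans (≤-reflexive (trans (cong (_+ k * d) (lU {y} U ex lx)) (+-assoc (length U) d (k * d)))) le))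

    module _ (e₀ : List V) (e₀-len : length e₀ ≡ suc d) (e₀-edge : Edge e₀) where

      Cycle : ℕ → List V → Set
      Cycle ℓ U = ∃ λ a → ∃ λ bs → ∃ λ exs → Walk a a ℓ bs exs × Unique (bs ++ concat exs) × Disjoint (bs ++ concat exs) U

      -- One edge through `a` and `b` is used twice: a refreshed copy is the first edge of the
      -- cycle, and the original ties `b` to the hub `a` for the way back.
      greedy-cycle : ∀ j U → length U + (3 + j) * d ≤ D → Cycle (2 + j) U
      greedy-cycle j U le = first (refresh-∷ [] e₀ U e₀-len e₀-edge e₀-len rm₁)
        where
        rm₁ : length U + suc d ≤ D
        rm₁ = ≤-trans (+-monoʳ-≤ (length U) (suc-d≤ j)) le
        rm₂ : suc (length U) + (2 + d₀) ≤ D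
        rm₂ = ≤-trans (≤-reflexive (trans (sym (+-suc (length U) (2 + d₀))) (cong (λ x → length U + suc x) d≡))) rm₁
        lem₁ : ∀ u x → 2 + u + suc x ≡ u + suc (2 + x)
        lem₁ = solve-∀
        rm₃ : ∀ {k} → k ≡ suc d₀ → 2 + length U + k ≤ D
        rm₃ refl = ≤-trans (≤-reflexive (trans (lem₁ (length U) d₀) (cong (λ x → length U + suc x) d≡))) rm₁
        rm₄ : ∀ {b} ex → length ex ≡ suc d₀ → suc (length (b ∷ (ex ++ U))) + suc j * d ≤ D
        rm₄ {b} ex lx = ≤-trans (≤-reflexive (trans (cong (λ x → suc x + suc j * d) (lU {b} U ex lx)) (lem₂ (length U) d (suc j * d))))
          (≤-trans (+-monoʳ-≤ (length U) (+-monoˡ-≤ (d + suc j * d) 1≤d)) le)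
          where
          lem₂ : ∀ u x y → suc (u + x) + y ≡ u + (1 + (x + y))
          lem₂ = solve-∀
        third : ∀ {a f b rest} → Disjoint (a ∷ f) U → Disjoint (b ∷ rest) (a ∷ U) → Edge (a ∷ b ∷ rest) → length rest ≡ suc d₀ →
          (∃ λ ex → length ex ≡ length rest × Fresh (a ∷ b ∷ U) (a ∷ b ∷ []) ex) → Cycle (2 + j) U
        third {a} {b = b} {rest} dj dj' ed lr (ex , lx , ux , djx , edx) = a , close-walk dj dj' djx (trans lx lr , edx) ux
          (return-walk j a b rest (a ∷ b ∷ (ex ++ U)) ed lr (here refl) (there (here refl)) (rm₄ {b} ex (trans lx lr)))
        second : ∀ {a f} → Disjoint (a ∷ f) U → (∃ λ b → ∃ λ rest → length rest ≡ suc d₀ × Fresh (a ∷ U) [ a ] (b ∷ rest)) → Cycle (2 + j) U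
        second {a} dj (b , rest , lr , _ , dj' , ed) =
          third dj dj' ed lr (refresh (a ∷ b ∷ []) rest (a ∷ b ∷ U) ed (len₂ lr) (rm₃ lr))
        first : (∃ λ a → ∃ λ f → length f ≡ d × Fresh U [] (a ∷ f)) → Cycle (2 + j) U
        first (a , f , lf , _ , dj , ed) = second dj (refresh-∷ [ a ] f (a ∷ U) (trans lf (sym d≡)) ed (cong suc lf) rm₂)

      greedy-piece : ∀ p U → Large p → length U + cost d p ≤ D → ∃ λ vs → Realizes (pattern-of (suc d) p) vs × Disjoint vs U
      greedy-piece (pathOrCycle false (suc (suc j))) U lg le =
        from (greedy-cycle j U (≤-trans (+-monoʳ-≤ (length U) (*-monoˡ-≤ d (+-monoʳ-≤ 3 (m≤n+m j 2)))) le))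
        where
        from : Cycle (2 + j) U → ∃ λ vs → Realizes (Qexp (suc d) false (2 + j)) vs × Disjoint vs U
        from (a , bs , exs , W , uq , dj) = bs ++ concat exs , realizes-cycle (suc d) r∸2 W uq , dj
      greedy-piece (pathOrCycle true (suc j)) U lg le =
        from (greedy-cycle j U (≤-trans (+-monoʳ-≤ (length U) (*-monoˡ-≤ d (+-monoʳ-≤ 3 (n≤1+n j)))) le))
        where
        from : Cycle (2 + j) U → ∃ λ vs → Realizes (Qexp (suc d) true (suc j)) vs × Disjoint vs U
        from (a , bs , exs , W , uq , dj) =
          let vs , R , sub = realizes-cycle-path (suc d) r∸2 W uq in vs , R , λ m m' → dj (sub m) m'
      greedy-piece (pathOrCycle false (suc zero)) U (s≤s ()) le
      greedy-piece (star k) U lg le =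
        let z , f , lf , u , dj , ed = refresh-∷ [] e₀ U e₀-len e₀-edge e₀-len (≤-trans (+-monoʳ-≤ (length U) (suc-d≤ k)) le)
        in from (dj (here refl)) (greedy-rays k z f (z ∷ U) ed lf (here refl)
              (≤-trans (≤-reflexive (sym (+-suc (length U) (k * d)))) (≤-trans (+-monoʳ-≤ (length U)
                (+-mono-≤ {1} 1≤d (≤-trans (m≤n+m (k * d) d) (m≤n+m (d + k * d) d)))) le)))
        where
        from : ∀ {z} → z ∉ U → Rays k z (z ∷ U) → ∃ λ vs → Realizes (expansion (suc d) (starG k)) vs × Disjoint vs U
        from {z} z∉ (leaves , exs , refl , rays , uq , djr) = (z ∷ leaves) ++ concat exs ,
          realizes-star (suc d) r∸2 rays uq (λ m → djr m (here refl)) ,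
          λ { (here refl) m → z∉ m ; (there m) m' → djr m (there m') }

      realize-greedy : ∀ ps → All Large ps → costs d ps ≤ D → ∃ λ vs → Realizes (⨆ (map (pattern-of (suc d)) ps)) vs
      realize-greedy ps lgs le =
        let vs , R , _ = assemble Φ step _ [] (ps , refl , lgs , le) in vs , R
        where
        Φ : List HGraph → List V → Set
        Φ Hs used = ∃ λ ps → Hs ≡ map (pattern-of (suc d)) ps × All Large ps × length used + costs d ps ≤ D
        lem : ∀ a b c → a + b + c ≡ b + (a + c)
        lem = solve-∀
        step : ∀ {H Hs used} → Φ (H ∷ Hs) used → ∃ λ vs → Realizes H vs × Disjoint vs used × Φ Hs (vs ++ used)
        step {used = used} (p ∷ ps , refl , lg ∷ lgs , le) =
          let vs , R , dj = greedy-piece p used lg (≤-trans (+-monoʳ-≤ (length used) (m≤m+n (cost d p) _)) le)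
          in vs , R , dj , ps , refl , lgs ,
             ≤-trans (≤-reflexive (trans (cong (_+ costs d ps) (trans (length-++ vs) (cong (_+ length used) (len R))))
               (lem (verts (pattern-of (suc d) p)) (length used) (costs d ps))))
               (≤-trans (+-monoʳ-≤ (length used) (m≤n+m (verts (pattern-of (suc d) p) + costs d ps) (cost d p))) le)

-- Vertex sets as lists; counting sets and cliques.

module Subsets where

  open Lists
  open Hyper
  open import Data.Nat.Combinatorics using (_C_; nCk+nC[k+1]≡[n+1]C[k+1])
  open import Data.Bool.Properties using (T-∧; ∧-zeroʳ)
  open import Data.Fin.Subset using (Subset; ⁅_⁆; _∪_; ∣_∣; inside; outside) renaming (⊥ to ∅; _∈_ to _∈ₛ_; _∉_ to _∉ₛ_; _⊆_ to _⊆ₛ_)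
  open import Data.Fin.Subset.Properties using (∪-identityˡ; x∈⁅x⁆; x∈⁅y⁆⇒x≡y; x∈p∪q⁻; x∈p∪q⁺; ∉⊥; ∣⊥∣≡0; drop-∷-⊆; drop-there) renaming (_∈?_ to _∈ₛ?_; ⊆-antisym to ⊆ₛ-antisym)
  open import Data.Vec as Vec using (Vec; []; _∷_; here; there)
  import Data.Vec.Properties as Vecₚ
  open import Function.Bundles using (Equivalence)

  T-∧⁻ : ∀ {a b} → T (a ∧ b) → T a × T b
  T-∧⁻ = Equivalence.to T-∧

  T-∧⁺ : ∀ {a b} → T a → T b → T (a ∧ b)
  T-∧⁺ a b = Equivalence.from T-∧ (a , b)

  C-zero : ∀ n → n C 0 ≡ 1
  C-zero n = refl

  C-mono₁ : ∀ n k → n C k ≤ suc n C k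
  C-mono₁ n zero    = ≤-reflexive (trans (C-zero n) (sym (C-zero (suc n))))
  C-mono₁ n (suc k) = ≤-trans (m≤n+m _ _) (≤-reflexive (nCk+nC[k+1]≡[n+1]C[k+1] n k))

  C-mono : ∀ {m n} k → m ≤ n → m C k ≤ n C k
  C-mono {m} {zero}  k z≤n = ≤-refl
  C-mono {m} {suc n} k le with m≤n⇒m<n∨m≡n le
  ... | inj₁ (s≤s lt) = ≤-trans (C-mono k lt) (C-mono₁ n k)
  ... | inj₂ refl     = ≤-refl

  module _ {n : ℕ} where

    toSet : List (Fin n) → Subset n
    toSet = foldr (λ x acc → ⁅ x ⁆ ∪ acc) ∅

    ∈-toSet⁺ : ∀ {l x} → x ∈ l → x ∈ₛ toSet l
    ∈-toSet⁺ {y ∷ l} (here refl) = x∈p∪q⁺ (inj₁ (x∈⁅x⁆ y))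
    ∈-toSet⁺ {y ∷ l} (there m)   = x∈p∪q⁺ (inj₂ (∈-toSet⁺ m))

    ∈-toSet⁻ : ∀ l {x} → x ∈ₛ toSet l → x ∈ l
    ∈-toSet⁻ []      m = ⊥-elim (∉⊥ m)
    ∈-toSet⁻ (y ∷ l) m = [ (λ a → here (x∈⁅y⁆⇒x≡y y a)) , (λ a → there (∈-toSet⁻ l a)) ]′ (x∈p∪q⁻ ⁅ y ⁆ (toSet l) m)

    toSet-cong : ∀ {l l'} → l ⊆ l' → l' ⊆ l → toSet l ≡ toSet l'
    toSet-cong {l} {l'} a b = ⊆ₛ-antisym (λ m → ∈-toSet⁺ (a (∈-toSet⁻ l m))) (λ m → ∈-toSet⁺ (b (∈-toSet⁻ l' m)))

  insert-∈ : ∀ {n} {x : Fin n} {p : Subset n} → x ∈ₛ p → ⁅ x ⁆ ∪ p ≡ p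
  insert-∈ {p = p} m = ⊆ₛ-antisym
    (λ a → [ (λ b → subst (_∈ₛ p) (sym (x∈⁅y⁆⇒x≡y _ b)) m) , id ]′ (x∈p∪q⁻ _ p a)) (λ a → x∈p∪q⁺ (inj₂ a))

  insert-∉ : ∀ {n} {x : Fin n} {p : Subset n} → x ∉ₛ p → ∣ ⁅ x ⁆ ∪ p ∣ ≡ suc ∣ p ∣
  insert-∉ {x = zero}  {inside ∷ p}  h = ⊥-elim (h here)
  insert-∉ {x = zero}  {outside ∷ p} h = cong (λ q → suc ∣ q ∣) (∪-identityˡ p)
  insert-∉ {x = suc x} {inside ∷ p}  h = cong suc (insert-∉ (h ∘ there))
  insert-∉ {x = suc x} {outside ∷ p} h = insert-∉ (h ∘ there)

  ∣insert∣≤ : ∀ {n} (x : Fin n) (p : Subset n) → ∣ ⁅ x ⁆ ∪ p ∣ ≤ suc ∣ p ∣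
  ∣insert∣≤ x p with x ∈ₛ? p
  ... | yes m = ≤-trans (≤-reflexive (cong ∣_∣ (insert-∈ m))) (n≤1+n _)
  ... | no ¬m = ≤-reflexive (insert-∉ ¬m)

  ∣toSet∣≤ : ∀ {n} (l : List (Fin n)) → ∣ toSet l ∣ ≤ length l
  ∣toSet∣≤ {n} []  = ≤-reflexive (∣⊥∣≡0 n)
  ∣toSet∣≤ (x ∷ l) = ≤-trans (∣insert∣≤ x (toSet l)) (s≤s (∣toSet∣≤ l))

  ∣toSet∣-Unique : ∀ {n} {l : List (Fin n)} → Unique l → ∣ toSet l ∣ ≡ length l
  ∣toSet∣-Unique {n} {[]}    u = ∣⊥∣≡0 n
  ∣toSet∣-Unique {n} {x ∷ l} u = trans (insert-∉ (Unique-head u ∘ ∈-toSet⁻ l)) (cong suc (∣toSet∣-Unique (Unique-tail u)))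

  toSet-Unique : ∀ {n} (l : List (Fin n)) → length l ≤ ∣ toSet l ∣ → Unique l
  toSet-Unique []      le = []
  toSet-Unique (x ∷ l) le with x ∈ₛ? toSet l
  ... | yes m = ⊥-elim (1+n≰n (≤-trans le (≤-trans (≤-reflexive (cong ∣_∣ (insert-∈ m))) (∣toSet∣≤ l))))
  ... | no ¬m = Unique-∷ (¬m ∘ ∈-toSet⁺) (toSet-Unique l (≤-pred (≤-trans le (∣insert∣≤ x (toSet l)))))

  elems : ∀ {n} → Subset n → List (Fin n)
  elems {n} p = filter (_∈ₛ? p) (allFin n)

  elems-∈⁻ : ∀ {n} (p : Subset n) {x} → x ∈ elems p → x ∈ₛ p
  elems-∈⁻ {n} p m = proj₂ (∈-filter⁻ (_∈ₛ? p) {xs = allFin n} m)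

  elems-Unique : ∀ {n} (p : Subset n) → Unique (elems p)
  elems-Unique {n} p = Uniq.filter⁺ (_∈ₛ? p) (Uniq.allFin⁺ n)

  toSet-elems : ∀ {n} (p : Subset n) → toSet (elems p) ≡ p
  toSet-elems {n} p = ⊆ₛ-antisym (λ m → elems-∈⁻ p (∈-toSet⁻ (elems p) m))
    (λ m → ∈-toSet⁺ (∈-filter⁺ (_∈ₛ? p) (∈-allFin _) m))

  length-elems : ∀ {n} (p : Subset n) → length (elems p) ≡ ∣ p ∣
  length-elems p = trans (sym (∣toSet∣-Unique (elems-Unique p))) (cong ∣_∣ (toSet-elems p))

  ∈-subsets : ∀ {n} (p : Subset n) → p ∈ subsets n
  ∈-subsets []          = here refl
  ∈-subsets (true ∷ p)  = ∈-++⁺ˡ (∈-map⁺ (true ∷_) (∈-subsets p))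
  ∈-subsets (false ∷ p) = ∈-++⁺ʳ (map (true ∷_) (subsets _)) (∈-map⁺ (false ∷_) (∈-subsets p))

  subsets-Unique : ∀ n → Unique (subsets n)
  subsets-Unique zero    = [] ∷ []
  subsets-Unique (suc n) = Unique-++ (Uniq.map⁺ Vecₚ.∷-injectiveʳ (subsets-Unique n)) (Uniq.map⁺ Vecₚ.∷-injectiveʳ (subsets-Unique n)) apart
    where
    apart : ∀ {v} → v ∈ map (true ∷_) (subsets n) → v ∈ map (false ∷_) (subsets n) → ⊥
    apart a b with ∈-map⁻ (true ∷_) a | ∈-map⁻ (false ∷_) b
    ... | _ , _ , refl | _ , _ , ()

  ∑-subsets : ∀ n (w : Subset (suc n) → ℕ) →
    ∑ (subsets (suc n)) w ≡ ∑ (subsets n) (w ∘ (true ∷_)) + ∑ (subsets n) (w ∘ (false ∷_))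
  ∑-subsets n w = trans (∑-++ (map (true ∷_) (subsets n)) _ w) (cong₂ _+_ (∑-map (true ∷_) (subsets n) w) (∑-map (false ∷_) (subsets n) w))

  ⊆ᵇ⇒⊆ : ∀ {n} (p q : Subset n) → T (p ⊆ᵇ q) → p ⊆ₛ q
  ⊆ᵇ⇒⊆ (true ∷ p)  (true ∷ q)  h here      = here
  ⊆ᵇ⇒⊆ (true ∷ p)  (true ∷ q)  h (there m) = there (⊆ᵇ⇒⊆ p q h m)
  ⊆ᵇ⇒⊆ (false ∷ p) (_ ∷ q)     h (there m) = there (⊆ᵇ⇒⊆ p q h m)

  ⊆⇒⊆ᵇ : ∀ {n} (p q : Subset n) → p ⊆ₛ q → T (p ⊆ᵇ q)
  ⊆⇒⊆ᵇ []          []          h = _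
  ⊆⇒⊆ᵇ (true ∷ p)  (true ∷ q)  h = ⊆⇒⊆ᵇ p q (drop-∷-⊆ h)
  ⊆⇒⊆ᵇ (true ∷ p)  (false ∷ q) h with h here
  ... | ()
  ⊆⇒⊆ᵇ (false ∷ p) (_ ∷ q)     h = ⊆⇒⊆ᵇ p q (drop-∷-⊆ h)

  -- The number of j-sets between an a-set f and f ∪ N, where N has n elements.
  between : ℕ → ℕ → ℕ → ℕ
  between n zero    j       = n C j
  between n (suc a) zero    = 0
  between n (suc a) (suc j) = between n a j

  between-mono : ∀ n a j → between n a j ≤ between (suc n) a j
  between-mono n zero    j       = C-mono₁ n j
  between-mono n (suc a) zero    = z≤n
  between-mono n (suc a) (suc j) = between-mono n a j

  between-step : ∀ n a j → between n a j + between n a (suc j) ≤ between (suc n) a (suc j)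
  between-step n zero    j       = ≤-reflexive (nCk+nC[k+1]≡[n+1]C[k+1] n j)
  between-step n (suc a) zero    = between-mono n a 0
  between-step n (suc a) (suc j) = between-step n a j

  between-+ : ∀ n a k → between n a (a + k) ≡ n C k
  between-+ n zero    k = refl
  between-+ n (suc a) k = between-+ n a k

  -- This is f ⊆ S ⊆ f ∪ N, computed coordinatewise so that the count can follow the recursion of
  -- `subsets`.
  inBetween : ∀ {n} → Subset n → Subset n → Subset n → Bool
  inBetween []      []      []      = true
  inBetween (f ∷ p) (b ∷ N) (s ∷ S) = (not f ∨ s) ∧ ((f ∨ (not s ∨ b)) ∧ inBetween p N S)

  ∑-false : ∀ {A : Set} (xs : List A) → ∑ xs (λ _ → 0) ≡ 0
  ∑-false xs = trans (∑-const xs 0) (*-zeroʳ (length xs))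

  ∑-subsets-≤ : ∀ n (w : Subset (suc n) → ℕ) {a b} → ∑ (subsets n) (w ∘ (true ∷_)) ≤ a →
    ∑ (subsets n) (w ∘ (false ∷_)) ≤ b → ∑ (subsets (suc n)) w ≤ a + b
  ∑-subsets-≤ n w p q = ≤-trans (≤-reflexive (∑-subsets n w)) (+-mono-≤ p q)

  ∑-∧-false : ∀ {A : Set} (xs : List A) (p : A → Bool) → ∑ xs (λ x → 𝟙 (p x ∧ false)) ≤ 0
  ∑-∧-false xs p = ≤-reflexive (trans (∑-cong xs (λ x → cong 𝟙 (∧-zeroʳ (p x)))) (∑-false xs))

  -- Only an inequality, since `N` may meet `f` and such elements offer no choice.
  count-between : ∀ {n} (f N : Subset n) j →
    ∑ (subsets n) (λ S → 𝟙 (inBetween f N S ∧ (∣ S ∣ ≡ᵇ j))) ≤ between (∣ N ∣) (∣ f ∣) j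
  count-between [] [] zero    = s≤s z≤n
  count-between [] [] (suc j) = z≤n
  count-between {suc n} (true ∷ f) (b ∷ N) zero =
    ∑-subsets-≤ n _ (∑-∧-false (subsets n) (inBetween f N)) (≤-reflexive (∑-false (subsets n)))
  count-between {suc n} (true ∷ f) (b ∷ N) (suc j) = ≤-trans
    (∑-subsets-≤ n _ (count-between f N j) (≤-reflexive (∑-false (subsets n))))
    (≤-trans (≤-reflexive (+-identityʳ _)) (grow b))
    where
    grow : ∀ b → between (∣ N ∣) (∣ f ∣) j ≤ between (∣ b ∷ N ∣) (∣ f ∣) j
    grow true  = between-mono (∣ N ∣) (∣ f ∣) j
    grow false = ≤-refl
  count-between {suc n} (false ∷ f) (false ∷ N) j =
    ∑-subsets-≤ n _ (≤-reflexive (∑-false (subsets n))) (count-between f N j)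
  count-between {suc n} (false ∷ f) (true ∷ N) zero = ≤-trans
    (∑-subsets-≤ n _ (∑-∧-false (subsets n) (inBetween f N)) (count-between f N zero))
    (between-mono (∣ N ∣) (∣ f ∣) 0)
  count-between {suc n} (false ∷ f) (true ∷ N) (suc j) = ≤-trans
    (∑-subsets-≤ n _ (count-between f N j) (count-between f N (suc j))) (between-step (∣ N ∣) (∣ f ∣) j)

  inBetween⁺ : ∀ {n} (f N S : Subset n) → f ⊆ₛ S → (∀ {x} → x ∈ₛ S → x ∉ₛ f → x ∈ₛ N) → T (inBetween f N S)
  inBetween⁺ [] [] [] h k = _
  inBetween⁺ (true ∷ f) (b ∷ N) (true ∷ S) h k =
    inBetween⁺ f N S (drop-∷-⊆ h) (λ m m' → drop-there (k (there m) (m' ∘ drop-there)))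
  inBetween⁺ (true ∷ f) (b ∷ N) (false ∷ S) h k with h here
  ... | ()
  inBetween⁺ (false ∷ f) (b ∷ N) (true ∷ S) h k with k here (λ ())
  ... | here = inBetween⁺ f N S (drop-∷-⊆ h) (λ m m' → drop-there (k (there m) (m' ∘ drop-there)))
  inBetween⁺ (false ∷ f) (b ∷ N) (false ∷ S) h k =
    inBetween⁺ f N S (drop-∷-⊆ h) (λ m m' → drop-there (k (there m) (m' ∘ drop-there)))

  count-sized : ∀ n j → ∑ (subsets n) (λ S → 𝟙 (∣ S ∣ ≡ᵇ j)) ≡ n C j
  count-sized zero    zero    = refl
  count-sized zero    (suc j) = refl
  count-sized (suc n) zero    = trans (∑-subsets n _) (trans (cong₂ _+_ (∑-false (subsets n)) (count-sized n 0))
    (trans (C-zero n) (sym (C-zero (suc n)))))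
  count-sized (suc n) (suc j) = trans (∑-subsets n _)
    (trans (cong₂ _+_ (count-sized n j) (count-sized n (suc j))) (nCk+nC[k+1]≡[n+1]C[k+1] n j))

  fold-all⁻ : {A : Set} (p : A → Bool) (xs : List A) → T (foldr _∧_ true (map p xs)) → ∀ {x} → x ∈ xs → T (p x)
  fold-all⁻ p (x ∷ xs) h (here refl) = proj₁ (T-∧⁻ h)
  fold-all⁻ p (x ∷ xs) h (there m)   = fold-all⁻ p xs (proj₂ (T-∧⁻ {p x} h)) m

  fold-all⁺ : {A : Set} (p : A → Bool) (xs : List A) → (∀ x → T (p x)) → T (foldr _∧_ true (map p xs))
  fold-all⁺ p []       h = _
  fold-all⁺ p (x ∷ xs) h = T-∧⁺ (h x) (fold-all⁺ p xs h)

  imp⁻ : ∀ {a b} → T (not a ∨ b) → T a → T b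
  imp⁻ {true} h _ = h

  imp⁺ : ∀ {a b} → (T a → T b) → T (not a ∨ b)
  imp⁺ {true}  h = h _
  imp⁺ {false} h = _

  module _ {r n : ℕ} (G : RGraph r n) where

    clique⁻ : ∀ s S → T (isCliqueᵇ G s S) → ∣ S ∣ ≡ s × (∀ A → A ⊆ₛ S → ∣ A ∣ ≡ r → T (E G A))
    clique⁻ s S h =
      ≡ᵇ⇒≡ ∣ S ∣ s (proj₁ (T-∧⁻ h)) ,
      λ A sub e → imp⁻ (fold-all⁻ _ (subsets n) (proj₂ (T-∧⁻ {∣ S ∣ ≡ᵇ s} h)) (∈-subsets A)) (T-∧⁺ (⊆⇒⊆ᵇ A S sub) (≡⇒≡ᵇ ∣ A ∣ r e))

    clique⁺ : ∀ s S → ∣ S ∣ ≡ s → (∀ A → A ⊆ₛ S → ∣ A ∣ ≡ r → T (E G A)) → T (isCliqueᵇ G s S)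
    clique⁺ s S e h = T-∧⁺ (≡⇒≡ᵇ ∣ S ∣ s e) (fold-all⁺ _ (subsets n) λ A → imp⁺ {(A ⊆ᵇ S) ∧ (∣ A ∣ ≡ᵇ r)} λ t →
      let a , b = T-∧⁻ {A ⊆ᵇ S} t in h A (⊆ᵇ⇒⊆ A S a) (≡ᵇ⇒≡ ∣ A ∣ r b))

    numKs-∑ : ∀ s → numKs s G ≡ ∑ (subsets n) (λ S → 𝟙 (isCliqueᵇ G s S))
    numKs-∑ s = length-filterᵇ (isCliqueᵇ G s) (subsets n)

    listE : List (Fin n) → Bool
    listE l = E G (toSet l)

    isHypergraph : IsHypergraph n r listE
    isHypergraph = record
      { E-resp = λ a b h → subst (T ∘ E G) (toSet-cong a b) h
      ; E-uniq = λ l len h → toSet-Unique l (≤-reflexive (trans len (sym (unif G (toSet l) h)))) }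

-- Deleting d-sets of small codegree.

module Peel where

  open Lists
  open Boxes
  open Clean
  open Hyper
  open Pattern
  open Subsets
  open import Data.Nat.Combinatorics using (_C_)
  open import Data.Bool.Properties using (T?)
  open import Data.Fin.Subset using (Subset; ⁅_⁆; _∪_; ∣_∣) renaming (_∈_ to _∈ₛ_; _⊆_ to _⊆ₛ_)
  open import Data.Fin.Subset.Properties using (x∈⁅y⁆⇒x≡y; x∈p∪q⁻; x∈p∪q⁺; anySubset?)
  open import Data.Vec as Vec using (Vec; []; _∷_; toList)
  open import Data.Vec.Properties using (lookup∘tabulate; lookup⇒[]=; toList∘fromList)

  ∑-strict : {A : Set} (xs : List A) {f g : A → ℕ} → (∀ x → f x ≤ g x) → ∀ {x} → x ∈ xs → f x < g x → ∑ xs f < ∑ xs g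
  ∑-strict (y ∷ xs) h (here refl) lt = +-mono-<-≤ lt (∑-mono xs λ x _ → h x)
  ∑-strict (y ∷ xs) h (there m)   lt = +-mono-≤-< (h y) (∑-strict xs h m lt)

  ∑□-allVec : {V : Set} (A : List V) (k : ℕ) (w : Vec V k → ℕ) → ∑□ (Vec.replicate k A) w ≡ ∑ (allVec A k) w
  ∑□-allVec A zero    w = sym (+-identityʳ _)
  ∑□-allVec A (suc k) w = trans (∑-cong A λ x → ∑□-allVec A k (w ∘ (x ∷_))) (sym (go A))
    where
    go : ∀ xs → ∑ (Data.List.cartesianProductWith _∷_ xs (allVec A k)) w ≡ ∑ xs (λ x → ∑ (allVec A k) (w ∘ (x ∷_)))
    go []       = refl
    go (x ∷ xs) = trans (∑-++ (map (x ∷_) (allVec A k)) _ w) (cong₂ _+_ (∑-map (x ∷_) (allVec A k) w) (go xs))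

  ∣tabulate∣ : ∀ {n m} (g : Fin n → Fin m) (p : Fin m → Bool) →
    ∣ Vec.tabulate (p ∘ g) ∣ ≡ ∑ (Data.List.tabulate g) (𝟙 ∘ p)
  ∣tabulate∣ {zero}  g p = refl
  ∣tabulate∣ {suc n} g p with p (g zero)
  ... | true  = cong suc (∣tabulate∣ (g ∘ suc) p)
  ... | false = ∣tabulate∣ (g ∘ suc) p

  module _ {d n : ℕ} where

    Graphₙ : Set
    Graphₙ = RGraph (suc d) n

    deg : Graphₙ → Subset n → ℕ
    deg G f = ∑ (allFin n) (λ x → 𝟙 (E G (⁅ x ⁆ ∪ f)))

    shadow : Graphₙ → Subset n → Bool
    shadow G f = (∣ f ∣ ≡ᵇ d) ∧ (1 ≤ᵇ deg G f)

    shadowSize : Graphₙ → ℕ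
    shadowSize G = ∑ (subsets n) (𝟙 ∘ shadow G)

    shadowSize≤ : ∀ G → shadowSize G ≤ n C d
    shadowSize≤ G = ≤-trans (∑-mono (subsets n) λ f _ → 𝟙-mono (proj₁ ∘ T-∧⁻)) (≤-reflexive (count-sized n d))

    nbrSet : Graphₙ → Subset n → Subset n
    nbrSet G f = Vec.tabulate (λ x → E G (⁅ x ⁆ ∪ f))

    nbrSet-∈ : ∀ G f {x} → T (E G (⁅ x ⁆ ∪ f)) → x ∈ₛ nbrSet G f
    nbrSet-∈ G f {x} h = lookup⇒[]= x (nbrSet G f) (trans (lookup∘tabulate _ x) (yes-true h))
      where
      yes-true : ∀ {b} → T b → b ≡ true
      yes-true {true} _ = refl

    _⊑_ : Graphₙ → Graphₙ → Set
    G' ⊑ G = ∀ A → T (E G' A) → T (E G A)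

    remove-edges : Graphₙ → Subset n → Graphₙ
    remove-edges G f = record { E = λ A → E G A ∧ not (f ⊆ᵇ A) ; unif = λ A h → unif G A (proj₁ (T-∧⁻ h)) }

    remove-⊑ : ∀ G f → remove-edges G f ⊑ G
    remove-⊑ G f A h = proj₁ (T-∧⁻ h)

    T-not : ∀ {b} → T (not b) → T b → ⊥
    T-not {true} ()

    ¬T⇒T-not : ∀ {b} → ¬ T b → T (not b)
    ¬T⇒T-not {true}  h = ⊥-elim (h _)
    ¬T⇒T-not {false} h = _

    -- `f` itself leaves the shadow and nothing enters it; so the shadow measures both the
    -- termination and the cost of `peel`.
    shadow-decreases : ∀ G f → T (shadow G f) → shadowSize (remove-edges G f) < shadowSize G
    shadow-decreases G f sf = ∑-strict (subsets n) le (∈-subsets f)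
      (≤-trans (s≤s (≤-reflexive zero')) (≤-reflexive (sym (𝟙-true sf))))
      where
      G' = remove-edges G f
      deg≤ : ∀ g → deg G' g ≤ deg G g
      deg≤ g = ∑-mono (allFin n) λ x _ → 𝟙-mono (remove-⊑ G f (⁅ x ⁆ ∪ g))
      le : ∀ g → 𝟙 (shadow G' g) ≤ 𝟙 (shadow G g)
      le g = 𝟙-mono λ h → let a , b = T-∧⁻ {∣ g ∣ ≡ᵇ d} h in T-∧⁺ a (≤⇒≤ᵇ (≤-trans (≤ᵇ⇒≤ 1 _ b) (deg≤ g)))
      none : deg G' f ≤ 0
      none = ≤-trans (∑-≤-const (allFin n) _ 0 λ x _ → 𝟙-mono {b = false} λ h →
          T-not (proj₂ (T-∧⁻ {E G (⁅ x ⁆ ∪ f)} h)) (⊆⇒⊆ᵇ f (⁅ x ⁆ ∪ f) (λ m → x∈p∪q⁺ (inj₂ m))))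
        (≤-reflexive (*-zeroʳ (length (allFin n))))
      zero' : 𝟙 (shadow G' f) ≡ 0
      zero' = n≤0⇒n≡0 (𝟙-mono {b = false} λ h → 1+n≰n (≤-trans (≤ᵇ⇒≤ 1 _ (proj₂ (T-∧⁻ {∣ f ∣ ≡ᵇ d} h))) none))

    -- In a clique containing `f`, each further vertex forms an edge with `f`; so the clique lies
    -- between `f` and its union with the neighbourhood.
    cliques-lost : ∀ G f a s → d < s → ∣ f ∣ ≡ d → deg G f ≤ a →
      numKs s G ≤ numKs s (remove-edges G f) + (a C (s ∸ d))
    cliques-lost G f a s d<s fd da = begin
      numKs s G                                            ≡⟨ numKs-∑ G s ⟩
      ∑ (subsets n) (λ S → 𝟙 (isCliqueᵇ G s S))            ≤⟨ ∑-mono (subsets n) (λ S _ → pointwise S) ⟩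
      ∑ (subsets n) (λ S → 𝟙 (isCliqueᵇ G' s S) + 𝟙 (inBetween f N S ∧ (∣ S ∣ ≡ᵇ s)))
                                                           ≡⟨ ∑-+ (subsets n) _ _ ⟩
      ∑ (subsets n) (λ S → 𝟙 (isCliqueᵇ G' s S)) + ∑ (subsets n) (λ S → 𝟙 (inBetween f N S ∧ (∣ S ∣ ≡ᵇ s)))
                                                           ≤⟨ +-mono-≤ (≤-reflexive (sym (numKs-∑ G' s))) count ⟩
      numKs s G' + a C (s ∸ d)                             ∎
      where
      open ≤-Reasoning
      G' = remove-edges G f
      N = nbrSet G f
      count : ∑ (subsets n) (λ S → 𝟙 (inBetween f N S ∧ (∣ S ∣ ≡ᵇ s))) ≤ a C (s ∸ d)
      count = begin
        _                                 ≤⟨ count-between f N s ⟩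
        between (∣ N ∣) (∣ f ∣) s         ≡⟨ cong₂ (between (∣ N ∣)) fd (sym (m+[n∸m]≡n (<⇒≤ d<s))) ⟩
        between (∣ N ∣) d (d + (s ∸ d))   ≡⟨ between-+ (∣ N ∣) d (s ∸ d) ⟩
        ∣ N ∣ C (s ∸ d)                   ≤⟨ C-mono (s ∸ d) (≤-trans (≤-reflexive (∣tabulate∣ id (λ x → E G (⁅ x ⁆ ∪ f)))) da) ⟩
        a C (s ∸ d)                       ∎
      pointwise : ∀ S → 𝟙 (isCliqueᵇ G s S) ≤ 𝟙 (isCliqueᵇ G' s S) + 𝟙 (inBetween f N S ∧ (∣ S ∣ ≡ᵇ s))
      pointwise S with T? (f ⊆ᵇ S)
      ... | yes f⊆ = ≤-trans (𝟙-mono λ h → let size , cl = clique⁻ G s S h in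
              T-∧⁺ (inBetween⁺ f N S (⊆ᵇ⇒⊆ f S f⊆) λ {x} x∈ x∉ → nbrSet-∈ G f
                (cl (⁅ x ⁆ ∪ f) (λ m → [ (λ a → subst (_∈ₛ S) (sym (x∈⁅y⁆⇒x≡y x a)) x∈) , ⊆ᵇ⇒⊆ f S f⊆ ]′ (x∈p∪q⁻ ⁅ x ⁆ f m))
                   (trans (insert-∉ x∉) (cong suc fd))))
                (≡⇒≡ᵇ ∣ S ∣ s size)) (m≤n+m _ _)
      ... | no f⊈ = ≤-trans (𝟙-mono λ h → let size , cl = clique⁻ G s S h in
              clique⁺ G' s S size λ A A⊆ sz → T-∧⁺ (cl A A⊆ sz)
                (¬T⇒T-not λ fA → f⊈ (⊆⇒⊆ᵇ f S (λ m → A⊆ (⊆ᵇ⇒⊆ f A fA m))))) (m≤m+n _ _)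

    FullAbove : ℕ → Graphₙ → Set
    FullAbove a G = ∀ f → ∣ f ∣ ≡ d → 1 ≤ deg G f → a < deg G f

    -- The bound is a potential inequality: one deletion loses at most `a C (s ∸ d)` cliques and
    -- shrinks the shadow by at least one. It is applied with both thresholds.
    peel : ∀ a s → d < s → ∀ m G → shadowSize G ≤ m → Σ Graphₙ λ G' → FullAbove a G' × G' ⊑ G ×
      numKs s G + (a C (s ∸ d)) * shadowSize G' ≤ numKs s G' + (a C (s ∸ d)) * shadowSize G
    peel a s d<s m G le with anySubset? (λ f → (∣ f ∣ ≟ d) ×-dec ((1 ≤? deg G f) ×-dec (deg G f ≤? a)))
    ... | no none = G , (λ f fd pos → ≰⇒> λ da → none (f , fd , pos , da)) , (λ _ → id) , ≤-refl
    ... | yes (f , fd , pos , da) = step m le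
      where
      open ≤-Reasoning
      c = a C (s ∸ d)
      G₁ = remove-edges G f
      dec : shadowSize G₁ < shadowSize G
      dec = shadow-decreases G f (T-∧⁺ (≡⇒≡ᵇ ∣ f ∣ d fd) (≤⇒≤ᵇ pos))
      chain : ∀ {x y k₀ k₁ k₂ σ} → k₀ ≤ k₁ + c → k₁ + c * x ≤ k₂ + c * y → y < σ → k₀ + c * x ≤ k₂ + c * σ
      chain {x} {y} {k₀} {k₁} {k₂} {σ} p q lt = begin
        k₀ + c * x        ≤⟨ +-monoˡ-≤ (c * x) p ⟩
        k₁ + c + c * x    ≡⟨ lem k₁ c (c * x) ⟩
        k₁ + c * x + c    ≤⟨ +-monoˡ-≤ c q ⟩
        k₂ + c * y + c    ≡⟨ lem₂ k₂ c y ⟩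
        k₂ + c * suc y    ≤⟨ +-monoʳ-≤ k₂ (*-monoʳ-≤ c lt) ⟩
        k₂ + c * σ        ∎
        where
        lem : ∀ a b c → a + b + c ≡ a + c + b
        lem = solve-∀
        lem₂ : ∀ a c y → a + c * y + c ≡ a + c * (1 + y)
        lem₂ = solve-∀
      step : ∀ m → shadowSize G ≤ m → Σ Graphₙ λ G' → FullAbove a G' × G' ⊑ G ×
        numKs s G + c * shadowSize G' ≤ numKs s G' + c * shadowSize G
      step zero    le = ⊥-elim (<⇒≱ dec (≤-trans le z≤n))
      step (suc m) le =
        let G' , full , sub , bound = peel a s d<s m G₁ (≤-pred (≤-trans dec le))
        in G' , full , (λ A h → remove-⊑ G f A (sub A h)) ,
           chain (cliques-lost G f a s d<s fd da) bound dec

    full-core : ∀ {a t} G → FullAbove a G → Core.Full (listE G) (isHypergraph G) t (suc a)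
    full-core {a} G full f lf x ed = ≤-trans
        (full (toSet f) (trans (∣toSet∣-Unique (Unique-tail (IsHypergraph.E-uniq (isHypergraph G) (x ∷ f) (cong suc lf) ed))) lf)
          (≤-trans (≤-reflexive (sym (𝟙-true ed))) (∈⇒≤∑ (allFin n) (λ x → 𝟙 (E G (⁅ x ⁆ ∪ toSet f))) (∈-allFin x))))
        (≤-reflexive (sym (length-filterᵇ (λ x → E G (⁅ x ⁆ ∪ toSet f)) (allFin n))))

    shadow-tuple : Graphₙ → Vec (Fin n) d → Bool
    shadow-tuple G ω = shadow G (toSet (toList ω))

    shadow-tuple-edge : ∀ G ω → T (shadow-tuple G ω) → ∃ λ x → T (listE G (x ∷ toList ω))
    shadow-tuple-edge G ω h =
      let x , _ , p = pigeonhole (allFin n) (λ x → 𝟙 (E G (⁅ x ⁆ ∪ toSet (toList ω)))) 0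
            (≤-trans (s≤s (≤-reflexive (*-zeroʳ (length (allFin n))))) (≤ᵇ⇒≤ 1 _ (proj₂ (T-∧⁻ {∣ toSet (toList ω) ∣ ≡ᵇ d} h))))
      in x , 𝟙-pos p

    -- One ordering per set is enough, as only positive density matters.
    shadow-tuples : ∀ G → shadowSize G ≤ ∑□ (Vec.replicate d (allFin n)) (𝟙 ∘ shadow-tuple G)
    shadow-tuples G = begin
      shadowSize G                                        ≡⟨ sym (length-filterᵇ (shadow G) (subsets n)) ⟩
      length (filterᵇ (shadow G) (subsets n))             ≤⟨ Unique-⊆-length (filterᵇ-Unique (shadow G) (subsets-Unique n)) cover ⟩
      length (map (toSet ∘ toList) tuples)                ≡⟨ length-map (toSet ∘ toList) tuples ⟩
      length tuples                                       ≡⟨ length-filterᵇ (shadow-tuple G) (allVec (allFin n) d) ⟩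
      ∑ (allVec (allFin n) d) (𝟙 ∘ shadow-tuple G)        ≡⟨ sym (∑□-allVec (allFin n) d _) ⟩
      ∑□ (Vec.replicate d (allFin n)) (𝟙 ∘ shadow-tuple G) ∎
      where
      open ≤-Reasoning
      tuples = filterᵇ (shadow-tuple G) (allVec (allFin n) d)
      vec : ∀ {k} (l : List (Fin n)) → length l ≡ k → Σ (Vec (Fin n) k) λ v → toList v ≡ l
      vec l refl = Vec.fromList l , toList∘fromList l
      cover : ∀ {f} → f ∈ filterᵇ (shadow G) (subsets n) → f ∈ map (toSet ∘ toList) tuples
      cover {f} m =
        let _ , sf = filterᵇ-∈⁻ (shadow G) (subsets n) m
            v , v≡ = vec (elems f) (trans (length-elems f) (≡ᵇ⇒≡ ∣ f ∣ d (proj₁ (T-∧⁻ sf))))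
            back : toSet (toList v) ≡ f
            back = trans (cong toSet v≡) (toSet-elems f)
        in subst (_∈ map (toSet ∘ toList) tuples) back (∈-map⁺ (toSet ∘ toList)
             (filterᵇ-∈⁺ (shadow-tuple G) (allVec (allFin n) d) (∈-allVec ∈-allFin v) (subst (T ∘ shadow G) (sym back) sf)))

    no-cliques : ∀ s G → d < s → (∀ A → ¬ T (E G A)) → numKs s G ≡ 0
    no-cliques s G d<s none = n≤0⇒n≡0 (≤-trans (≤-reflexive (numKs-∑ G s))
      (≤-trans (∑-≤-const (subsets n) _ 0 λ S _ → 𝟙-mono {b = false} λ h → impossible S (clique⁻ G s S h))
        (≤-reflexive (*-zeroʳ (length (subsets n))))))
      where
      impossible : ∀ S → ∣ S ∣ ≡ s × (∀ A → A ⊆ₛ S → ∣ A ∣ ≡ suc d → T (E G A)) → ⊥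
      impossible S (size , cl) = none (toSet l) (cl (toSet l)
          (λ m → elems-∈⁻ S (take-∈ (suc d) (∈-toSet⁻ l m)))
          (trans (∣toSet∣-Unique (Uniq.take⁺ (suc d) (elems-Unique S)))
            (length-take-≤ (suc d) (elems S) (≤-trans d<s (≤-reflexive (sym (trans (length-elems S) size)))))))
        where l = take (suc d) (elems S)

    contains : ∀ (G : Graphₙ) H v₀ m {vs} → Realization.Realizes v₀ (λ l → T (listE G l)) m H vs → Contains G H
    contains G H v₀ m {vs} R = look v₀ vs ,
      (λ x y x< y< → look-inj v₀ uniq x y (≤-trans x< (≤-reflexive (sym len))) (≤-trans y< (≤-reflexive (sym len)))) ,
      All.map (λ {e} h → subst (T ∘ E G) (sym (image-toSet (look v₀ vs) e)) (subst (λ l → T (listE G (map (look v₀ l) e))) (++-identityʳ vs) h)) (edge [])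
      where
      open Realization.Realizes R
      image-toSet : ∀ φ e → image φ e ≡ toSet (map φ e)
      image-toSet φ []      = refl
      image-toSet φ (x ∷ e) = cong (⁅ φ x ⁆ ∪_) (image-toSet φ e)

    contains-⊑ : ∀ {G' G : Graphₙ} {H} → G' ⊑ G → Contains G' H → Contains G H
    contains-⊑ sub (φ , inj , es) = φ , inj , All.map (λ {e} → sub (image φ e)) es

-- Transversals of the forbidden graph and the lower bound construction.

module Crosscut where

  open Lists
  open Subsets
  open Embedding using (Piece; pathOrCycle; star; pattern-of; crosscut; Large; weights)
  open import Data.Nat.DivMod using (m<n*o⇒m/o<n)
  open import Data.Bool.Properties using (T-∨)
  open import Data.Fin.Subset using (Subset; ⁅_⁆; _∪_; ∣_∣) renaming (_∈_ to _∈ₛ_)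
  open import Data.Vec using ([]; _∷_; here; there; zipWith; tabulate; toList)
  open import Function.Bundles using (Equivalence)

  cnt : (ℕ → Bool) → ℕ → ℕ
  cnt mark zero    = 0
  cnt mark (suc k) = 𝟙 (mark 0) + cnt (mark ∘ suc) k

  cnt-+ : ∀ mark a b → cnt mark (a + b) ≡ cnt mark a + cnt (mark ∘ (a +_)) b
  cnt-+ mark zero    b = refl
  cnt-+ mark (suc a) b = trans (cong (𝟙 (mark 0) +_) (cnt-+ (mark ∘ suc) a b)) (sym (+-assoc (𝟙 (mark 0)) _ _))

  cnt-cong : ∀ {mark mark'} → (∀ i → mark i ≡ mark' i) → ∀ k → cnt mark k ≡ cnt mark' k
  cnt-cong h zero    = refl
  cnt-cong h (suc k) = cong₂ _+_ (cong 𝟙 (h 0)) (cnt-cong (h ∘ suc) k)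

  cnt-last : ∀ mark k → cnt mark (suc k) ≡ cnt mark k + 𝟙 (mark k)
  cnt-last mark zero    = +-identityʳ _
  cnt-last mark (suc k) = trans (cong (𝟙 (mark 0) +_) (cnt-last (mark ∘ suc) k)) (sym (+-assoc (𝟙 (mark 0)) _ _))

  Hit : (ℕ → Bool) → List ℕ → Set
  Hit mark e = ∃ λ x → x ∈ e × T (mark x)

  -- `σ` is a lower bound for the transversal number: marked vertices may meet an edge more than
  -- once.
  CoverAtLeast : HGraph → ℕ → Set
  CoverAtLeast H σ = ∀ mark → All (Hit mark) (edges H) → σ ≤ cnt mark (verts H)

  cover-⊔ : ∀ {H H' σ σ'} → CoverAtLeast H σ → CoverAtLeast H' σ' → CoverAtLeast (H ⊔ H') (σ + σ')
  cover-⊔ {H} {H'} c c' mark h = ≤-trans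
    (+-mono-≤ (c mark (Allₚ.++⁻ˡ (edges H) h)) (c' (mark ∘ (verts H +_))
      (All.map (λ { (x , x∈ , t) → let y , y∈ , e = ∈-map⁻ (verts H +_) x∈ in y , y∈ , subst (T ∘ mark) e t })
        (Allₚ.map⁻ (Allₚ.++⁻ʳ (edges H) h)))))
    (≤-reflexive (sym (cnt-+ mark (verts H) (verts H'))))

  cnt-hit : ∀ {mark k i} → i < k → T (mark i) → 1 ≤ cnt mark k
  cnt-hit {mark} {suc k} {zero}  (s≤s _) t = ≤-trans (≤-reflexive (sym (𝟙-true t))) (m≤m+n _ _)
  cnt-hit {mark} {suc k} {suc i} (s≤s l) t = ≤-trans (cnt-hit l t) (m≤n+m _ _)

  edge-hit : ∀ mark m f {a b} → Hit mark (a ∷ b ∷ map (f +_) (upTo m)) →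
    1 ≤ 𝟙 (mark a) + 𝟙 (mark b) + cnt (mark ∘ (f +_)) m
  edge-hit mark m f (x , here refl , t) = ≤-trans (≤-reflexive (sym (𝟙-true t))) (≤-trans (m≤m+n _ _) (m≤m+n _ _))
  edge-hit mark m f {a} (x , there (here refl) , t) =
    ≤-trans (≤-reflexive (sym (𝟙-true t))) (≤-trans (m≤n+m _ (𝟙 (mark a))) (m≤m+n _ _))
  edge-hit mark m f {a} {b} (x , there (there m∈) , t) with ∈-map⁻ (f +_) m∈
  ... | i , i∈ , refl = ≤-trans (cnt-hit (∈-upTo⁻ i∈) t) (m≤n+m _ (𝟙 (mark a) + 𝟙 (mark b)))

  -- Hits are counted by incidences at base vertices, whereas an expansion vertex belongs to one
  -- edge and counts once.
  expand-cover : ∀ mark m f es → All (Hit mark) (expandEdges m f es) →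
    length es ≤ ∑ es (λ ab → 𝟙 (mark (proj₁ ab)) + 𝟙 (mark (proj₂ ab))) + cnt (mark ∘ (f +_)) (length es * m)
  expand-cover mark m f []             h          = z≤n
  expand-cover mark m f ((a , b) ∷ es) (hit ∷ h) = ≤-trans (+-mono-≤ (edge-hit mark m f hit) (expand-cover mark m (f + m) es h))
    (≤-reflexive (trans (lem (𝟙 (mark a) + 𝟙 (mark b)) (cnt (mark ∘ (f +_)) m) (∑ es _) _)
      (cong (λ z → 𝟙 (mark a) + 𝟙 (mark b) + ∑ es _ + z) (sym split))))
    where
    lem : ∀ x y z w → x + y + (z + w) ≡ x + z + (y + w)
    lem = solve-∀
    split : cnt (mark ∘ (f +_)) (m + length es * m) ≡ cnt (mark ∘ (f +_)) m + cnt (mark ∘ (f + m +_)) (length es * m)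
    split = trans (cnt-+ (mark ∘ (f +_)) m (length es * m))
      (cong (cnt (mark ∘ (f +_)) m +_) (cnt-cong (λ i → cong mark (sym (+-assoc f m i))) (length es * m)))

  ∑-applyUpTo : {X : Set} (g : ℕ → X) (w : X → ℕ) (mark mark' : ℕ → Bool) (k : ℕ) →
    (∀ i → w (g i) ≡ 𝟙 (mark i) + 𝟙 (mark' i)) → ∑ (applyUpTo g k) w ≡ cnt mark k + cnt mark' k
  ∑-applyUpTo g w mark mark' zero    h = refl
  ∑-applyUpTo g w mark mark' (suc k) h =
    trans (cong₂ _+_ (h 0) (∑-applyUpTo (g ∘ suc) w (mark ∘ suc) (mark' ∘ suc) k (h ∘ suc)))
      (lem (𝟙 (mark 0)) (𝟙 (mark' 0)) _ _)
    where
    lem : ∀ a b c d → a + b + (c + d) ≡ a + c + (b + d)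
    lem = solve-∀

  half-≤ : ∀ {ℓ c} → ℓ ≤ c + c → suc ℓ / 2 ≤ c
  half-≤ {ℓ} {c} h = ≤-pred (m<n*o⇒m/o<n {suc ℓ} {suc c} {2} (≤-trans (s≤s (s≤s h)) (≤-reflexive (lem c))))
    where
    lem : ∀ c → 2 + (c + c) ≡ suc c * 2
    lem = solve-∀

  -- Every vertex of the base graph lies in at most two edges.
  cover-degree-two : ∀ r F → (∀ mark → ∑ (gedges F) (λ ab → 𝟙 (mark (proj₁ ab)) + 𝟙 (mark (proj₂ ab))) ≤ cnt mark (gverts F) + cnt mark (gverts F)) →
    CoverAtLeast (expansion r F) (suc (length (gedges F)) / 2)
  cover-degree-two r F deg mark h = half-≤ (≤-trans (expand-cover mark (r ∸ 2) (gverts F) (gedges F) h)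
    (≤-trans (+-mono-≤ (deg mark) (m≤m+n x x)) (≤-reflexive (trans (lem (cnt mark (gverts F)) x) (cong (λ z → z + z) (sym (cnt-+ mark (gverts F) _)))))))
    where
    x = cnt (mark ∘ (gverts F +_)) (length (gedges F) * (r ∸ 2))
    lem : ∀ a b → a + a + (b + b) ≡ a + b + (a + b)
    lem = solve-∀

  cover-path : ∀ r ℓ → CoverAtLeast (expansion r (pathG ℓ)) (suc ℓ / 2)
  cover-path r ℓ = subst (λ k → CoverAtLeast (expansion r (pathG ℓ)) (suc k / 2))
    (trans (length-map _ (upTo ℓ)) (length-upTo ℓ)) (cover-degree-two r (pathG ℓ) deg)
    where
    deg : ∀ mark → ∑ (gedges (pathG ℓ)) (λ ab → 𝟙 (mark (proj₁ ab)) + 𝟙 (mark (proj₂ ab))) ≤ cnt mark (suc ℓ) + cnt mark (suc ℓ)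
    deg mark = ≤-trans (≤-reflexive (trans (cong (λ es → ∑ es _) (map-applyUpTo id (λ i → i , suc i) ℓ))
        (∑-applyUpTo (λ i → i , suc i) _ mark (mark ∘ suc) ℓ (λ _ → refl))))
      (+-mono-≤ (≤-trans (m≤m+n _ _) (≤-reflexive (sym (cnt-last mark ℓ)))) (m≤n+m _ (𝟙 (mark 0))))

  cover-cycle : ∀ r ℓ → CoverAtLeast (expansion r (cycleG (suc ℓ))) (suc (suc ℓ) / 2)
  cover-cycle r ℓ = subst (λ k → CoverAtLeast (expansion r (cycleG (suc ℓ))) (suc k / 2))
    (trans (length-++ (map (λ i → i , suc i) (upTo ℓ))) (trans (cong (_+ 1) (trans (length-map _ (upTo ℓ)) (length-upTo ℓ))) (+-comm ℓ 1)))
    (cover-degree-two r (cycleG (suc ℓ)) deg)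
    where
    lem : ∀ a b c d → a + b + (c + d + 0) ≡ a + c + (d + b)
    lem = solve-∀
    deg : ∀ mark → ∑ (gedges (cycleG (suc ℓ))) (λ ab → 𝟙 (mark (proj₁ ab)) + 𝟙 (mark (proj₂ ab))) ≤ cnt mark (suc ℓ) + cnt mark (suc ℓ)
    deg mark = ≤-reflexive (trans (∑-++ (map (λ i → i , suc i) (upTo ℓ)) _ _)
      (trans (cong (_+ (𝟙 (mark ℓ) + 𝟙 (mark 0) + 0)) (trans (cong (λ es → ∑ es _) (map-applyUpTo id (λ i → i , suc i) ℓ))
        (∑-applyUpTo (λ i → i , suc i) _ mark (mark ∘ suc) ℓ (λ _ → refl))))
      (trans (lem (cnt mark ℓ) (cnt (mark ∘ suc) ℓ) (𝟙 (mark ℓ)) (𝟙 (mark 0))) (cong (_+ cnt mark (suc ℓ)) (sym (cnt-last mark ℓ))))))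

  cover-star : ∀ r D → 1 ≤ D → CoverAtLeast (expansion r (starG D)) 1
  cover-star r (suc D) (s≤s z≤n) mark ((x , x∈ , t) ∷ _) = cnt-hit {mark} (bound x∈) t
    where
    N = suc (suc D)
    bound : ∀ {x} → x ∈ 0 ∷ 1 ∷ map (N +_) (upTo (r ∸ 2)) → x < N + length (gedges (starG (suc D))) * (r ∸ 2)
    bound (here refl)         = s≤s z≤n
    bound (there (here refl)) = s≤s (s≤s z≤n)
    bound (there (there m)) with ∈-map⁻ (N +_) m
    ... | i , i∈ , refl = +-monoʳ-< N (<-≤-trans (∈-upTo⁻ i∈) (m≤m+n (r ∸ 2) _))

  cover-piece : ∀ r p → Large p → CoverAtLeast (pattern-of r p) (crosscut p)
  cover-piece r (pathOrCycle true ℓ)        lg = cover-path r ℓ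
  cover-piece r (pathOrCycle false (suc ℓ)) lg = cover-cycle r ℓ
  cover-piece r (star D)                    lg = cover-star r D lg

  cover-pieces : ∀ r ps → All Large ps → CoverAtLeast (⨆ (map (pattern-of r) ps)) (weights ps)
  cover-pieces r []       []         mark h = z≤n
  cover-pieces r (p ∷ ps) (lg ∷ lgs) =
    cover-⊔ {pattern-of r p} {⨆ (map (pattern-of r) ps)} (cover-piece r p lg) (cover-pieces r ps lgs)

  meets⁻ : ∀ {n m} t (A : Subset n) (h : Fin n → Fin m) →
    T (foldr _∨_ false (toList (zipWith (λ b i → b ∧ (suc (toℕ i) ≤ᵇ t)) A (tabulate h)))) → ∃ λ i → i ∈ₛ A × toℕ (h i) < t
  meets⁻ t (b ∷ A) h p with Equivalence.to (T-∨ {b ∧ (suc (toℕ (h zero)) ≤ᵇ t)}) p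
  ... | inj₂ q = let i , i∈ , lt = meets⁻ t A (h ∘ suc) q in suc i , there i∈ , lt
  meets⁻ t (true ∷ A) h p | inj₁ q = zero , here , ≤ᵇ⇒≤ _ t q

  meets⁺ : ∀ {n m} t (A : Subset n) (h : Fin n → Fin m) {i} → i ∈ₛ A → toℕ (h i) < t →
    T (foldr _∨_ false (toList (zipWith (λ b i → b ∧ (suc (toℕ i) ≤ᵇ t)) A (tabulate h))))
  meets⁺ t (true ∷ A) h here       lt = Equivalence.from (T-∨ {suc (toℕ (h zero)) ≤ᵇ t}) (inj₁ (≤⇒≤ᵇ lt))
  meets⁺ t (b ∷ A)    h (there i∈) lt = Equivalence.from (T-∨ {b ∧ (suc (toℕ (h zero)) ≤ᵇ t)}) (inj₂ (meets⁺ t A (h ∘ suc) i∈ lt))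

  cnt-filter : ∀ mark k → cnt mark k ≡ length (filterᵇ mark (upTo k))
  cnt-filter mark k = trans (go id k) (sym (length-filterᵇ mark (upTo k)))
    where
    go : ∀ (g : ℕ → ℕ) k → cnt (mark ∘ g) k ≡ ∑ (applyUpTo g k) (𝟙 ∘ mark)
    go g zero    = refl
    go g (suc k) = cong (𝟙 (mark (g 0)) +_) (go (g ∘ suc) k)

  -- In a copy, the vertices sent into the fixed t-set meet every edge, and by injectivity there are
  -- at most `t` of them.
  Snt-free : ∀ r n t H → CoverAtLeast H (suc t) → Free (Snt r n t) H
  Snt-free r n t H cov (φ , inj , es) = 1+n≰n (≤-trans (cov mark (All.map hit es)) few)
    where
    mark : ℕ → Bool
    mark x = suc (toℕ (φ x)) ≤ᵇ t
    ∈-image : ∀ e {i} → i ∈ₛ image φ e → ∃ λ x → x ∈ e × i ≡ φ x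
    ∈-image e m = preimage e (∈-toSet⁻ (map φ e) (subst (_ ∈ₛ_) (same e) m))
      where
      same : ∀ e → image φ e ≡ toSet (map φ e)
      same []      = refl
      same (x ∷ e) = cong (⁅ φ x ⁆ ∪_) (same e)
      preimage : ∀ e {i} → i ∈ map φ e → ∃ λ x → x ∈ e × i ≡ φ x
      preimage e m = ∈-map⁻ φ m
    hit : ∀ {e} → T (E (Snt r n t) (image φ e)) → Hit mark e
    hit {e} h =
      let i , i∈ , lt = meets⁻ t (image φ e) id (proj₂ (T-∧⁻ {∣ image φ e ∣ ≡ᵇ r} h))
          x , x∈ , eq = ∈-image e i∈
      in x , x∈ , ≤⇒≤ᵇ (subst (λ j → toℕ j < t) eq lt)
    xs = filterᵇ mark (upTo (verts H))
    few : cnt mark (verts H) ≤ t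
    few = ≤-trans (≤-reflexive (trans (cnt-filter mark (verts H)) (sym (length-map (toℕ ∘ φ) xs))))
      (≤-trans (Unique-⊆-length uniq sub) (≤-reflexive (length-upTo t)))
      where
      open Embedding using (Unique-map-∈)
      below : ∀ {x} → x ∈ xs → x < verts H × toℕ (φ x) < t
      below m = let a , b = filterᵇ-∈⁻ mark (upTo (verts H)) m in ∈-upTo⁻ a , ≤ᵇ⇒≤ _ t b
      uniq : Unique (map (toℕ ∘ φ) xs)
      uniq = Unique-map-∈ (toℕ ∘ φ) (filterᵇ-Unique mark (Uniq.upTo⁺ (verts H)))
        (λ m m' e → inj _ _ (proj₁ (below m)) (proj₁ (below m')) (Finₚ.toℕ-injective e))
      sub : ∀ {y} → y ∈ map (toℕ ∘ φ) xs → y ∈ upTo t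
      sub m with ∈-map⁻ (toℕ ∘ φ) m
      ... | x , x∈ , refl = ∈-upTo⁺ (proj₂ (below x∈))

-- Cliques of the construction and binomial estimates.

module SntCount where

  open Lists
  open Subsets
  open Crosscut using (meets⁺)
  open import Data.Nat.Combinatorics using (_C_; nCk+nC[k+1]≡[n+1]C[k+1]; nC1≡n)
  open import Data.Bool.Properties using (T?)
  open import Data.Fin.Subset using (Subset; ∣_∣) renaming (⊥ to ∅; _∈_ to _∈ₛ_; _⊆_ to _⊆ₛ_)
  open import Data.Fin.Subset.Properties using (p⊆q⇒∣p∣≤∣q∣)
  open import Data.Vec using ([]; _∷_; here; there) renaming (_++_ to _++ᵥ_)
  open import Data.Vec.Properties using (++-injective)

  length-product : {A B D : Set} (f : A → B → D) (xs : List A) (ys : List B) →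
    length (cartesianProductWith f xs ys) ≡ length xs * length ys
  length-product f []       ys = refl
  length-product f (x ∷ xs) ys = trans (length-++ (map (f x) ys)) (cong₂ _+_ (length-map (f x) ys) (length-product f xs ys))

  ∣++∣ : ∀ {t m} (A : Subset t) (B : Subset m) → ∣ A ++ᵥ B ∣ ≡ ∣ A ∣ + ∣ B ∣
  ∣++∣ []          B = refl
  ∣++∣ (true ∷ A)  B = cong suc (∣++∣ A B)
  ∣++∣ (false ∷ A) B = ∣++∣ A B

  ∣∅++∣ : ∀ t {m} (B : Subset m) → ∣ ∅ {t} ++ᵥ B ∣ ≡ ∣ B ∣
  ∣∅++∣ zero    B = refl
  ∣∅++∣ (suc t) B = ∣∅++∣ t B

  high : ∀ {t m} (A : Subset t) (B : Subset m) {x} → x ∈ₛ A ++ᵥ B → ¬ (toℕ x < t) → x ∈ₛ ∅ {t} ++ᵥ B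
  high []      B m         h = m
  high (_ ∷ A) B here      h = ⊥-elim (h (s≤s z≤n))
  high (_ ∷ A) B (there m) h = there (high A B m (h ∘ s≤s))

  -- A (d+1)-set does not fit into `B`, so it meets the fixed `t` vertices.
  clique-Snt : ∀ {t m d} k (A : Subset t) (B : Subset m) → ∣ A ∣ ≡ k → ∣ B ∣ ≡ d →
    T (isCliqueᵇ (Snt (suc d) (t + m) t) (k + d) (A ++ᵥ B))
  clique-Snt {t} {m} {d} k A B eA eB = clique⁺ (Snt (suc d) (t + m) t) (k + d) (A ++ᵥ B)
    (trans (∣++∣ A B) (cong₂ _+_ eA eB)) λ X X⊆ sz → T-∧⁺ (≡⇒≡ᵇ ∣ X ∣ (suc d) sz) (meets X X⊆ sz)
    where
    meets : ∀ X → X ⊆ₛ A ++ᵥ B → ∣ X ∣ ≡ suc d → T (meetsᵇ t X)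
    meets X X⊆ sz with T? (meetsᵇ t X)
    ... | yes p = p
    ... | no ¬p = ⊥-elim (1+n≰n (≤-trans (≤-reflexive (sym sz))
          (≤-trans (p⊆q⇒∣p∣≤∣q∣ (λ {x} m → high A B (X⊆ m) (λ lt → ¬p (meets⁺ t X id m lt))))
            (≤-reflexive (trans (∣∅++∣ t B) eB)))))

  -- Only cliques with exactly `d` vertices outside the fixed set are counted. A lower bound
  -- suffices, because the upper one follows from freeness.
  Snt-lower : ∀ t m d k → (t C k) * (m C d) ≤ numKs (k + d) (Snt (suc d) (t + m) t)
  Snt-lower t m d k = begin
    (t C k) * (m C d)                     ≡⟨ sym (cong₂ _*_ (sized t k) (sized m d)) ⟩
    length (X t k) * length (X m d)       ≡⟨ sym (length-product _++ᵥ_ (X t k) (X m d)) ⟩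
    length pairs                          ≤⟨ Unique-⊆-length uniq sub ⟩
    numKs (k + d) (Snt (suc d) (t + m) t) ∎
    where
    open ≤-Reasoning
    X : ∀ n j → List (Subset n)
    X n j = filterᵇ (λ S → ∣ S ∣ ≡ᵇ j) (subsets n)
    sized : ∀ n j → length (X n j) ≡ n C j
    sized n j = trans (length-filterᵇ _ (subsets n)) (count-sized n j)
    pairs = cartesianProductWith _++ᵥ_ (X t k) (X m d)
    uniq : Unique pairs
    uniq = Uniq.cartesianProductWith⁺ _++ᵥ_ (λ {A} {A'} e → ++-injective A A' e)
      (filterᵇ-Unique _ (subsets-Unique t)) (filterᵇ-Unique _ (subsets-Unique m))
    sub : ∀ {S} → S ∈ pairs → S ∈ filterᵇ (isCliqueᵇ (Snt (suc d) (t + m) t) (k + d)) (subsets (t + m))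
    sub q with ∈-cartesianProductWith⁻ _++ᵥ_ (X t k) (X m d) q
    ... | A , B , A∈ , B∈ , refl = filterᵇ-∈⁺ _ (subsets (t + m)) (∈-subsets (A ++ᵥ B))
          (clique-Snt k A B (≡ᵇ⇒≡ ∣ A ∣ k (proj₂ (filterᵇ-∈⁻ _ (subsets t) A∈))) (≡ᵇ⇒≡ ∣ B ∣ d (proj₂ (filterᵇ-∈⁻ _ (subsets m) B∈))))

  -- The additive form of (k+1) C(n, k+1) = (n-k) C(n, k): without subtraction it follows from
  -- Pascal's rule by induction.
  absorb : ∀ n k → suc k * (n C suc k) + k * (n C k) ≡ n * (n C k)
  absorb zero    zero    = refl
  absorb zero    (suc k) = cong₂ _+_ (*-zeroʳ (suc (suc k))) (*-zeroʳ (suc k))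
  absorb (suc n) zero    = trans (cong (λ x → x + 0 + 0) (nC1≡n (suc n))) (lem (suc n))
    where
    lem : ∀ n → n + 0 + 0 ≡ n * 1
    lem = solve-∀
  absorb (suc n) (suc k) = begin
    (2 + k) * (suc n C (2 + k)) + suc k * (suc n C suc k)
      ≡⟨ cong₂ (λ a b → (2 + k) * a + suc k * b) (sym (nCk+nC[k+1]≡[n+1]C[k+1] n (suc k))) (sym (nCk+nC[k+1]≡[n+1]C[k+1] n k)) ⟩
    (2 + k) * (x + y) + suc k * (w + x)                          ≡⟨ lem₁ k w x y ⟩
    ((2 + k) * y + suc k * x) + (suc k * x + k * w) + (w + x)     ≡⟨ cong₂ (λ a b → a + b + (w + x)) (absorb n (suc k)) (absorb n k) ⟩
    n * x + n * w + (w + x)                                      ≡⟨ lem₂ n w x ⟩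
    suc n * (w + x)                                              ≡⟨ cong (suc n *_) (nCk+nC[k+1]≡[n+1]C[k+1] n k) ⟩
    suc n * (suc n C suc k)                                      ∎
    where
    open ≡-Reasoning
    w = n C k
    x = n C suc k
    y = n C suc (suc k)
    lem₁ : ∀ k w x y → (2 + k) * (x + y) + (1 + k) * (w + x) ≡ ((2 + k) * y + (1 + k) * x) + ((1 + k) * x + k * w) + (w + x)
    lem₁ = solve-∀
    lem₂ : ∀ n w x → n * x + n * w + (w + x) ≡ (1 + n) * (w + x)
    lem₂ = solve-∀

  falling : ∀ n k → suc k ! * (n C suc k) ≡ (n ∸ k) * (k ! * (n C k))
  falling n k = begin
    suc k ! * (n C suc k)                          ≡⟨ lem (suc k) (k !) (n C suc k) ⟩
    k ! * (suc k * (n C suc k))                    ≡⟨ cong (k ! *_) (sym (m+n∸n≡m _ (k * (n C k)))) ⟩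
    k ! * (suc k * (n C suc k) + k * (n C k) ∸ k * (n C k)) ≡⟨ cong (λ z → k ! * (z ∸ k * (n C k))) (absorb n k) ⟩
    k ! * (n * (n C k) ∸ k * (n C k))              ≡⟨ cong (k ! *_) (sym (*-distribʳ-∸ (n C k) n k)) ⟩
    k ! * ((n ∸ k) * (n C k))                      ≡⟨ lem₂ (k !) (n ∸ k) (n C k) ⟩
    (n ∸ k) * (k ! * (n C k))                      ∎
    where
    open ≡-Reasoning
    lem : ∀ a b c → a * b * c ≡ b * (a * c)
    lem = solve-∀
    lem₂ : ∀ a b c → a * (b * c) ≡ b * (a * c)
    lem₂ = solve-∀

  C-upper : ∀ n d → d ! * (n C d) ≤ n ^ d
  C-upper n zero    = ≤-refl
  C-upper n (suc d) = ≤-trans (≤-reflexive (falling n d)) (*-mono-≤ (m∸n≤m n d) (C-upper n d))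

  C-lower : ∀ n d → (n ∸ d) ^ d ≤ d ! * (n C d)
  C-lower n zero    = ≤-refl
  C-lower n (suc d) = ≤-trans (*-mono-≤ (∸-monoʳ-≤ n (n≤1+n d)) (≤-trans (^-monoˡ-≤ d (∸-monoʳ-≤ n (n≤1+n d))) (C-lower n d)))
    (≤-reflexive (sym (falling n d)))

  -- Bernoulli's inequality (1 - a/n)^d ≥ 1 - da/n, multiplied by n^(d+1).
  bernoulli : ∀ n a d → n * n ^ d ≤ n * (n ∸ a) ^ d + d * a * n ^ d
  bernoulli n a zero    = m≤m+n (n * 1) _
  bernoulli n a (suc d) = begin
    n * (n * n ^ d)                              ≤⟨ *-monoʳ-≤ n (bernoulli n a d) ⟩
    n * (n * x + d * a * n ^ d)                  ≤⟨ *-monoʳ-≤ n (+-monoˡ-≤ _ (*-monoˡ-≤ x (m≤n+m∸n n a))) ⟩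
    n * ((a + (n ∸ a)) * x + d * a * n ^ d)      ≡⟨ lem n a (n ∸ a) x d (n ^ d) ⟩
    n * ((n ∸ a) * x) + (d * a * (n * n ^ d) + a * (n * x)) ≤⟨ +-monoʳ-≤ (n * ((n ∸ a) * x)) (+-monoʳ-≤ (d * a * (n * n ^ d)) (*-monoʳ-≤ a (*-monoʳ-≤ n (^-monoˡ-≤ d (m∸n≤m n a))))) ⟩
    n * ((n ∸ a) * x) + (d * a * (n * n ^ d) + a * (n * n ^ d)) ≡⟨ lem₂ (n * ((n ∸ a) * x)) d a (n * n ^ d) ⟩
    n * ((n ∸ a) * x) + suc d * a * (n * n ^ d)  ∎
    where
    open ≤-Reasoning
    x = (n ∸ a) ^ d
    lem : ∀ n a b x d y → n * ((a + b) * x + d * a * y) ≡ n * (b * x) + (d * a * (n * y) + a * (n * x))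
    lem = solve-∀
    lem₂ : ∀ z d a y → z + (d * a * y + a * y) ≡ z + (1 + d) * a * y
    lem₂ = solve-∀

-- Combining the bounds.

module Final where

  open Lists
  open Boxes
  open Hyper
  open Pattern
  open Embedding
  open Greedy
  open Subsets
  open Peel
  open Crosscut
  open SntCount
  open import Data.Nat.Combinatorics using (_C_; nCn≡1; k>n⇒nCk≡0)
  open import Data.Nat.ListAction using (sum)
  open import Data.Vec using (Vec; []; _∷_; lookup; toList; zipWith)

  module Upper {d d₀ : ℕ} (d≡ : 2 + d₀ ≡ d) (s : ℕ) (d<s : d < s) (t : ℕ)
               (q₁ : Bool) (ℓ₁ : ℕ) (ps : List Piece) (5≤ℓ₁ : 5 ≤ ℓ₁) (lgs : All Large ps)
               (wt : weights (pathOrCycle q₁ ℓ₁ ∷ ps) ≡ suc t) where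

    pieces : List Piece
    pieces = pathOrCycle q₁ ℓ₁ ∷ ps

    F : HGraph
    F = ⨆ (map (pattern-of (suc d)) pieces)

    D₀ M : ℕ
    D₀ = costs d pieces
    -- The summand 2 ensures `2 ≤ M` and makes `M` visibly nonzero.
    M  = 2 + rooms pieces

    -- The case distinction on the vertices of the edge `A` only serves to obtain a default vertex
    -- for `look`.
    very-full : ∀ {n} (G : RGraph (suc d) n) → FullAbove D₀ G → ∀ A → T (E G A) → Contains G F
    very-full {n} G full A h = go n G A h (elems A) refl full
      where
      go : ∀ n (G : RGraph (suc d) n) A → T (E G A) → ∀ l → l ≡ elems A → FullAbove D₀ G → Contains G F
      go n G A h [] eq full = ⊥-elim (0≢1+n (trans (cong length eq) (trans (length-elems A) (unif G A h))))
      go n G A h (v₀ ∷ l) eq full =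
        let vs , R = GreedyCase.realize-greedy d≡ (listE G) (isHypergraph G) (suc D₀) v₀ (full-core {t = suc D₀} G full)
                       (elems A) (trans (length-elems A) (unif G A h)) (subst (T ∘ E G) (sym (toSet-elems A)) h)
                       pieces (5≤ℓ₁ ∷ lgs) (n≤1+n D₀)
        in contains G F v₀ (suc d₀) R

    dense-shadow : ∀ e {{_ : NonZero e}} → Σ ℕ λ N → ∀ n → N ≤ n → (G : RGraph (suc d) n) → FullAbove t G →
      n ^ d ≤ e * shadowSize G → Contains G F
    -- The `suc` forces `n` to be positive, so that `zero` can be the default vertex.
    dense-shadow e = suc (proj₁ box) , body
      where
      box = cleanBox d (suc t) M e
      body : ∀ n → suc (proj₁ box) ≤ n → (G : RGraph (suc d) n) → FullAbove t G → n ^ d ≤ e * shadowSize G → Contains G F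
      body (suc n) (s≤s N≤) G full dense =
        finish (proj₂ box (suc n) (m≤n⇒m≤1+n N≤) (listE G) (isHypergraph G) (full-core {t = suc t} G full) (shadow-tuple G)
          (shadow-tuple-edge G) (≤-trans dense (*-monoʳ-≤ e (shadow-tuples G))))
        where
        finish : HasCleanBox (listE G) (isHypergraph G) (suc t) M → Contains G F
        finish (P , q , L , B , box-clean) =
          let vs , R = Embed.realize-dense d≡ (listE G) (isHypergraph G) (suc t) zero (full-core {t = suc t} G full) box-clean (s≤s (s≤s z≤n))
                         q₁ ℓ₁ ps 5≤ℓ₁ lgs wt (m≤n+m (rooms pieces) 2)
          in contains G F zero (suc d₀) R

    upper : ∀ b → Σ ℕ λ N → ∀ n → N ≤ n → (G : RGraph (suc d) n) → Free G F →
      suc b * numKs s G ≤ suc b * ((t C (s ∸ d)) * (n C d)) + n ^ d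
    upper b = proj₁ dense , λ n N≤ G free → bound n N≤ G free (peel t s d<s _ G ≤-refl)
      where
      K = D₀ C (s ∸ d)
      c = t C (s ∸ d)
      -- If `small` fails, then the shadow of G₀ has density above 1/((b+1)K), which this parameter
      -- covers; the outer `suc` allows for `K` being 0.
      dense = dense-shadow (suc (suc b * K))
      bound : ∀ n → proj₁ dense ≤ n → (G : RGraph (suc d) n) → Free G F →
        (Σ (RGraph (suc d) n) λ G₀ → FullAbove t G₀ × G₀ ⊑ G × numKs s G + c * shadowSize G₀ ≤ numKs s G₀ + c * shadowSize G) →
        suc b * numKs s G ≤ suc b * (c * (n C d)) + n ^ d
      bound n N≤ G free (G₀ , full₀ , sub₀ , le₀) = begin
        suc b * numKs s G                                   ≤⟨ *-monoʳ-≤ (suc b) (≤-trans (m≤m+n _ _) le₀) ⟩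
        suc b * (numKs s G₀ + c * shadowSize G)             ≤⟨ *-monoʳ-≤ (suc b) (+-mono-≤ few (*-monoʳ-≤ c (shadowSize≤ G))) ⟩
        suc b * (K * shadowSize G₀ + c * (n C d))           ≡⟨ lem (suc b) K (shadowSize G₀) (c * (n C d)) ⟩
        suc b * (c * (n C d)) + suc b * K * shadowSize G₀   ≤⟨ +-monoʳ-≤ _ small ⟩
        suc b * (c * (n C d)) + n ^ d                       ∎
        where
        open ≤-Reasoning
        lem : ∀ b k σ x → b * (k * σ + x) ≡ b * x + b * k * σ
        lem = solve-∀
        few : numKs s G₀ ≤ K * shadowSize G₀
        few = from (peel D₀ s d<s _ G₀ ≤-refl)
          where
          from : (Σ (RGraph (suc d) n) λ G₁ → FullAbove D₀ G₁ × G₁ ⊑ G₀ ×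
                   numKs s G₀ + K * shadowSize G₁ ≤ numKs s G₁ + K * shadowSize G₀) → numKs s G₀ ≤ K * shadowSize G₀
          from (G₁ , full₁ , sub₁ , le₁) = ≤-trans (≤-trans (m≤m+n _ _) le₁)
            (≤-reflexive (cong (_+ K * shadowSize G₀) (no-cliques s G₁ d<s λ A h →
              free (contains-⊑ {G' = G₀} {G} {F} sub₀ (contains-⊑ {G' = G₁} {G₀} {F} sub₁ (very-full G₁ full₁ A h))))))
        small : suc b * K * shadowSize G₀ ≤ n ^ d
        small with suc b * K * shadowSize G₀ ≤? n ^ d
        ... | yes p = p
        ... | no ¬p = ⊥-elim (free (contains-⊑ {G' = G₀} {G} {F} sub₀ (proj₂ dense n N≤ G₀ full₀
                (≤-trans (<⇒≤ (≰⇒> ¬p)) (*-monoˡ-≤ (shadowSize G₀) (n≤1+n (suc b * K)))))))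

  module _ (d t k : ℕ) where

    private
      c = t C k
      a = t + d

    Snt-asymptotic : ∀ b → Σ ℕ λ N → ∀ n → N ≤ n →
      suc b * c * n ^ d ≤ suc b * d ! * numKs (k + d) (Snt (suc d) n t) + d ! * n ^ d
    -- Beyond `t` the fixed set fits into the vertex set, and beyond `suc b * c * (d * a)` the
    -- relative error da/n of `bernoulli` costs at most one term `n ^ d`.
    Snt-asymptotic b = suc (t + suc b * c * (d * a)) , body
      where
      open ≤-Reasoning
      body : ∀ n → suc (t + suc b * c * (d * a)) ≤ n →
        suc b * c * n ^ d ≤ suc b * d ! * numKs (k + d) (Snt (suc d) n t) + d ! * n ^ d
      body n N≤ = begin
        suc b * c * n ^ d                            ≤⟨ *-cancelˡ-≤ n {{>-nonZero (≤-trans (s≤s z≤n) N≤)}} scaled ⟩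
        suc b * c * (n ∸ a) ^ d + n ^ d              ≤⟨ +-mono-≤ main (m≤n*m (n ^ d) (d !) {{d !≢0}}) ⟩
        suc b * d ! * numKs (k + d) (Snt (suc d) n t) + d ! * n ^ d ∎
        where
        B = suc b * c
        t≤n : t ≤ n
        t≤n = ≤-trans (m≤n⇒m≤1+n (m≤m+n t _)) N≤
        scaled : n * (B * n ^ d) ≤ n * (B * (n ∸ a) ^ d + n ^ d)
        scaled = begin
          n * (B * n ^ d)                                  ≡⟨ lem₁ n B (n ^ d) ⟩
          B * (n * n ^ d)                                  ≤⟨ *-monoʳ-≤ B (bernoulli n a d) ⟩
          B * (n * (n ∸ a) ^ d + d * a * n ^ d)            ≡⟨ lem₂ B n ((n ∸ a) ^ d) (d * a) (n ^ d) ⟩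
          n * (B * (n ∸ a) ^ d) + B * (d * a) * n ^ d      ≤⟨ +-monoʳ-≤ _ (*-monoˡ-≤ (n ^ d) (≤-trans (m≤n⇒m≤1+n (m≤n+m _ t)) N≤)) ⟩
          n * (B * (n ∸ a) ^ d) + n * n ^ d                ≡⟨ sym (*-distribˡ-+ n _ _) ⟩
          n * (B * (n ∸ a) ^ d + n ^ d)                    ∎
          where
          lem₁ : ∀ n b x → n * (b * x) ≡ b * (n * x)
          lem₁ = solve-∀
          lem₂ : ∀ b n y e x → b * (n * y + e * x) ≡ n * (b * y) + b * e * x
          lem₂ = solve-∀
        m = n ∸ t
        main : B * (n ∸ a) ^ d ≤ suc b * d ! * numKs (k + d) (Snt (suc d) n t)
        main = begin
          suc b * c * (n ∸ a) ^ d            ≡⟨ cong (λ z → suc b * c * z ^ d) (sym (∸-+-assoc n t d)) ⟩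
          suc b * c * (m ∸ d) ^ d            ≤⟨ *-monoʳ-≤ (suc b * c) (C-lower m d) ⟩
          suc b * c * (d ! * (m C d))        ≡⟨ lem (suc b) c (d !) (m C d) ⟩
          suc b * d ! * (c * (m C d))        ≤⟨ *-monoʳ-≤ (suc b * d !) (Snt-lower t m d k) ⟩
          suc b * d ! * numKs (k + d) (Snt (suc d) (t + m) t) ≡⟨ cong (λ z → suc b * d ! * numKs (k + d) (Snt (suc d) z t)) (m+[n∸m]≡n t≤n) ⟩
          suc b * d ! * numKs (k + d) (Snt (suc d) n t) ∎
          where
          lem : ∀ b c f x → b * c * (f * x) ≡ b * f * (c * x)
          lem = solve-∀

  pieces-of : ∀ {k p} → Vec ℕ k → Vec Bool k → Vec ℕ p → List Piece
  pieces-of ls qs ts = toList (zipWith pathOrCycle qs ls) ++ map star (toList ts)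

  forbidden-pieces : ∀ {k p} r (ls : Vec ℕ k) (qs : Vec Bool k) (ts : Vec ℕ p) →
    forbidden r ls qs ts ≡ ⨆ (map (pattern-of r) (pieces-of ls qs ts))
  forbidden-pieces r ls qs ts = cong ⨆ (trans (cong₂ _++_ (zips ls qs) (map-∘ (toList ts)))
    (sym (map-++ (pattern-of r) (toList (zipWith pathOrCycle qs ls)) (map star (toList ts)))))
    where
    zips : ∀ {k} (ls : Vec ℕ k) (qs : Vec Bool k) →
      toList (zipWith (Qexp r) qs ls) ≡ map (pattern-of r) (toList (zipWith pathOrCycle qs ls))
    zips []       []       = refl
    zips (ℓ ∷ ls) (q ∷ qs) = cong (Qexp r q ℓ ∷_) (zips ls qs)

  pieces-Large : ∀ {k p} (ls : Vec ℕ k) (qs : Vec Bool k) (ts : Vec ℕ p) →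
    (∀ i → 5 ≤ lookup ls i) → (∀ j → 2 ≤ lookup ts j) → All Large (pieces-of ls qs ts)
  pieces-Large ls qs ts hl ht = Allₚ.++⁺ (first ls qs hl) (Allₚ.map⁺ (second ts ht))
    where
    first : ∀ {k} (ls : Vec ℕ k) (qs : Vec Bool k) → (∀ i → 5 ≤ lookup ls i) → All Large (toList (zipWith pathOrCycle qs ls))
    first []       []       h = []
    first (ℓ ∷ ls) (q ∷ qs) h = h zero ∷ first ls qs (h ∘ suc)
    second : ∀ {p} (ts : Vec ℕ p) → (∀ j → 2 ≤ lookup ts j) → All (Large ∘ star) (toList ts)
    second []       h = []
    second (D ∷ ts) h = ≤-trans (s≤s z≤n) (h zero) ∷ second ts (h ∘ suc)

  pieces-weights : ∀ {k p} (ls : Vec ℕ k) (qs : Vec Bool k) (ts : Vec ℕ p) →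
    weights (pieces-of ls qs ts) ≡ sum (map (λ ℓ → suc ℓ / 2) (toList ls)) + p
  pieces-weights []       []       ts = go ts
    where
    go : ∀ {p} (ts : Vec ℕ p) → weights (map star (toList ts)) ≡ p
    go []       = refl
    go (_ ∷ ts) = cong suc (go ts)
  pieces-weights (ℓ ∷ ls) (q ∷ qs) ts = trans (cong (suc ℓ / 2 +_) (pieces-weights ls qs ts)) (sym (+-assoc (suc ℓ / 2) _ _))

  -- Turning two additive error terms into a factor 1 + 1/b; B = 4 f (b + 1) is the precision needed.
  ratio : ∀ b f c S x X {{_ : NonZero f}} → 1 ≤ c → let B = 4 * f * suc b in
    B * f * x ≤ B * c * X + f * X → B * c * X ≤ B * f * S + f * X → suc b * x ≤ suc (suc b) * S
  ratio b f c S x X 1≤c up low = *-cancelˡ-≤ (4 * f) {{m*n≢0 4 f}} (begin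
    4 * f * (suc b * x)         ≡⟨ sym (*-assoc (4 * f) (suc b) x) ⟩
    B * x                       ≤⟨ Bx ⟩
    B * S + 2 * X               ≤⟨ +-monoʳ-≤ (B * S) (*-monoʳ-≤ 2 X≤) ⟩
    B * S + 2 * (2 * (f * S))   ≡⟨ lem₃ f b S ⟩
    4 * f * (suc (suc b) * S)   ∎)
    where
    open ≤-Reasoning
    B = 4 * f * suc b
    lem₃ : ∀ f b S → 4 * f * (1 + b) * S + 2 * (2 * (f * S)) ≡ 4 * f * ((2 + b) * S)
    lem₃ = solve-∀
    Bx : B * x ≤ B * S + 2 * X
    Bx = *-cancelˡ-≤ f (begin
      f * (B * x)              ≡⟨ lem₄ f B x ⟩
      B * f * x                ≤⟨ up ⟩
      B * c * X + f * X        ≤⟨ +-monoˡ-≤ (f * X) low ⟩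
      B * f * S + f * X + f * X ≡⟨ lem₅ B f S X ⟩
      f * (B * S + 2 * X)      ∎)
      where
      lem₄ : ∀ f b x → f * (b * x) ≡ b * f * x
      lem₄ = solve-∀
      lem₅ : ∀ b f S X → b * f * S + f * X + f * X ≡ f * (b * S + 2 * X)
      lem₅ = solve-∀
    X≤ : X ≤ 2 * (f * S)
    X≤ = *-cancelˡ-≤ (2 * f * suc b) {{m*n≢0 (2 * f) (suc b) {{m*n≢0 2 f}}}} (+-cancelʳ-≤ (2 * f * suc b * X) _ _ (begin
      2 * f * suc b * X + 2 * f * suc b * X        ≡⟨ lem₆ f b X ⟩
      B * 1 * X                                    ≤⟨ *-monoˡ-≤ X (*-monoʳ-≤ B 1≤c) ⟩
      B * c * X                                    ≤⟨ low ⟩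
      B * f * S + f * X                            ≤⟨ +-monoʳ-≤ (B * f * S) (*-monoˡ-≤ X (≤-trans (m≤n*m f 2) (m≤m*n (2 * f) (suc b)))) ⟩
      B * f * S + 2 * f * suc b * X                ≡⟨ cong (_+ 2 * f * suc b * X) (lem₇ f b S) ⟩
      2 * f * suc b * (2 * (f * S)) + 2 * f * suc b * X ∎))
      where
      lem₆ : ∀ f b X → 2 * f * (1 + b) * X + 2 * f * (1 + b) * X ≡ 4 * f * (1 + b) * 1 * X
      lem₆ = solve-∀
      lem₇ : ∀ f b S → 4 * f * (1 + b) * f * S ≡ 2 * f * (1 + b) * (2 * (f * S))
      lem₇ = solve-∀

  module Asymptotics {d d₀ : ℕ} (d≡ : 2 + d₀ ≡ d) (k : ℕ) (0<k : 0 < k) (t : ℕ)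
               (q₁ : Bool) (ℓ₁ : ℕ) (ps : List Piece) (5≤ℓ₁ : 5 ≤ ℓ₁) (lgs : All Large ps)
               (wt : weights (pathOrCycle q₁ ℓ₁ ∷ ps) ≡ suc t) where

    s : ℕ
    s = k + d

    private
      open module U = Upper d≡ s (m<n+m d 0<k) t q₁ ℓ₁ ps 5≤ℓ₁ lgs wt using (F; upper)
      c = t C k
      f = d !
      s∸d : s ∸ d ≡ k
      s∸d = m+n∸n≡m k d

    Snt-F-free : ∀ n → Free (Snt (suc d) n t) F
    Snt-F-free n = Snt-free (suc d) n t F (subst (CoverAtLeast F) wt (cover-pieces (suc d) (pathOrCycle q₁ ℓ₁ ∷ ps) (5≤ℓ₁ ∷ lgs)))

    ex-upper : ∀ b → Σ ℕ λ N → ∀ n → N ≤ n → ∀ (G : RGraph (suc d) n) → Free G F →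
      suc b * f * numKs s G ≤ suc b * c * n ^ d + f * n ^ d
    ex-upper b = proj₁ (upper b) , λ n N≤ G free → scale n (numKs s G) (proj₂ (upper b) n N≤ G free)
      where
      open ≤-Reasoning
      lem : ∀ b f x → b * f * x ≡ f * (b * x)
      lem = solve-∀
      lem₂ : ∀ f b c y z → f * (b * (c * y) + z) ≡ b * c * (f * y) + f * z
      lem₂ = solve-∀
      scale : ∀ n x → suc b * x ≤ suc b * ((t C (s ∸ d)) * (n C d)) + n ^ d → suc b * f * x ≤ suc b * c * n ^ d + f * n ^ d
      scale n x h = begin
        suc b * f * x                                       ≡⟨ lem (suc b) f x ⟩
        f * (suc b * x)                                     ≤⟨ *-monoʳ-≤ f h ⟩
        f * (suc b * ((t C (s ∸ d)) * (n C d)) + n ^ d)     ≡⟨ cong (λ j → f * (suc b * ((t C j) * (n C d)) + n ^ d)) s∸d ⟩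
        f * (suc b * (c * (n C d)) + n ^ d)                 ≡⟨ lem₂ f (suc b) c (n C d) (n ^ d) ⟩
        suc b * c * (f * (n C d)) + f * n ^ d               ≤⟨ +-monoˡ-≤ (f * n ^ d) (*-monoʳ-≤ (suc b * c) (C-upper n d)) ⟩
        suc b * c * n ^ d + f * n ^ d                       ∎

    -- The errors of order n^d can be absorbed into a factor because `k ≤ t` makes the leading
    -- coefficient `c` positive.
    ex-ratio : k ≤ t → ∀ b → Σ ℕ λ N → ∀ n → N ≤ n → ∀ (G : RGraph (suc d) n) → Free G F →
      suc b * numKs s G ≤ suc (suc b) * numKs s (Snt (suc d) n t)
    ex-ratio k≤t b = proj₁ up + proj₁ low , λ n N≤ G free →
      ratio b f c (numKs s (Snt (suc d) n t)) (numKs s G) (n ^ d) 1≤c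
        (subst (λ z → z * f * numKs s G ≤ z * c * n ^ d + f * n ^ d) B≡ (proj₂ up n (≤-trans (m≤m+n _ _) N≤) G free))
        (subst (λ z → z * c * n ^ d ≤ z * f * numKs s (Snt (suc d) n t) + f * n ^ d) B≡ (proj₂ low n (≤-trans (m≤n+m _ (proj₁ up)) N≤)))
      where
      instance
        f≢0 : NonZero f
        f≢0 = d !≢0
      B = 4 * f * suc b
      B≡ : suc (pred B) ≡ B
      B≡ = suc-pred B {{m*n≢0 (4 * f) (suc b) {{m*n≢0 4 f}}}}
      up  = ex-upper (pred B)
      low = Snt-asymptotic d t k (pred B)
      1≤c : 1 ≤ c
      1≤c = ≤-trans (≤-reflexive (sym (nCn≡1 k))) (C-mono k k≤t)

    -- The binomial coefficient in `upper` vanishes, which leaves the error term alone.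
    ex-small : t < k → ∀ b → Σ ℕ λ N → ∀ n → N ≤ n → ∀ (G : RGraph (suc d) n) → Free G F → suc b * numKs s G ≤ n ^ d
    ex-small t<k b = proj₁ (upper b) , λ n N≤ G free → ≤-trans (proj₂ (upper b) n N≤ G free)
      (≤-reflexive (cong (_+ n ^ d) (trans (cong (λ z → suc b * (z * (n C d))) (trans (cong (t C_) s∸d) (k>n⇒nCk≡0 t<k))) (*-zeroʳ (suc b)))))

    module _ (H : HGraph) (H≡F : H ≡ F) where

      private
        toF : ∀ {n} {G : RGraph (suc d) n} → Free G H → Free G F
        toF {G = G} = subst (Free G) H≡F

        Snt-H-free : ∀ n → Free (Snt (suc d) n t) H
        Snt-H-free n = subst (Free (Snt (suc d) n t)) (sym H≡F) (Snt-F-free n)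

      part-i : k ≤ t →
        (∀ b → Σ ℕ λ N → ∀ n → N ≤ n →
          (∀ (G : RGraph (suc d) n) → Free G H → suc b * numKs s G ≤ suc (suc b) * numKs s (Snt (suc d) n t)) ×
          Σ (RGraph (suc d) n) λ G → Free G H × b * numKs s (Snt (suc d) n t) ≤ suc b * numKs s G)
        ×
        (∀ b → Σ ℕ λ N → ∀ n → N ≤ n →
          (suc b * d ! * numKs s (Snt (suc d) n t) ≤ suc b * (t C k) * n ^ d + d ! * n ^ d) ×
          (suc b * (t C k) * n ^ d ≤ suc b * d ! * numKs s (Snt (suc d) n t) + d ! * n ^ d))
        ×
        (∀ b → Σ ℕ λ N → ∀ n → N ≤ n →
          (∀ (G : RGraph (suc d) n) → Free G H → suc b * d ! * numKs s G ≤ suc b * (t C k) * n ^ d + d ! * n ^ d) ×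
          Σ (RGraph (suc d) n) λ G → Free G H ×
            suc b * (t C k) * n ^ d ≤ suc b * d ! * numKs s G + d ! * n ^ d)
      part-i k≤t =
        (λ b → proj₁ (ex-ratio k≤t b) , λ n N≤ →
          (λ G free → proj₂ (ex-ratio k≤t b) n N≤ G (toF {G = G} free)) ,
          Snt (suc d) n t , Snt-H-free n , m≤n+m _ _) ,
        (λ b → proj₁ (ex-upper b) + proj₁ (Snt-asymptotic d t k b) , λ n N≤ →
          -- The construction is itself free of `F`, so its own upper bound is an instance of the
          -- general one.
          proj₂ (ex-upper b) n (≤-trans (m≤m+n _ _) N≤) (Snt (suc d) n t) (Snt-F-free n) ,
          proj₂ (Snt-asymptotic d t k b) n (≤-trans (m≤n+m _ (proj₁ (ex-upper b))) N≤)) ,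
        (λ b → proj₁ (ex-upper b) + proj₁ (Snt-asymptotic d t k b) , λ n N≤ →
          (λ G free → proj₂ (ex-upper b) n (≤-trans (m≤m+n _ _) N≤) G (toF {G = G} free)) ,
          Snt (suc d) n t , Snt-H-free n ,
          proj₂ (Snt-asymptotic d t k b) n (≤-trans (m≤n+m _ (proj₁ (ex-upper b))) N≤))

      part-ii : t < k → ∀ b → Σ ℕ λ N → ∀ n → N ≤ n → ∀ (G : RGraph (suc d) n) → Free G H → suc b * numKs s G ≤ n ^ d
      part-ii t<k b = proj₁ (ex-small t<k b) , λ n N≤ G free → proj₂ (ex-small t<k b) n N≤ G (toF {G = G} free)

open Final
open Embedding using (large-form; pathOrCycle)

open import Data.Nat.Combinatorics using (_C_)
open import Data.Nat.ListAction using (sum)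
open import Data.Vec using (Vec; []; _∷_; lookup; toList)

theorem6p2 :
    (r k p s : ℕ) (ls : Vec ℕ k) (qs : Vec Bool k) (ts : Vec ℕ p) →
    3 ≤ r → 1 ≤ k → (∀ i → 5 ≤ lookup ls i) → (∀ j → 2 ≤ lookup ts j) → r ≤ s →
    let t = tParam ls p
        F = forbidden r ls qs ts
        c = t C (s ∸ r + 1)
        f = (r ∸ 1) !
    in
    -- (i)  s ≤ t + r - 1
    (s ≤ t + r ∸ 1 →
      -- ex ≤ (1 + o(1)) 𝒩(K_s, S_{n,t})  and  ex ≥ (1 - o(1)) 𝒩(K_s, S_{n,t})
      ((∀ b → Σ ℕ λ N → ∀ n → N ≤ n →
          (∀ (G : RGraph r n) → Free G F →
             suc b * numKs s G ≤ suc (suc b) * numKs s (Snt r n t)) ×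
          Σ (RGraph r n) λ G → Free G F ×
             b * numKs s (Snt r n t) ≤ suc b * numKs s G)
      ×
      -- 𝒩(K_s, S_{n,t}) = c n^{r-1}/(r-1)! + o(n^{r-1})
      (∀ b → Σ ℕ λ N → ∀ n → N ≤ n →
          (suc b * f * numKs s (Snt r n t) ≤ suc b * c * n ^ (r ∸ 1) + f * n ^ (r ∸ 1)) ×
          (suc b * c * n ^ (r ∸ 1) ≤ suc b * f * numKs s (Snt r n t) + f * n ^ (r ∸ 1)))
      ×
      -- ex = c n^{r-1}/(r-1)! + o(n^{r-1})
      (∀ b → Σ ℕ λ N → ∀ n → N ≤ n →
          (∀ (G : RGraph r n) → Free G F →
             suc b * f * numKs s G ≤ suc b * c * n ^ (r ∸ 1) + f * n ^ (r ∸ 1)) ×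
          Σ (RGraph r n) λ G → Free G F ×
             suc b * c * n ^ (r ∸ 1) ≤ suc b * f * numKs s G + f * n ^ (r ∸ 1))))
    ×
    -- (ii)  s ≥ t + r :  ex = o(n^{r-1})
    (t + r ≤ s →
      ∀ b → Σ ℕ λ N → ∀ n → N ≤ n →
        ∀ (G : RGraph r n) → Free G F → suc b * numKs s G ≤ n ^ (r ∸ 1))
theorem6p2 r@(suc d@(suc (suc d₀))) (suc k) p s ls@(ℓ ∷ ls') qs@(q ∷ qs') ts (s≤s (s≤s (s≤s z≤n))) _ hl ht r≤s =
  (λ s≤ → subst PartI s≡ (A.part-i H H≡ (k≤t s≤))) , (λ ≤s → subst PartII s≡ (A.part-ii H H≡ (t<k ≤s)))
  where
  κ = s ∸ r + 1
  t = tParam ls p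
  H = forbidden r ls qs ts
  s≡ : κ + d ≡ s
  s≡ = trans (+-assoc (s ∸ r) 1 d) (m∸n+n≡m r≤s)
  PartI PartII : ℕ → Set
  PartI s =
      (∀ b → Σ ℕ λ N → ∀ n → N ≤ n →
          (∀ (G : RGraph r n) → Free G H → suc b * numKs s G ≤ suc (suc b) * numKs s (Snt r n t)) ×
          Σ (RGraph r n) λ G → Free G H × b * numKs s (Snt r n t) ≤ suc b * numKs s G)
      ×
      (∀ b → Σ ℕ λ N → ∀ n → N ≤ n →
          (suc b * d ! * numKs s (Snt r n t) ≤ suc b * (t C κ) * n ^ d + d ! * n ^ d) ×
          (suc b * (t C κ) * n ^ d ≤ suc b * d ! * numKs s (Snt r n t) + d ! * n ^ d))
      ×
      (∀ b → Σ ℕ λ N → ∀ n → N ≤ n →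
          (∀ (G : RGraph r n) → Free G H → suc b * d ! * numKs s G ≤ suc b * (t C κ) * n ^ d + d ! * n ^ d) ×
          Σ (RGraph r n) λ G → Free G H × suc b * (t C κ) * n ^ d ≤ suc b * d ! * numKs s G + d ! * n ^ d)
  PartII s = ∀ b → Σ ℕ λ N → ∀ n → N ≤ n → ∀ (G : RGraph r n) → Free G H → suc b * numKs s G ≤ n ^ d
  total = sum (map (λ ℓ → suc ℓ / 2) (toList ls)) + p
  1≤total : 1 ≤ total
  1≤total =
    let x , _ , e = large-form (hl Fin.zero)
    in ≤-trans (s≤s z≤n) (≤-trans (m≤m+n 3 x) (≤-trans (≤-reflexive (sym e)) (≤-trans (m≤m+n (suc ℓ / 2) _) (m≤m+n _ p))))
  -- The truncated subtraction in `tParam` is genuine because the sum is positive, so the crosscut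
  -- numbers add up to exactly t + 1.
  wt = trans (pieces-weights ls qs ts) (+-∸-assoc 1 1≤total)
  -- The head of `ls` provides the path or cycle that makes up for the missing popular colours.
  module A = Asymptotics {d} {d₀} refl κ (m≤n+m 1 (s ∸ r)) t q ℓ (pieces-of ls' qs' ts) (hl Fin.zero)
               (pieces-Large ls' qs' ts (hl ∘ Fin.suc) ht) wt
  H≡ = forbidden-pieces r ls qs ts
  k≤t : s ≤ t + r ∸ 1 → κ ≤ t
  k≤t h = +-cancelʳ-≤ d κ t (≤-trans (≤-reflexive s≡) (≤-trans h (≤-reflexive (cong (_∸ 1) (+-suc t d)))))
  t<k : t + r ≤ s → t < κ
  t<k h = +-cancelʳ-≤ d (suc t) κ (≤-trans (≤-reflexive (sym (+-suc t d))) (≤-trans h (≤-reflexive (sym s≡))))
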